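{- The first-order part of $\mathsf{WKL}_0^-$ is the same as that of $\mathsf{RCA}_0^-$, namely $\mathrm{B}\Sigma_1$; that is, for every sentence $\varphi$ of $L_1$ the following are equivalent: $\mathsf{WKL}_0^-\vdash\varphi$; $\mathsf{RCA}_0^-\vdash\varphi$; $\mathrm{B}\Sigma_1\vdash\varphi$.
   Context: **Language $L_1$ and BASIC.** $L_1$ is the first-order language with constant $0$, unary function symbols $S,H,T$, binary function symbols $+,\cdot$, a binary pairing function symbol $(\cdot,\cdot)$, and a binary relation $<$. Write $1=S(0)$, $2=S(S(0))$, and $x\le y$ for $x<y\lor x=y$. Pairing associates to the right. BASIC consists of the universal closures of: $S(x)\neq 0$; $S(x)=S(y)\to x=y$; $x+0=x$; $x+S(y)=S(x+y)$; $x\cdot 0=0$; $x\cdot S(y)=x\cdot y+x$; $\lnot x<0$; $x<S(y)\leftrightarrow x<y\lor x=y$; $x<y\lor x=y\lor y<x$; $0<x\to\exists y<x\,S(y)=x$; $(x,y)=z\leftrightarrow 2\cdot z=(x+y)\cdot(x+y+1)+2\cdot x+2$; $(x,y)=(x',y')\to x=x'\land y=y'$; $z>0\to\exists x,y<z\,(x,y)=z$; $H((x,y))=x$; $H(0)=0$; $T((x,y))=y$; $T(0)=0$. **Language $L_2$ and formula classes.** $L_2$ is the two-sorted language extending $L_1$ with set variables and atomic formulas $t\in X$. $\Delta^0_0$ formulas are the $L_2$-formulas all of whose quantifiers are bounded number quantifiers (free set variables allowed); $\Delta_0$ formulas are those without set variables; $\Sigma_1$ formulas have the form $\exists\vec y\,\theta$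 with $\theta\in\Delta_0$. **$\mathrm{B}\Sigma_1$.** $\mathrm{B}\Sigma_1$ is BASIC plus the universal closures of $\varphi(0)\land\forall x(\varphi(x)\to\varphi(x+1))\to\forall x\,\varphi(x)$ for $\varphi\in\Delta_0$ and of $\forall x{<}a\,\exists y\,\varphi(x,y)\to\exists b\,\forall x{<}a\,\exists y{<}b\,\varphi(x,y)$ for $\varphi\in\Sigma_1$ (parameters allowed). **$\mathsf{RCA}_0^-$.** $\mathrm{C}\Delta^0_0$ consists of BASIC, the induction axiom $\mathrm{IND}$ (universal closure of $0\in X\land\forall x(x\in X\to S(x)\in X)\to x\in X$), and $\mathrm{C}[\Delta^0_0]$, the universal closures of $\exists X\forall x(x\in X\leftrightarrow\varphi(x))$ for $\varphi\in\Delta^0_0$ ($X$ not free in $\varphi$; other parameters allowed). For a set $f$, $f\in\mathcal F$ abbreviates $\forall x\exists y\,(x,y)\in f\land\forall x,y,y'((x,y)\in f\land(x,y')\in f\to y=y')\land 0\notin f$; $f(x)=y$ abbreviates $(x,y)\in f$. The axiom $\circ$ is $\forall g,h\in\mathcal F\;\exists f\in\mathcal F\;\forall x,y,z\,(h(x)=z\land g(z)=y\to f(x)=y)$. $\mathsf{RCA}_0^-:=\mathrm{C}\Delta^0_0+\circ$. **Trees and WKL.** $2^x\doteq y$ denotes a $\Delta_0$ formula defining the graph of exponentiation (with the usual recurrences provable by bounded induction). A finite $0$–$1$ sequence $\langle x_0,\dots,x_{n-1}\rangle$ is coded by the number with binary representation $1x_0\ldots x_{n-1}$, so every nonzero number codes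 a sequence and $1$ codes the empty one. For $\sigma,\tau>0$, $\sigma\preceq\tau$ ($\sigma$ is an initial segment of $\tau$) means $\exists p,y\le\tau\,\exists x<p\,(2^y\doteq p\land\tau=\sigma\cdot p+x)$; $\sigma\prec\tau$ means $\sigma\preceq\tau$ and $\sigma<\tau$. A set $T$ is a (binary) tree if $0\notin T$ and $\forall\tau\in T\,\forall\sigma\prec\tau\,(\sigma\in T)$. A tree is infinite if it is unbounded (no $b$ satisfies $\forall x\in T\,x<b$). A branch is a tree linearly ordered by $\preceq$. $\mathsf{WKL}$ is the sentence: for every infinite tree $T$ there is an infinite tree $P$ such that $P$ is a branch and $P\subseteq T$. $\mathsf{WKL}_0^-:=\mathsf{RCA}_0^-+\mathsf{WKL}$. -}

module Defs where

open import Data.Nat.Base using (ℕ; zero; suc)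
open import Data.Fin.Base using (Fin; zero; suc)
open import Data.Fin.Patterns using (0F; 1F; 2F; 3F)
open import Data.List.Base using (List; map) renaming ([] to []ᶜ; _∷_ to _▹_)
open import Data.List.Membership.Propositional using () renaming (_∈_ to _∈ᶜ_)
open import Data.Vec.Functional using ([]; _∷_)
open import Function.Base using (_∘_; id)
open import Level using (0ℓ)
open import Relation.Unary using (Pred; _∪_; ｛_｝)

infixl 9 _[_]ᵗ _[_] _[_]ˢ
infixl 8 _·_
infixl 7 _+_
infix  6 _≐_ _<_ _≤_ _∈_ _∈ℱ _⟨_⟩≐_
infix  5 ¬_
infixr 4 _∧_
infixr 3 _∨_
infixr 2 _⇒_
infix  2 _↔_
infixr 1 ∀ⁿ_ ∃ⁿ_ ∀ˢ_ ∃ˢ_ ∀[<_]_ ∃[<_]_ ∃[≤_]_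
infix  0 _∣_⊢_ _⊢_

------------------------------------------------------------------------
-- Syntax

data Lang : Set where
  L₁ L₂ : Lang

data HasSets : Lang → Set where
  instance hasSets : HasSets L₂

private
  variable
    L : Lang
    m m′ n n′ : ℕ

-- Number variables are de Bruijn indices, with n of them in scope.
data Term (n : ℕ) : Set where
  var     : Fin n → Term n
  O       : Term n
  S H T   : Term n → Term n
  _+_ _·_ : Term n → Term n → Term n
  ⟪_,_⟫   : Term n → Term n → Term n

-- m set variables and n number variables are in scope.  The superscripts
-- n and s mark number and set quantifiers.  Equality is between numbers only.
data Formula (L : Lang) (m n : ℕ) : Set where
  _≐_ _<_     : Term n → Term n → Formula L m n
  _∈_         : ⦃ HasSets L ⦄ → Term n → Fin m → Formula L m n
  ⊥           : Formula L m n
  _∧_ _∨_ _⇒_ : Formula L m n → Formula L m n → Formula L m n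
  ∀ⁿ_ ∃ⁿ_     : Formula L m (suc n) → Formula L m n
  ∀ˢ_ ∃ˢ_     : ⦃ HasSets L ⦄ → Formula L (suc m) n → Formula L m n

Sentence : Lang → Set
Sentence L = Formula L 0 0

_[_]ᵗ : Term n → (Fin n → Term n′) → Term n′
var i     [ σ ]ᵗ = σ i
O         [ σ ]ᵗ = O
S t       [ σ ]ᵗ = S (t [ σ ]ᵗ)
H t       [ σ ]ᵗ = H (t [ σ ]ᵗ)
T t       [ σ ]ᵗ = T (t [ σ ]ᵗ)
(s + t)   [ σ ]ᵗ = (s [ σ ]ᵗ) + (t [ σ ]ᵗ)
(s · t)   [ σ ]ᵗ = (s [ σ ]ᵗ) · (t [ σ ]ᵗ)
⟪ s , t ⟫ [ σ ]ᵗ = ⟪ s [ σ ]ᵗ , t [ σ ]ᵗ ⟫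

wkᵗ : Term n → Term (suc n)
wkᵗ t = t [ var ∘ suc ]ᵗ

liftⁿ : (Fin n → Term n′) → Fin (suc n) → Term (suc n′)
liftⁿ σ = var zero ∷ (wkᵗ ∘ σ)

liftˢ : (Fin m → Fin m′) → Fin (suc m) → Fin (suc m′)
liftˢ ρ = zero ∷ (suc ∘ ρ)

-- Simultaneous renaming of set variables and substitution of terms for
-- number variables.
sub : (Fin m → Fin m′) → (Fin n → Term n′) → Formula L m n → Formula L m′ n′
sub ρ σ (s ≐ t) = s [ σ ]ᵗ ≐ t [ σ ]ᵗ
sub ρ σ (s < t) = s [ σ ]ᵗ < t [ σ ]ᵗ
sub ρ σ (t ∈ X) = t [ σ ]ᵗ ∈ ρ X
sub ρ σ ⊥       = ⊥
sub ρ σ (φ ∧ ψ) = sub ρ σ φ ∧ sub ρ σ ψ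
sub ρ σ (φ ∨ ψ) = sub ρ σ φ ∨ sub ρ σ ψ
sub ρ σ (φ ⇒ ψ) = sub ρ σ φ ⇒ sub ρ σ ψ
sub ρ σ (∀ⁿ φ)  = ∀ⁿ sub ρ (liftⁿ σ) φ
sub ρ σ (∃ⁿ φ)  = ∃ⁿ sub ρ (liftⁿ σ) φ
sub ρ σ (∀ˢ φ)  = ∀ˢ sub (liftˢ ρ) σ φ
sub ρ σ (∃ˢ φ)  = ∃ˢ sub (liftˢ ρ) σ φ

wkⁿ : Formula L m n → Formula L m (suc n)
wkⁿ = sub id (var ∘ suc)

wkˢ : Formula L m n → Formula L (suc m) n
wkˢ = sub suc var

inScope : Sentence L → Formula L m n
inScope = sub [] []

_[_] : Formula L m (suc n) → Term n → Formula L m n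
φ [ t ] = sub id (t ∷ var) φ

_[_]ˢ : Formula L (suc m) n → Fin m → Formula L m n
φ [ X ]ˢ = sub (X ∷ id) var φ

embed : Formula L₁ m n → Formula L₂ m n
embed (s ≐ t)       = s ≐ t
embed (s < t)       = s < t
embed (_∈_ ⦃ () ⦄ t X)
embed ⊥             = ⊥
embed (φ ∧ ψ)       = embed φ ∧ embed ψ
embed (φ ∨ ψ)       = embed φ ∨ embed ψ
embed (φ ⇒ ψ)       = embed φ ⇒ embed ψ
embed (∀ⁿ φ)        = ∀ⁿ embed φ
embed (∃ⁿ φ)        = ∃ⁿ embed φ
embed (∀ˢ_ ⦃ () ⦄ φ)
embed (∃ˢ_ ⦃ () ⦄ φ)

¬_ : Formula L m n → Formula L m n
¬ φ = φ ⇒ ⊥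

_↔_ : Formula L m n → Formula L m n → Formula L m n
φ ↔ ψ = (φ ⇒ ψ) ∧ (ψ ⇒ φ)

_≤_ : Term n → Term n → Formula L m n
s ≤ t = s < t ∨ s ≐ t

∀[<_]_ ∃[<_]_ ∃[≤_]_ : Term n → Formula L m (suc n) → Formula L m n
∀[< t ] φ = ∀ⁿ (var zero < wkᵗ t ⇒ φ)
∃[< t ] φ = ∃ⁿ (var zero < wkᵗ t ∧ φ)
∃[≤ t ] φ = ∃ⁿ (var zero ≤ wkᵗ t ∧ φ)

∀ⁿ* : ∀ n → Formula L m n → Formula L m 0
∀ⁿ* zero    φ = φ
∀ⁿ* (suc n) φ = ∀ⁿ* n (∀ⁿ φ)

∀ˢ* : ∀ m → Formula L₂ m n → Formula L₂ 0 n
∀ˢ* zero    φ = φ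
∀ˢ* (suc m) φ = ∀ˢ* m (∀ˢ φ)

pattern x₀ = var 0F
pattern x₁ = var 1F
pattern x₂ = var 2F
pattern x₃ = var 3F

𝟏 𝟐 : Term n
𝟏 = S O
𝟐 = S (S O)

------------------------------------------------------------------------
-- Classical natural deduction.  Axioms of a theory are sentences; the rules
-- keep track of the variables in scope, and eigenvariables are fresh by
-- weakening.  Set variables are the only set terms, so the bare calculus does
-- not prove that sets exist; the second-order theories below do.

Theory : Lang → Set₁
Theory L = Pred (Sentence L) 0ℓ

data _∣_⊢_ {L} (𝒯 : Theory L) {m n} (Γ : List (Formula L m n)) :
           Formula L m n → Set where
  axiom : ∀ {φ} → 𝒯 φ → 𝒯 ∣ Γ ⊢ inScope φ
  hyp   : ∀ {φ} → φ ∈ᶜ Γ → 𝒯 ∣ Γ ⊢ φ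
  raa   : ∀ {φ} → 𝒯 ∣ (¬ φ) ▹ Γ ⊢ ⊥ → 𝒯 ∣ Γ ⊢ φ
  ∧I    : ∀ {φ ψ} → 𝒯 ∣ Γ ⊢ φ → 𝒯 ∣ Γ ⊢ ψ → 𝒯 ∣ Γ ⊢ φ ∧ ψ
  ∧E₁   : ∀ {φ ψ} → 𝒯 ∣ Γ ⊢ φ ∧ ψ → 𝒯 ∣ Γ ⊢ φ
  ∧E₂   : ∀ {φ ψ} → 𝒯 ∣ Γ ⊢ φ ∧ ψ → 𝒯 ∣ Γ ⊢ ψ
  ∨I₁   : ∀ {φ ψ} → 𝒯 ∣ Γ ⊢ φ → 𝒯 ∣ Γ ⊢ φ ∨ ψ
  ∨I₂   : ∀ {φ ψ} → 𝒯 ∣ Γ ⊢ ψ → 𝒯 ∣ Γ ⊢ φ ∨ ψ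
  ∨E    : ∀ {φ ψ χ} → 𝒯 ∣ Γ ⊢ φ ∨ ψ →
          𝒯 ∣ φ ▹ Γ ⊢ χ → 𝒯 ∣ ψ ▹ Γ ⊢ χ → 𝒯 ∣ Γ ⊢ χ
  ⇒I    : ∀ {φ ψ} → 𝒯 ∣ φ ▹ Γ ⊢ ψ → 𝒯 ∣ Γ ⊢ φ ⇒ ψ
  ⇒E    : ∀ {φ ψ} → 𝒯 ∣ Γ ⊢ φ ⇒ ψ → 𝒯 ∣ Γ ⊢ φ → 𝒯 ∣ Γ ⊢ ψ
  ∀ⁿI   : ∀ {φ} → 𝒯 ∣ map wkⁿ Γ ⊢ φ → 𝒯 ∣ Γ ⊢ ∀ⁿ φ
  ∀ⁿE   : ∀ {φ} → 𝒯 ∣ Γ ⊢ ∀ⁿ φ → ∀ t → 𝒯 ∣ Γ ⊢ φ [ t ]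
  ∃ⁿI   : ∀ {φ} t → 𝒯 ∣ Γ ⊢ φ [ t ] → 𝒯 ∣ Γ ⊢ ∃ⁿ φ
  ∃ⁿE   : ∀ {φ χ} → 𝒯 ∣ Γ ⊢ ∃ⁿ φ → 𝒯 ∣ φ ▹ map wkⁿ Γ ⊢ wkⁿ χ → 𝒯 ∣ Γ ⊢ χ
  ∀ˢI   : ⦃ _ : HasSets L ⦄ → ∀ {φ} → 𝒯 ∣ map wkˢ Γ ⊢ φ → 𝒯 ∣ Γ ⊢ ∀ˢ φ
  ∀ˢE   : ⦃ _ : HasSets L ⦄ → ∀ {φ} → 𝒯 ∣ Γ ⊢ ∀ˢ φ → ∀ X → 𝒯 ∣ Γ ⊢ φ [ X ]ˢ
  ∃ˢI   : ⦃ _ : HasSets L ⦄ → ∀ {φ} X → 𝒯 ∣ Γ ⊢ φ [ X ]ˢ → 𝒯 ∣ Γ ⊢ ∃ˢ φ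
  ∃ˢE   : ⦃ _ : HasSets L ⦄ → ∀ {φ χ} → 𝒯 ∣ Γ ⊢ ∃ˢ φ →
          𝒯 ∣ φ ▹ map wkˢ Γ ⊢ wkˢ χ → 𝒯 ∣ Γ ⊢ χ
  ≐I    : ∀ {t} → 𝒯 ∣ Γ ⊢ t ≐ t
  ≐E    : ∀ {s t} φ → 𝒯 ∣ Γ ⊢ s ≐ t → 𝒯 ∣ Γ ⊢ φ [ s ] → 𝒯 ∣ Γ ⊢ φ [ t ]

_⊢_ : Theory L → Sentence L → Set
𝒯 ⊢ φ = 𝒯 ∣ []ᶜ ⊢ φ

------------------------------------------------------------------------
-- Formula classes

-- At L₂ these are the Δ⁰₀ formulas (free set variables allowed), at L₁ the
-- Δ₀ formulas.  The bound t cannot mention the quantified variable.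
data IsΔ₀ {L m n} : Formula L m n → Set where
  eq   : ∀ {s t} → IsΔ₀ (s ≐ t)
  less : ∀ {s t} → IsΔ₀ (s < t)
  mem  : ⦃ _ : HasSets L ⦄ → ∀ {t X} → IsΔ₀ (t ∈ X)
  bot  : IsΔ₀ ⊥
  and  : ∀ {φ ψ} → IsΔ₀ φ → IsΔ₀ ψ → IsΔ₀ (φ ∧ ψ)
  or   : ∀ {φ ψ} → IsΔ₀ φ → IsΔ₀ ψ → IsΔ₀ (φ ∨ ψ)
  imp  : ∀ {φ ψ} → IsΔ₀ φ → IsΔ₀ ψ → IsΔ₀ (φ ⇒ ψ)
  ball : ∀ {φ} t → IsΔ₀ φ → IsΔ₀ (∀[< t ] φ)
  bex  : ∀ {φ} t → IsΔ₀ φ → IsΔ₀ (∃[< t ] φ)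

data IsΣ₁ {n} : Formula L₁ 0 n → Set where
  Δ₀ : ∀ {θ} → IsΔ₀ θ → IsΣ₁ θ
  ex : ∀ {φ} → IsΣ₁ φ → IsΣ₁ (∃ⁿ φ)

------------------------------------------------------------------------
-- First-order theories

data BASIC {L} : Theory L where
  S≢0    : BASIC (∀ⁿ* 1 (¬ S x₀ ≐ O))
  S-inj  : BASIC (∀ⁿ* 2 (S x₀ ≐ S x₁ ⇒ x₀ ≐ x₁))
  +-0    : BASIC (∀ⁿ* 1 (x₀ + O ≐ x₀))
  +-S    : BASIC (∀ⁿ* 2 (x₀ + S x₁ ≐ S (x₀ + x₁)))
  ·-0    : BASIC (∀ⁿ* 1 (x₀ · O ≐ O))
  ·-S    : BASIC (∀ⁿ* 2 (x₀ · S x₁ ≐ x₀ · x₁ + x₀))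
  ≮0     : BASIC (∀ⁿ* 1 (¬ x₀ < O))
  <-S    : BASIC (∀ⁿ* 2 (x₀ < S x₁ ↔ x₀ < x₁ ∨ x₀ ≐ x₁))
  <-tri  : BASIC (∀ⁿ* 2 (x₀ < x₁ ∨ x₀ ≐ x₁ ∨ x₁ < x₀))
  S-surj : BASIC (∀ⁿ* 1 (O < x₀ ⇒ (∃[< x₀ ] S x₀ ≐ x₁)))
  -- (x₀ , x₁) = x₂
  pair   : BASIC (∀ⁿ* 3 (⟪ x₀ , x₁ ⟫ ≐ x₂ ↔
             𝟐 · x₂ ≐ (x₀ + x₁) · (x₀ + x₁ + 𝟏) + 𝟐 · x₀ + 𝟐))
  p-inj  : BASIC (∀ⁿ* 4 (⟪ x₀ , x₁ ⟫ ≐ ⟪ x₂ , x₃ ⟫ ⇒ x₀ ≐ x₂ ∧ x₁ ≐ x₃))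
  -- ∃x<z ∃y<z (x,y) = z; inside, y, x, z are x₀, x₁, x₂.
  p-surj : BASIC (∀ⁿ* 1 (O < x₀ ⇒ (∃[< x₀ ] ∃[< x₁ ] ⟪ x₁ , x₀ ⟫ ≐ x₂)))
  H-pair : BASIC (∀ⁿ* 2 (H ⟪ x₀ , x₁ ⟫ ≐ x₀))
  H-0    : BASIC (H O ≐ O)
  T-pair : BASIC (∀ⁿ* 2 (T ⟪ x₀ , x₁ ⟫ ≐ x₁))
  T-0    : BASIC (T O ≐ O)

-- The induction variable is x₀ of φ; the other n variables are parameters.
data IndΔ₀ : Theory L₁ where
  ind : (φ : Formula L₁ 0 (suc n)) → IsΔ₀ φ →
        IndΔ₀ (∀ⁿ* n (φ [ O ] ∧
                      (∀ⁿ (φ ⇒ sub id ((x₀ + 𝟏) ∷ (var ∘ suc)) φ)) ⇒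
                      (∀ⁿ φ)))

-- In φ the variables y, x, a are x₀, x₁, x₂ and the remaining ones are
-- further parameters.  The substitution makes room for b between x and a.
data CollΣ₁ : Theory L₁ where
  coll : (φ : Formula L₁ 0 (suc (suc (suc n)))) → IsΣ₁ φ →
         CollΣ₁ (∀ⁿ* (suc n)
           ((∀[< x₀ ] ∃ⁿ φ) ⇒
            (∃ⁿ ∀[< x₁ ] ∃[< x₁ ]
               sub id (x₀ ∷ x₁ ∷ λ i → var (suc (suc (suc i)))) φ)))

IΔ₀ BΣ₁ : Theory L₁
IΔ₀ = BASIC ∪ IndΔ₀
BΣ₁ = IΔ₀ ∪ CollΣ₁

------------------------------------------------------------------------
-- Second-order theories

IND : Sentence L₂
IND = ∀ˢ ∀ⁿ (O ∈ 0F ∧ (∀ⁿ (x₀ ∈ 0F ⇒ S x₀ ∈ 0F)) ⇒ x₀ ∈ 0F)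

data ComprΔ⁰₀ : Theory L₂ where
  compr : (φ : Formula L₂ m (suc n)) → IsΔ₀ φ →
          ComprΔ⁰₀ (∀ˢ* m (∀ⁿ* n (∃ˢ ∀ⁿ (x₀ ∈ 0F ↔ wkˢ φ))))

CΔ⁰₀ : Theory L₂
CΔ⁰₀ = BASIC ∪ ｛ IND ｝ ∪ ComprΔ⁰₀

_∈ℱ : Fin m → Formula L₂ m n
f ∈ℱ = (∀ⁿ ∃ⁿ ⟪ x₁ , x₀ ⟫ ∈ f)
     ∧ (∀ⁿ ∀ⁿ ∀ⁿ (⟪ x₂ , x₁ ⟫ ∈ f ∧ ⟪ x₂ , x₀ ⟫ ∈ f ⇒ x₁ ≐ x₀))
     ∧ ¬ O ∈ f

_⟨_⟩≐_ : Fin m → Term n → Term n → Formula L₂ m n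
f ⟨ s ⟩≐ t = ⟪ s , t ⟫ ∈ f

-- First g, h are 1F, 0F; under the quantifier over f, they are 2F, 1F and f
-- is 0F.  The numbers x, y, z are x₂, x₁, x₀.
COMP : Sentence L₂
COMP = ∀ˢ ∀ˢ ((1F ∈ℱ) ∧ (0F ∈ℱ) ⇒
         (∃ˢ ((0F ∈ℱ) ∧
              (∀ⁿ ∀ⁿ ∀ⁿ ((1F ⟨ x₂ ⟩≐ x₀) ∧ (2F ⟨ x₀ ⟩≐ x₁) ⇒
                         (0F ⟨ x₂ ⟩≐ x₁))))))

RCA₀⁻ : Theory L₂
RCA₀⁻ = CΔ⁰₀ ∪ ｛ COMP ｝

------------------------------------------------------------------------
-- Trees and weak König's lemma

-- A Δ₀ definition of the graph of exponentiation: `graph` with x₀, x₁ for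
-- x, y says 2ˣ = y.  The two recurrences determine the formula up to
-- IΔ₀-provable equivalence, and force it to define the true graph of
-- exponentiation in the standard model.
record ExpGraph : Set where
  field
    graph : Formula L₁ 0 2
    isΔ₀  : IsΔ₀ graph

  Exp[_,_] : Term n → Term n → Formula L₁ m n
  Exp[ s , t ] = sub [] (s ∷ t ∷ []) graph

  field
    base : IΔ₀ ⊢ ∀ⁿ (Exp[ O , x₀ ] ↔ x₀ ≐ 𝟏)
    step : IΔ₀ ⊢ ∀ⁿ ∀ⁿ (Exp[ S x₁ , x₀ ] ↔ (∃ⁿ (Exp[ x₂ , x₀ ] ∧ x₁ ≐ 𝟐 · x₀)))

module _ (exp : ExpGraph) where
  open ExpGraph exp

  infix 6 _≼_ _≺_ _⊆_

  -- ∃p≤τ ∃y≤τ ∃x<p (2^y ≐ p ∧ τ = σ·p + x); in the matrix, x, y, p are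
  -- x₀, x₁, x₂.  The formula provably fails when σ or τ is 0, so the side
  -- condition σ, τ > 0 need not be added.
  _≼_ : Term n → Term n → Formula L₂ m n
  σ ≼ τ = ∃[≤ τ ] ∃[≤ wkᵗ τ ] ∃[< x₁ ]
            (embed Exp[ x₁ , x₂ ] ∧
             wkᵗ (wkᵗ (wkᵗ τ)) ≐ wkᵗ (wkᵗ (wkᵗ σ)) · x₂ + x₀)

  _≺_ : Term n → Term n → Formula L₂ m n
  σ ≺ τ = σ ≼ τ ∧ σ < τ

  IsTree : Fin m → Formula L₂ m n
  IsTree X = ¬ O ∈ X ∧ (∀ⁿ (x₀ ∈ X ⇒ (∀ⁿ (x₀ ≺ x₁ ⇒ x₀ ∈ X))))

  IsInfinite : Fin m → Formula L₂ m n
  IsInfinite X = ¬ (∃ⁿ ∀ⁿ (x₀ ∈ X ⇒ x₀ < x₁))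

  -- ≼ is provably a partial order on nonzero numbers, so being linearly
  -- ordered amounts to comparability.
  IsBranch : Fin m → Formula L₂ m n
  IsBranch X = IsTree X
             ∧ (∀ⁿ ∀ⁿ (x₁ ∈ X ∧ x₀ ∈ X ⇒ x₁ ≼ x₀ ∨ x₀ ≼ x₁))

  _⊆_ : Fin m → Fin m → Formula L₂ m n
  X ⊆ Y = ∀ⁿ (x₀ ∈ X ⇒ x₀ ∈ Y)

  WKL : Sentence L₂
  WKL = ∀ˢ (IsTree 0F ∧ IsInfinite 0F ⇒
          (∃ˢ (IsTree 0F ∧ IsInfinite 0F ∧ IsBranch 0F ∧ 0F ⊆ 1F)))

  WKL₀⁻ : Theory L₂
  WKL₀⁻ = RCA₀⁻ ∪ ｛ WKL ｝

{-# OPTIONS --safe #-}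

-- That BΣ₁ implies the first-order part of WKL₀⁻ is shown by building, inside a
-- countable model of BΣ₁, enough sets.  To argue constructively, falsity is read as the
-- provability R of the given sentence: a Henkin construction then yields, without
-- deciding anything, a model in which truth is C-stable for C A = (A → R) → R and in
-- which the truth of the sentence implies its provability.  Sets are added to that
-- model one at a time, and all formulas of the second-order theory are interpreted in
-- the Kripke frame of the resulting finite expansions.
--
-- A new set P is approximated by numbers σ of various levels, of which there are
-- boundedly many at each level.  For a branch of a tree, σ runs through the nodes of
-- the tree; for comprehension and for composition there is nothing to choose.  A
-- generic path through the approximations preserves Δ₀ induction, because a bounded
-- formula about P is a bounded formula about a single σ.  It preserves collection:
-- given ∀x<a ∃y θ(x,y,P), if for some x < a the approximations with ∀y ¬θ(x,y,σ) have
-- unbounded levels, the path can be chosen among them; otherwise a uniform bound on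
-- these levels exists, by collection in the old model, and bounds the witnesses y.
--
-- Conversely, the composition axiom yields collection in every model of RCA₀⁻.

module Submission where

open import Defs
open import Data.Empty using (⊥-elim) renaming (⊥ to ⊥₀)
open import Data.Fin.Base using (Fin; zero; suc) renaming (toℕ to toℕᶠ)
open import Data.Fin.Patterns using (0F; 1F; 2F; 3F; 4F)
open import Data.List.Base using (List; map; length; _++_) renaming ([] to []ᴸ; _∷_ to _∷ᴸ_)
open import Data.List.Membership.Propositional using () renaming (_∈_ to _∈ᴸ_)
open import Data.List.Membership.Propositional.Properties using (∈-map⁺; ∈-++⁺ˡ; ∈-++⁺ʳ)
open import Data.List.Relation.Binary.Subset.Propositional using () renaming (_⊆_ to _⊆ᴸ_)
open import Data.List.Relation.Binary.Subset.Propositional.Properties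
  using (map⁺; ∷⁺ʳ; ⊆-refl; ⊆-trans; xs⊆ys++xs)
open import Data.List.Relation.Unary.All as All using (All) renaming ([] to []ᵃ; _∷_ to _∷ᵃ_)
import Data.List.Relation.Unary.All.Properties as All
open import Data.List.Relation.Unary.Any using (here; there; index)
open import Data.Nat.Base as ℕ using (ℕ; zero; suc; _⊔_)
open import Data.Nat.Binary.Base using (ℕᵇ; 2[1+_]; 1+[2_]; fromℕ; toℕ) renaming (zero to zeroᵇ)
open import Data.Nat.Binary.Properties using (fromℕ-toℕ)
import Data.Nat.Properties as ℕ
open import Data.Product using (Σ; ∃; ∃₂; _×_; _,_; proj₁; proj₂)
open import Data.Sum as Sum using (_⊎_; inj₁; inj₂)
open import Data.Unit using (tt) renaming (⊤ to ⊤₀)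
open import Data.Vec.Base using (Vec; lookup; fromList) renaming ([] to []ᵛ; _∷_ to _∷ᵛ_)
open import Data.Vec.Functional using ([]; _∷_)
open import Function.Base using (_∘_; id)
open import Function.Bundles using (_⇔_; mk⇔)
open import Level using (Lift; lift; lower)
open import Relation.Binary using (tri<; tri≈; tri>)
open import Relation.Binary.Bundles using (Setoid)
import Relation.Binary.Reasoning.Setoid as SetoidReasoning
open import Relation.Binary.PropositionalEquality
  using (_≡_; refl; sym; trans; cong; cong₂; subst)
open import Relation.Nullary using (yes; no)

-- Two obstacles shape the construction. The first is that a limit of all finite extensions would
-- need choices along an enumeration of its own sets. Reading set quantifiers over the frame of
-- finite extensions avoids forming it, and nothing is lost, since an arithmetical formula has the
-- same truth value in every world. The second is that no choice may be decided. Each one is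
-- therefore determined uniquely (by relative consistency, or as the candidate of least index) and
-- shown to exist only up to `C`; the union of the stages is then a plain predicate. Countability
-- gives every requirement its turn.
--
-- Composition is the delicate axiom. The graph of g ∘ h need not be bounded in g and h, because the
-- intermediate value h(x) has no bound. When a composition is added, the level of an approximation
-- provides that bound. Conversely, this is where the axiom exceeds comprehension: a statement about
-- k(h(x)) becomes a bounded statement about the single set k ∘ h, so that induction on sets applies
-- to it.
--
-- Sets obtained by comprehension are added by the same generic machinery, so preservation is proved
-- only once.

private
  variable
    L : Lang
    m m′ m″ n n′ n″ k N : ℕ
    A B : Set

-- Substitution

[]ᵗ-cong : {σ τ : Fin n → Term n′} → (∀ i → σ i ≡ τ i) → ∀ t → t [ σ ]ᵗ ≡ t [ τ ]ᵗ
[]ᵗ-cong p (var i)   = p i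
[]ᵗ-cong p O         = refl
[]ᵗ-cong p (S t)     = cong S ([]ᵗ-cong p t)
[]ᵗ-cong p (H t)     = cong H ([]ᵗ-cong p t)
[]ᵗ-cong p (T t)     = cong T ([]ᵗ-cong p t)
[]ᵗ-cong p (s + t)   = cong₂ _+_ ([]ᵗ-cong p s) ([]ᵗ-cong p t)
[]ᵗ-cong p (s · t)   = cong₂ _·_ ([]ᵗ-cong p s) ([]ᵗ-cong p t)
[]ᵗ-cong p ⟪ s , t ⟫ = cong₂ ⟪_,_⟫ ([]ᵗ-cong p s) ([]ᵗ-cong p t)

[]ᵗ-∘ : {σ : Fin n → Term n′} {τ : Fin n′ → Term n″} →
        ∀ t → t [ σ ]ᵗ [ τ ]ᵗ ≡ t [ (λ i → σ i [ τ ]ᵗ) ]ᵗ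
[]ᵗ-∘ (var i)   = refl
[]ᵗ-∘ O         = refl
[]ᵗ-∘ (S t)     = cong S ([]ᵗ-∘ t)
[]ᵗ-∘ (H t)     = cong H ([]ᵗ-∘ t)
[]ᵗ-∘ (T t)     = cong T ([]ᵗ-∘ t)
[]ᵗ-∘ (s + t)   = cong₂ _+_ ([]ᵗ-∘ s) ([]ᵗ-∘ t)
[]ᵗ-∘ (s · t)   = cong₂ _·_ ([]ᵗ-∘ s) ([]ᵗ-∘ t)
[]ᵗ-∘ ⟪ s , t ⟫ = cong₂ ⟪_,_⟫ ([]ᵗ-∘ s) ([]ᵗ-∘ t)

[]ᵗ-var : ∀ (t : Term n) → t [ var ]ᵗ ≡ t
[]ᵗ-var (var i)   = refl
[]ᵗ-var O         = refl
[]ᵗ-var (S t)     = cong S ([]ᵗ-var t)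
[]ᵗ-var (H t)     = cong H ([]ᵗ-var t)
[]ᵗ-var (T t)     = cong T ([]ᵗ-var t)
[]ᵗ-var (s + t)   = cong₂ _+_ ([]ᵗ-var s) ([]ᵗ-var t)
[]ᵗ-var (s · t)   = cong₂ _·_ ([]ᵗ-var s) ([]ᵗ-var t)
[]ᵗ-var ⟪ s , t ⟫ = cong₂ ⟪_,_⟫ ([]ᵗ-var s) ([]ᵗ-var t)

liftⁿ-cong : {σ τ : Fin n → Term n′} → (∀ i → σ i ≡ τ i) → ∀ i → liftⁿ σ i ≡ liftⁿ τ i
liftⁿ-cong p zero    = refl
liftⁿ-cong p (suc i) = cong wkᵗ (p i)

liftˢ-cong : {ρ τ : Fin m → Fin m′} → (∀ i → ρ i ≡ τ i) → ∀ i → liftˢ ρ i ≡ liftˢ τ i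
liftˢ-cong p zero    = refl
liftˢ-cong p (suc i) = cong suc (p i)

sub-cong : {ρ ρ′ : Fin m → Fin m′} {σ σ′ : Fin n → Term n′} →
           (∀ i → ρ i ≡ ρ′ i) → (∀ i → σ i ≡ σ′ i) →
           ∀ (φ : Formula L m n) → sub ρ σ φ ≡ sub ρ′ σ′ φ
sub-cong p q (s ≐ t)           = cong₂ _≐_ ([]ᵗ-cong q s) ([]ᵗ-cong q t)
sub-cong p q (s < t)           = cong₂ _<_ ([]ᵗ-cong q s) ([]ᵗ-cong q t)
sub-cong p q (_∈_ ⦃ h ⦄ t X)   = cong₂ (_∈_ ⦃ h ⦄) ([]ᵗ-cong q t) (p X)
sub-cong p q ⊥                 = refl
sub-cong p q (φ ∧ ψ)           = cong₂ _∧_ (sub-cong p q φ) (sub-cong p q ψ)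
sub-cong p q (φ ∨ ψ)           = cong₂ _∨_ (sub-cong p q φ) (sub-cong p q ψ)
sub-cong p q (φ ⇒ ψ)           = cong₂ _⇒_ (sub-cong p q φ) (sub-cong p q ψ)
sub-cong p q (∀ⁿ φ)            = cong ∀ⁿ_ (sub-cong p (liftⁿ-cong q) φ)
sub-cong p q (∃ⁿ φ)            = cong ∃ⁿ_ (sub-cong p (liftⁿ-cong q) φ)
sub-cong p q (∀ˢ_ ⦃ h ⦄ φ)     = cong (∀ˢ_ ⦃ h ⦄) (sub-cong (liftˢ-cong p) q φ)
sub-cong p q (∃ˢ_ ⦃ h ⦄ φ)     = cong (∃ˢ_ ⦃ h ⦄) (sub-cong (liftˢ-cong p) q φ)

liftⁿ-∘ : (σ : Fin n → Term n′) (τ : Fin n′ → Term n″) →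
          ∀ i → liftⁿ σ i [ liftⁿ τ ]ᵗ ≡ liftⁿ (λ i → σ i [ τ ]ᵗ) i
liftⁿ-∘ σ τ zero    = refl
liftⁿ-∘ σ τ (suc i) = trans ([]ᵗ-∘ (σ i)) (sym ([]ᵗ-∘ (σ i)))

liftˢ-∘ : (ρ : Fin m → Fin m′) (τ : Fin m′ → Fin m″) →
          ∀ i → liftˢ τ (liftˢ ρ i) ≡ liftˢ (τ ∘ ρ) i
liftˢ-∘ ρ τ zero    = refl
liftˢ-∘ ρ τ (suc i) = refl

sub-∘ : {ρ : Fin m → Fin m′} {ρ′ : Fin m′ → Fin m″}
        {σ : Fin n → Term n′} {σ′ : Fin n′ → Term n″} →
        ∀ (φ : Formula L m n) → sub ρ′ σ′ (sub ρ σ φ) ≡ sub (ρ′ ∘ ρ) (λ i → σ i [ σ′ ]ᵗ) φ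
sub-∘ (s ≐ t)           = cong₂ _≐_ ([]ᵗ-∘ s) ([]ᵗ-∘ t)
sub-∘ (s < t)           = cong₂ _<_ ([]ᵗ-∘ s) ([]ᵗ-∘ t)
sub-∘ (_∈_ ⦃ h ⦄ t X)   = cong (λ t → _∈_ ⦃ h ⦄ t _) ([]ᵗ-∘ t)
sub-∘ ⊥                 = refl
sub-∘ (φ ∧ ψ)           = cong₂ _∧_ (sub-∘ φ) (sub-∘ ψ)
sub-∘ (φ ∨ ψ)           = cong₂ _∨_ (sub-∘ φ) (sub-∘ ψ)
sub-∘ (φ ⇒ ψ)           = cong₂ _⇒_ (sub-∘ φ) (sub-∘ ψ)
sub-∘ {σ = σ} {σ′} (∀ⁿ φ) =
  cong ∀ⁿ_ (trans (sub-∘ φ) (sub-cong (λ _ → refl) (liftⁿ-∘ σ σ′) φ))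
sub-∘ {σ = σ} {σ′} (∃ⁿ φ) =
  cong ∃ⁿ_ (trans (sub-∘ φ) (sub-cong (λ _ → refl) (liftⁿ-∘ σ σ′) φ))
sub-∘ {ρ = ρ} {ρ′} (∀ˢ_ ⦃ h ⦄ φ) =
  cong (∀ˢ_ ⦃ h ⦄) (trans (sub-∘ φ) (sub-cong (liftˢ-∘ ρ ρ′) (λ _ → refl) φ))
sub-∘ {ρ = ρ} {ρ′} (∃ˢ_ ⦃ h ⦄ φ) =
  cong (∃ˢ_ ⦃ h ⦄) (trans (sub-∘ φ) (sub-cong (liftˢ-∘ ρ ρ′) (λ _ → refl) φ))

[]ᵗ-id : {σ : Fin n → Term n} → (∀ i → σ i ≡ var i) → ∀ t → t [ σ ]ᵗ ≡ t
[]ᵗ-id p t = trans ([]ᵗ-cong p t) ([]ᵗ-var t)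

sub-id : {ρ : Fin m → Fin m} {σ : Fin n → Term n} → (∀ i → ρ i ≡ i) → (∀ i → σ i ≡ var i) →
         ∀ (φ : Formula L m n) → sub ρ σ φ ≡ φ
sub-id p q (s ≐ t)           = cong₂ _≐_ ([]ᵗ-id q s) ([]ᵗ-id q t)
sub-id p q (s < t)           = cong₂ _<_ ([]ᵗ-id q s) ([]ᵗ-id q t)
sub-id p q (_∈_ ⦃ h ⦄ t X)   = cong₂ (_∈_ ⦃ h ⦄) ([]ᵗ-id q t) (p X)
sub-id p q ⊥                 = refl
sub-id p q (φ ∧ ψ)           = cong₂ _∧_ (sub-id p q φ) (sub-id p q ψ)
sub-id p q (φ ∨ ψ)           = cong₂ _∨_ (sub-id p q φ) (sub-id p q ψ)
sub-id p q (φ ⇒ ψ)           = cong₂ _⇒_ (sub-id p q φ) (sub-id p q ψ)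
sub-id p q (∀ⁿ φ)            = cong ∀ⁿ_ (sub-id p (λ { zero → refl ; (suc i) → cong wkᵗ (q i) }) φ)
sub-id p q (∃ⁿ φ)            = cong ∃ⁿ_ (sub-id p (λ { zero → refl ; (suc i) → cong wkᵗ (q i) }) φ)
sub-id p q (∀ˢ_ ⦃ h ⦄ φ)     = cong (∀ˢ_ ⦃ h ⦄)
  (sub-id (λ { zero → refl ; (suc i) → cong suc (p i) }) q φ)
sub-id p q (∃ˢ_ ⦃ h ⦄ φ)     = cong (∃ˢ_ ⦃ h ⦄)
  (sub-id (λ { zero → refl ; (suc i) → cong suc (p i) }) q φ)

-- Structures, forcing with worlds of sets, soundness

infix 2 _⟷_
_⟷_ : ∀ {a b} → Set a → Set b → Set _
A ⟷ B = (A → B) × (B → A)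

module _ {a b c d} {A : Set a} {B : Set b} {A′ : Set c} {B′ : Set d} where

  infixr 2 _×-⟷_
  _×-⟷_ : A ⟷ A′ → B ⟷ B′ → (A × B) ⟷ (A′ × B′)
  (f , g) ×-⟷ (h , k) = (λ (x , y) → f x , h y) , (λ (x , y) → g x , k y)

  _→-⟷_ : A ⟷ A′ → B ⟷ B′ → (A → B) ⟷ (A′ → B′)
  (f , g) →-⟷ (h , k) = (λ u x → h (u (g x))) , (λ u x → k (u (f x)))

  _⊎-⟷_ : A ⟷ A′ → B ⟷ B′ → (A ⊎ B) ⟷ (A′ ⊎ B′)
  (f , g) ⊎-⟷ (h , k) = Sum.map f h , Sum.map g k

module _ {a b c} {A : Set a} {P : A → Set b} {Q : A → Set c} (h : ∀ x → P x ⟷ Q x) where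

  ∀-⟷ : (∀ x → P x) ⟷ (∀ x → Q x)
  ∀-⟷ = (λ f x → proj₁ (h x) (f x)) , (λ f x → proj₂ (h x) (f x))

  Σ-⟷ : Σ A P ⟷ Σ A Q
  Σ-⟷ = (λ (x , y) → x , proj₁ (h x) y) , (λ (x , y) → x , proj₂ (h x) y)

⟷-refl : ∀ {a} {A : Set a} → A ⟷ A
⟷-refl = id , id

⟷-sym : ∀ {a b} {A : Set a} {B : Set b} → A ⟷ B → B ⟷ A
⟷-sym (f , g) = g , f

⟷-trans : ∀ {a b c} {A : Set a} {B : Set b} {C : Set c} → A ⟷ B → B ⟷ C → A ⟷ C
⟷-trans (f , g) (h , k) = h ∘ f , g ∘ k

≡⇒⟷ : ∀ {a} {A B : Set a} → A ≡ B → A ⟷ B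
≡⇒⟷ refl = ⟷-refl

-- Falsity is an arbitrary set R, and C is the double negation relative to R;
-- every truth value below is C-stable, so that classical logic is available.
record Str : Set₁ where
  infix  4 _≈_ _⊏_
  infixl 7 _+ᴰ_
  infixl 8 _·ᴰ_
  field
    D R    : Set
    _≈_    : D → D → Set
    _⊏_    : D → D → Set
    0ᴰ     : D
    Sᴰ     : D → D
    Hᴰ     : D → D
    Tᴰ     : D → D
    _+ᴰ_   : D → D → D
    _·ᴰ_   : D → D → D
    ⟪_,_⟫ᴰ : D → D → D

  C : ∀ {a} → Set a → Set a
  C A = (A → R) → R

  field
    ≈-refl   : ∀ {x} → x ≈ x
    ≈-sym    : ∀ {x y} → x ≈ y → y ≈ x
    ≈-trans  : ∀ {x y z} → x ≈ y → y ≈ z → x ≈ z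
    S-cong   : ∀ {x y} → x ≈ y → Sᴰ x ≈ Sᴰ y
    H-cong   : ∀ {x y} → x ≈ y → Hᴰ x ≈ Hᴰ y
    T-cong   : ∀ {x y} → x ≈ y → Tᴰ x ≈ Tᴰ y
    +-cong   : ∀ {x x′ y y′} → x ≈ x′ → y ≈ y′ → x +ᴰ y ≈ x′ +ᴰ y′
    ·-cong   : ∀ {x x′ y y′} → x ≈ x′ → y ≈ y′ → x ·ᴰ y ≈ x′ ·ᴰ y′
    ⟪⟫-cong  : ∀ {x x′ y y′} → x ≈ x′ → y ≈ y′ → ⟪ x , y ⟫ᴰ ≈ ⟪ x′ , y′ ⟫ᴰ
    ⊏-resp   : ∀ {x x′ y y′} → x ≈ x′ → y ≈ y′ → x ⊏ y → x′ ⊏ y′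
    ≈-stable : ∀ {x y} → C (x ≈ y) → x ≈ y
    ⊏-stable : ∀ {x y} → C (x ⊏ y) → x ⊏ y

  infixl 1 _>>=_
  _>>=_ : ∀ {a b} {A : Set a} {B : Set b} → C A → (A → C B) → C B
  (m >>= f) k = m λ x → f x k

  return : ∀ {a} {A : Set a} → A → C A
  return x k = k x

  C-map : ∀ {a b} {A : Set a} {B : Set b} → (A → B) → C A → C B
  C-map f c k = c (k ∘ f)

  C-⟷ : ∀ {a b} {A : Set a} {B : Set b} → A ⟷ B → C A ⟷ C B
  C-⟷ (f , g) = C-map f , C-map g

  lem : ∀ {a} (A : Set a) → C (A ⊎ (A → R))
  lem A k = k (inj₂ λ x → k (inj₁ x))

  Stable : ∀ {a} → Set a → Set a
  Stable A = C A → A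

  -- Atomic formulas `t ∈ X` have to respect `≈`, which need not be identity of elements, and to be
  -- `C`-stable like all other truth values.
  record Good (X : D → Set) : Set where
    field
      stable : ∀ {d} → Stable (X d)
      resp   : ∀ {d d′} → d ≈ d′ → X d → X d′

module Truth (𝔖 : Str) where
  open Str 𝔖

  ⟦_⟧ : Term n → (Fin n → D) → D
  ⟦ var i ⟧     e = e i
  ⟦ O ⟧         e = 0ᴰ
  ⟦ S t ⟧       e = Sᴰ (⟦ t ⟧ e)
  ⟦ H t ⟧       e = Hᴰ (⟦ t ⟧ e)
  ⟦ T t ⟧       e = Tᴰ (⟦ t ⟧ e)
  ⟦ s + t ⟧     e = ⟦ s ⟧ e +ᴰ ⟦ t ⟧ e
  ⟦ s · t ⟧     e = ⟦ s ⟧ e ·ᴰ ⟦ t ⟧ e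
  ⟦ ⟪ s , t ⟫ ⟧ e = ⟪ ⟦ s ⟧ e , ⟦ t ⟧ e ⟫ᴰ

  ⟦⟧-sub : {σ : Fin n → Term n′} {e : Fin n′ → D} {e′ : Fin n → D} →
           (∀ i → ⟦ σ i ⟧ e ≈ e′ i) → ∀ t → ⟦ t [ σ ]ᵗ ⟧ e ≈ ⟦ t ⟧ e′
  ⟦⟧-sub p (var i)   = p i
  ⟦⟧-sub p O         = ≈-refl
  ⟦⟧-sub p (S t)     = S-cong (⟦⟧-sub p t)
  ⟦⟧-sub p (H t)     = H-cong (⟦⟧-sub p t)
  ⟦⟧-sub p (T t)     = T-cong (⟦⟧-sub p t)
  ⟦⟧-sub p (s + t)   = +-cong (⟦⟧-sub p s) (⟦⟧-sub p t)
  ⟦⟧-sub p (s · t)   = ·-cong (⟦⟧-sub p s) (⟦⟧-sub p t)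
  ⟦⟧-sub p ⟪ s , t ⟫ = ⟪⟫-cong (⟦⟧-sub p s) (⟦⟧-sub p t)

  ⟦⟧-lift : (σ : Fin n → Term n′) {e : Fin n′ → D} {e′ : Fin n → D} →
            (∀ i → ⟦ σ i ⟧ e ≈ e′ i) → ∀ d i → ⟦ liftⁿ σ i ⟧ (d ∷ e) ≈ (d ∷ e′) i
  ⟦⟧-lift σ p d zero    = ≈-refl
  ⟦⟧-lift σ p d (suc i) = ≈-trans (⟦⟧-sub (λ _ → ≈-refl) (σ i)) (p i)

  -- Truth of arithmetical formulas.  Set quantifiers get a junk value.
  Tr : Formula L m n → (Fin m → D → Set) → (Fin n → D) → Set
  Tr (s ≐ t) ρ e = ⟦ s ⟧ e ≈ ⟦ t ⟧ e
  Tr (s < t) ρ e = ⟦ s ⟧ e ⊏ ⟦ t ⟧ e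
  Tr (t ∈ X) ρ e = ρ X (⟦ t ⟧ e)
  Tr ⊥       ρ e = R
  Tr (φ ∧ ψ) ρ e = Tr φ ρ e × Tr ψ ρ e
  Tr (φ ∨ ψ) ρ e = C (Tr φ ρ e ⊎ Tr ψ ρ e)
  Tr (φ ⇒ ψ) ρ e = Tr φ ρ e → Tr ψ ρ e
  Tr (∀ⁿ φ)  ρ e = ∀ d → Tr φ ρ (d ∷ e)
  Tr (∃ⁿ φ)  ρ e = C (Σ D λ d → Tr φ ρ (d ∷ e))
  Tr (∀ˢ φ)  ρ e = R
  Tr (∃ˢ φ)  ρ e = R

  -- A Kripke frame whose worlds differ only in their collections of sets.
  record Frame : Set₂ where
    infix 4 _⊑_
    field
      W       : Set₁
      _⊑_     : W → W → Set₁
      ⊑-refl  : ∀ {w} → w ⊑ w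
      ⊑-trans : ∀ {w w′ w″} → w ⊑ w′ → w′ ⊑ w″ → w ⊑ w″
      𝒳       : W → (D → Set) → Set₁
      𝒳-mono  : ∀ {w w′ X} → w ⊑ w′ → 𝒳 w X → 𝒳 w′ X
      𝒳-good  : ∀ {w X} → 𝒳 w X → Good X

  -- Ordinary second-order structures are the frames with one world, so one soundness proof serves
  -- both the Henkin models and the frame of extensions.
  flat : (𝒮 : (D → Set) → Set₁) → (∀ {X} → 𝒮 X → Good X) → Frame
  flat 𝒮 g = record
    { W       = Lift _ ⊤₀
    ; _⊑_     = λ _ _ → Lift _ ⊤₀
    ; ⊑-refl  = _
    ; ⊑-trans = _
    ; 𝒳       = λ _ → 𝒮
    ; 𝒳-mono  = λ _ x → x
    ; 𝒳-good  = g
    }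

  module Forcing (𝔉 : Frame) where
    open Frame 𝔉

    -- Kripke double negation with `R` for falsity; in forcing terms, `P` holds densely above `w`.
    J : (W → Set₁) → W → Set₁
    J P w = ∀ {w′} → w ⊑ w′ → (∀ {w″} → w′ ⊑ w″ → P w″ → R) → R

    infix 4 _⊩_[_,_]
    -- Numbers are the same in all worlds, so only implication, set quantifiers and `J` look at
    -- later ones. Placing `J` on disjunctions and existentials makes the whole interpretation
    -- classical.
    _⊩_[_,_] : W → Formula L m n → (Fin m → D → Set) → (Fin n → D) → Set₁
    w ⊩ s ≐ t [ ρ , e ] = Lift _ (⟦ s ⟧ e ≈ ⟦ t ⟧ e)
    w ⊩ s < t [ ρ , e ] = Lift _ (⟦ s ⟧ e ⊏ ⟦ t ⟧ e)
    w ⊩ t ∈ X [ ρ , e ] = Lift _ (ρ X (⟦ t ⟧ e))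
    w ⊩ ⊥     [ ρ , e ] = Lift _ R
    w ⊩ φ ∧ ψ [ ρ , e ] = (w ⊩ φ [ ρ , e ]) × (w ⊩ ψ [ ρ , e ])
    w ⊩ φ ∨ ψ [ ρ , e ] = J (λ w → (w ⊩ φ [ ρ , e ]) ⊎ (w ⊩ ψ [ ρ , e ])) w
    w ⊩ φ ⇒ ψ [ ρ , e ] = ∀ {w′} → w ⊑ w′ → w′ ⊩ φ [ ρ , e ] → w′ ⊩ ψ [ ρ , e ]
    w ⊩ ∀ⁿ φ  [ ρ , e ] = ∀ d → w ⊩ φ [ ρ , d ∷ e ]
    w ⊩ ∃ⁿ φ  [ ρ , e ] = J (λ w → Σ D λ d → w ⊩ φ [ ρ , d ∷ e ]) w
    w ⊩ ∀ˢ φ  [ ρ , e ] = ∀ {w′} → w ⊑ w′ → ∀ {X} → 𝒳 w′ X → w′ ⊩ φ [ X ∷ ρ , e ]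
    w ⊩ ∃ˢ φ  [ ρ , e ] = J (λ w → Σ (D → Set) λ X → 𝒳 w X × w ⊩ φ [ X ∷ ρ , e ]) w

    J-map : ∀ {P Q : W → Set₁} → (∀ {w} → P w → Q w) → ∀ {w} → J P w → J Q w
    J-map f j p k = j p λ q x → k q (f x)

    J-⟷ : ∀ {P Q : W → Set₁} → (∀ {w} → P w ⟷ Q w) → ∀ {w} → J P w ⟷ J Q w
    J-⟷ h = J-map (proj₁ h) , J-map (proj₂ h)

    J-mono : ∀ {P : W → Set₁} {w w′} → w ⊑ w′ → J P w → J P w′
    J-mono p j q = j (⊑-trans p q)

    mono : ∀ (φ : Formula L m n) {ρ e w w′} → w ⊑ w′ → w ⊩ φ [ ρ , e ] → w′ ⊩ φ [ ρ , e ]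
    mono (s ≐ t) p x = x
    mono (s < t) p x = x
    mono (t ∈ X) p x = x
    mono ⊥       p x = x
    mono (φ ∧ ψ) p (x , y) = mono φ p x , mono ψ p y
    mono (φ ∨ ψ) p = J-mono p
    mono (φ ⇒ ψ) p f q = f (⊑-trans p q)
    mono (∀ⁿ φ)  p f d = mono φ p (f d)
    mono (∃ⁿ φ)  p = J-mono p
    mono (∀ˢ φ)  p f q = f (⊑-trans p q)
    mono (∃ˢ φ)  p = J-mono p

    J-join : ∀ {P : W → Set₁} {w} → J (J P) w → J P w
    J-join j p k = j p λ q j′ → j′ ⊑-refl λ r → k (⊑-trans q r)

    good-∷ : ∀ {X w} {ρ : Fin m → D → Set} → 𝒳 w X → (∀ i → Good (ρ i)) → ∀ i → Good ((X ∷ ρ) i)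
    good-∷ x g zero    = 𝒳-good x
    good-∷ x g (suc i) = g i

    lift-∷ : ∀ {X} {r : Fin m → Fin m′} {ρ ρ′} → (∀ i → ρ (r i) ≡ ρ′ i) →
             ∀ i → (X ∷ ρ) (liftˢ r i) ≡ (_∷_ {A = D → Set} X ρ′) i
    lift-∷ p zero    = refl
    lift-∷ p (suc i) = p i

    -- What is dense is forced; this is the soundness of `raa` and allows `J` to be eliminated into
    -- any formula.
    stable : ∀ (φ : Formula L m n) {ρ e w} → (∀ i → Good (ρ i)) →
             J (λ w → w ⊩ φ [ ρ , e ]) w → w ⊩ φ [ ρ , e ]
    stable (s ≐ t) g j = lift (≈-stable λ k → j ⊑-refl λ _ x → k (lower x))
    stable (s < t) g j = lift (⊏-stable λ k → j ⊑-refl λ _ x → k (lower x))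
    stable (t ∈ X) g j = lift (Good.stable (g X) λ k → j ⊑-refl λ _ x → k (lower x))
    stable ⊥       g j = lift (j ⊑-refl λ _ x → lower x)
    stable (φ ∧ ψ) g j = stable φ g (J-map proj₁ j) , stable ψ g (J-map proj₂ j)
    stable (φ ∨ ψ) g j = J-join j
    stable (φ ⇒ ψ) g j p x =
      stable ψ g λ q k → j (⊑-trans p q) λ r f → k r (f ⊑-refl (mono φ (⊑-trans q r) x))
    stable (∀ⁿ φ)  g j d = stable φ g (J-map (λ f → f d) j)
    stable (∃ⁿ φ)  g j = J-join j
    stable (∀ˢ φ)  g j p x =
      stable φ (good-∷ x g) λ q k → j (⊑-trans p q) λ r f → k r (f ⊑-refl (𝒳-mono (⊑-trans q r) x))
    stable (∃ˢ φ)  g j = J-join j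

    J-elim : ∀ {P : W → Set₁} (φ : Formula L m n) {ρ e w} → (∀ i → Good (ρ i)) → J P w →
             (∀ {w′} → w ⊑ w′ → P w′ → w′ ⊩ φ [ ρ , e ]) → w ⊩ φ [ ρ , e ]
    J-elim φ g j f = stable φ g λ p k → j p λ q x → k q (f (⊑-trans p q) x)

    -- Substituted terms match their values only up to `≈`; at the atoms `t ∈ X` this is absorbed by
    -- `Good`.
    ⊩-sub : {r : Fin m → Fin m′} {σ : Fin n → Term n′} (φ : Formula L m n) →
            ∀ {ρ ρ′ e e′} → (∀ i → Good (ρ′ i)) → (∀ i → ρ (r i) ≡ ρ′ i) →
            (∀ i → ⟦ σ i ⟧ e ≈ e′ i) → ∀ {w} →
            (w ⊩ sub r σ φ [ ρ , e ]) ⟷ (w ⊩ φ [ ρ′ , e′ ])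
    ⊩-sub (s ≐ t) g p q =
      (λ (lift x) → lift (≈-trans (≈-sym (⟦⟧-sub q s)) (≈-trans x (⟦⟧-sub q t)))) ,
      (λ (lift x) → lift (≈-trans (⟦⟧-sub q s) (≈-trans x (≈-sym (⟦⟧-sub q t)))))
    ⊩-sub (s < t) g p q =
      (λ (lift x) → lift (⊏-resp (⟦⟧-sub q s) (⟦⟧-sub q t) x)) ,
      (λ (lift x) → lift (⊏-resp (≈-sym (⟦⟧-sub q s)) (≈-sym (⟦⟧-sub q t)) x))
    ⊩-sub (t ∈ X) g p q =
      (λ (lift x) → lift (Good.resp (g X) (⟦⟧-sub q t) (subst (λ Y → Y _) (p X) x))) ,
      (λ (lift x) → lift (subst (λ Y → Y _) (sym (p X)) (Good.resp (g X) (≈-sym (⟦⟧-sub q t)) x)))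
    ⊩-sub ⊥       g p q = ⟷-refl
    ⊩-sub (φ ∧ ψ) g p q = ⊩-sub φ g p q ×-⟷ ⊩-sub ψ g p q
    ⊩-sub (φ ∨ ψ) g p q = J-⟷ (⊩-sub φ g p q ⊎-⟷ ⊩-sub ψ g p q)
    ⊩-sub (φ ⇒ ψ) g p q =
      (λ f r x → proj₁ (⊩-sub ψ g p q) (f r (proj₂ (⊩-sub φ g p q) x))) ,
      (λ f r x → proj₂ (⊩-sub ψ g p q) (f r (proj₁ (⊩-sub φ g p q) x)))
    ⊩-sub {σ = σ} (∀ⁿ φ) g p q = ∀-⟷ λ d → ⊩-sub φ g p (⟦⟧-lift σ q d)
    ⊩-sub {σ = σ} (∃ⁿ φ) g p q = J-⟷ (Σ-⟷ λ d → ⊩-sub φ g p (⟦⟧-lift σ q d))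
    ⊩-sub (∀ˢ φ) g p q =
      (λ f u x → proj₁ (⊩-sub φ (good-∷ x g) (lift-∷ p) q) (f u x)) ,
      (λ f u x → proj₂ (⊩-sub φ (good-∷ x g) (lift-∷ p) q) (f u x))
    ⊩-sub (∃ˢ φ) g p q =
      J-map (λ (X , x , y) → X , x , proj₁ (⊩-sub φ (good-∷ x g) (lift-∷ p) q) y) ,
      J-map (λ (X , x , y) → X , x , proj₂ (⊩-sub φ (good-∷ x g) (lift-∷ p) q) y)

    ⊩-closed : (φ : Sentence L) {ρ : Fin m → D → Set} {e : Fin n → D} → ∀ {w} →
               (w ⊩ inScope φ [ ρ , e ]) ⟷ (w ⊩ φ [ [] , [] ])
    ⊩-closed φ = ⊩-sub φ (λ ()) (λ ()) (λ ())

    module Soundness {𝒯 : Theory L} (ax : ∀ {φ} → 𝒯 φ → ∀ {w} → w ⊩ φ [ [] , [] ]) where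

      Ctx : W → List (Formula L m n) → (Fin m → D → Set) → (Fin n → D) → Set₁
      Ctx w Γ ρ e = All (λ ψ → w ⊩ ψ [ ρ , e ]) Γ

      Ctx-mono : ∀ {Γ : List (Formula L m n)} {ρ e w w′} → w ⊑ w′ → Ctx w Γ ρ e → Ctx w′ Γ ρ e
      Ctx-mono p = All.map λ {ψ} → mono ψ p

      Ctx-wkⁿ : ∀ {Γ : List (Formula L m n)} {ρ e w} → (∀ i → Good (ρ i)) →
                ∀ d → Ctx w Γ ρ e → Ctx w (map wkⁿ Γ) ρ (d ∷ e)
      Ctx-wkⁿ g d γ = All.map⁺ (All.map (λ {ψ} → proj₂ (⊩-sub ψ g (λ _ → refl) (λ _ → ≈-refl))) γ)

      Ctx-wkˢ : ∀ {Γ : List (Formula L m n)} {ρ e w} → (∀ i → Good (ρ i)) →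
                ∀ X → Ctx w Γ ρ e → Ctx w (map wkˢ Γ) (X ∷ ρ) e
      Ctx-wkˢ g X γ = All.map⁺ (All.map (λ {ψ} → proj₂ (⊩-sub ψ g (λ _ → refl) (λ _ → ≈-refl))) γ)

      sound : ∀ {Γ : List (Formula L m n)} {φ} → 𝒯 ∣ Γ ⊢ φ → ∀ {ρ e w} →
              (∀ i → 𝒳 w (ρ i)) → Ctx w Γ ρ e → w ⊩ φ [ ρ , e ]
      sound (axiom {φ} a) r γ = proj₂ (⊩-closed φ) (ax a)
      sound (hyp i) r γ = All.lookup γ i
      sound (raa {φ} d) {w = w} r γ = stable φ (𝒳-good ∘ r) λ p k →
        lower (sound d (𝒳-mono p ∘ r) ((λ q x → lift (k q x)) ∷ᵃ Ctx-mono p γ))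
      sound (∧I d d′) r γ = sound d r γ , sound d′ r γ
      sound (∧E₁ d) r γ = proj₁ (sound d r γ)
      sound (∧E₂ d) r γ = proj₂ (sound d r γ)
      sound (∨I₁ {φ} d) r γ = λ p k → k ⊑-refl (inj₁ (mono φ p (sound d r γ)))
      sound (∨I₂ {ψ = ψ} d) r γ = λ p k → k ⊑-refl (inj₂ (mono ψ p (sound d r γ)))
      sound (∨E {χ = χ} d d₁ d₂) r γ = J-elim χ (𝒳-good ∘ r) (sound d r γ) λ where
        p (inj₁ x) → sound d₁ (𝒳-mono p ∘ r) (x ∷ᵃ Ctx-mono p γ)
        p (inj₂ x) → sound d₂ (𝒳-mono p ∘ r) (x ∷ᵃ Ctx-mono p γ)
      sound (⇒I d) r γ p x = sound d (𝒳-mono p ∘ r) (x ∷ᵃ Ctx-mono p γ)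
      sound (⇒E d d′) r γ = sound d r γ ⊑-refl (sound d′ r γ)
      sound (∀ⁿI d) r γ x = sound d r (Ctx-wkⁿ (𝒳-good ∘ r) x γ)
      sound (∀ⁿE {φ} d t) r γ =
        proj₂ (⊩-sub φ (𝒳-good ∘ r) (λ _ → refl) λ { zero → ≈-refl ; (suc i) → ≈-refl })
          (sound d r γ (⟦ t ⟧ _))
      sound (∃ⁿI {φ} t d) r γ p k = k ⊑-refl (⟦ t ⟧ _ , mono φ p
        (proj₁ (⊩-sub φ (𝒳-good ∘ r) (λ _ → refl) λ { zero → ≈-refl ; (suc i) → ≈-refl })
          (sound d r γ)))
      sound (∃ⁿE {χ = χ} d d′) r γ = J-elim χ (𝒳-good ∘ r) (sound d r γ) λ p (x , y) →
        proj₁ (⊩-sub χ (𝒳-good ∘ r) (λ _ → refl) (λ _ → ≈-refl))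
          (sound d′ (𝒳-mono p ∘ r) (y ∷ᵃ Ctx-mono p (Ctx-wkⁿ (𝒳-good ∘ r) x γ)))
      sound (∀ˢI d) r γ p x =
        sound d (λ { zero → x ; (suc i) → 𝒳-mono p (r i) })
          (Ctx-mono p (Ctx-wkˢ (𝒳-good ∘ r) _ γ))
      sound (∀ˢE {φ = φ} d X) r γ =
        proj₂ (⊩-sub φ (λ { zero → 𝒳-good (r X) ; (suc i) → 𝒳-good (r i) })
                 (λ { zero → refl ; (suc i) → refl }) (λ _ → ≈-refl))
          (sound d r γ ⊑-refl (r X))
      sound (∃ˢI {φ = φ} X d) {ρ} r γ p k = k ⊑-refl (ρ X , 𝒳-mono p (r X) , mono φ p
        (proj₁ (⊩-sub φ (λ { zero → 𝒳-good (r X) ; (suc i) → 𝒳-good (r i) })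
                  (λ { zero → refl ; (suc i) → refl }) (λ _ → ≈-refl))
          (sound d r γ)))
      sound (∃ˢE {χ = χ} d d′) r γ = J-elim χ (𝒳-good ∘ r) (sound d r γ) λ p (X , x , y) →
        proj₁ (⊩-sub χ (𝒳-good ∘ r) (λ _ → refl) (λ _ → ≈-refl))
          (sound d′ (λ { zero → x ; (suc i) → 𝒳-mono p (r i) })
            (y ∷ᵃ Ctx-mono p (Ctx-wkˢ (𝒳-good ∘ r) X γ)))
      sound ≐I r γ = lift ≈-refl
      sound (≐E {s} {t} φ d d′) {e = e} r γ =
        proj₂ (⊩-sub φ {e′ = ⟦ t ⟧ e ∷ e} (𝒳-good ∘ r) (λ _ → refl)
                 λ { zero → ≈-refl ; (suc i) → ≈-refl })
          (proj₁ (⊩-sub φ (𝒳-good ∘ r) (λ _ → refl)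
                    λ { zero → lower (sound d r γ) ; (suc i) → ≈-refl })
            (sound d′ r γ))

-- Arithmetical formulas and their truth

Arith : Formula L m n → Set
Arith (s ≐ t) = ⊤₀
Arith (s < t) = ⊤₀
Arith (t ∈ X) = ⊤₀
Arith ⊥       = ⊤₀
Arith (φ ∧ ψ) = Arith φ × Arith ψ
Arith (φ ∨ ψ) = Arith φ × Arith ψ
Arith (φ ⇒ ψ) = Arith φ × Arith ψ
Arith (∀ⁿ φ)  = Arith φ
Arith (∃ⁿ φ)  = Arith φ
Arith (∀ˢ φ)  = ⊥₀
Arith (∃ˢ φ)  = ⊥₀

Arith-embed : (φ : Formula L₁ m n) → Arith (embed φ)
Arith-embed (s ≐ t) = tt
Arith-embed (s < t) = tt
Arith-embed (_∈_ ⦃ () ⦄ t X)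
Arith-embed ⊥       = tt
Arith-embed (φ ∧ ψ) = Arith-embed φ , Arith-embed ψ
Arith-embed (φ ∨ ψ) = Arith-embed φ , Arith-embed ψ
Arith-embed (φ ⇒ ψ) = Arith-embed φ , Arith-embed ψ
Arith-embed (∀ⁿ φ)  = Arith-embed φ
Arith-embed (∃ⁿ φ)  = Arith-embed φ
Arith-embed (∀ˢ_ ⦃ () ⦄ φ)
Arith-embed (∃ˢ_ ⦃ () ⦄ φ)

Arith-L₁ : (φ : Formula L₁ m n) → Arith φ
Arith-L₁ (s ≐ t) = tt
Arith-L₁ (s < t) = tt
Arith-L₁ (_∈_ ⦃ () ⦄ t X)
Arith-L₁ ⊥       = tt
Arith-L₁ (φ ∧ ψ) = Arith-L₁ φ , Arith-L₁ ψ
Arith-L₁ (φ ∨ ψ) = Arith-L₁ φ , Arith-L₁ ψ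
Arith-L₁ (φ ⇒ ψ) = Arith-L₁ φ , Arith-L₁ ψ
Arith-L₁ (∀ⁿ φ)  = Arith-L₁ φ
Arith-L₁ (∃ⁿ φ)  = Arith-L₁ φ
Arith-L₁ (∀ˢ_ ⦃ () ⦄ φ)
Arith-L₁ (∃ˢ_ ⦃ () ⦄ φ)

module TruthLemmas (𝔖 : Str) where
  open Str 𝔖
  open Truth 𝔖

  Tr-sub : {r : Fin m → Fin m′} {σ : Fin n → Term n′} (φ : Formula L m n) →
           ∀ {ρ ρ′ e e′} → (∀ i → Good (ρ′ i)) → (∀ i → ρ (r i) ≡ ρ′ i) →
           (∀ i → ⟦ σ i ⟧ e ≈ e′ i) → Tr (sub r σ φ) ρ e ⟷ Tr φ ρ′ e′
  Tr-sub (s ≐ t) g p q =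
    (λ x → ≈-trans (≈-sym (⟦⟧-sub q s)) (≈-trans x (⟦⟧-sub q t))) ,
    (λ x → ≈-trans (⟦⟧-sub q s) (≈-trans x (≈-sym (⟦⟧-sub q t))))
  Tr-sub (s < t) g p q =
    ⊏-resp (⟦⟧-sub q s) (⟦⟧-sub q t) ,
    ⊏-resp (≈-sym (⟦⟧-sub q s)) (≈-sym (⟦⟧-sub q t))
  Tr-sub (t ∈ X) g p q =
    (λ x → Good.resp (g X) (⟦⟧-sub q t) (subst (λ Y → Y _) (p X) x)) ,
    (λ x → subst (λ Y → Y _) (sym (p X)) (Good.resp (g X) (≈-sym (⟦⟧-sub q t)) x))
  Tr-sub ⊥       g p q = ⟷-refl
  Tr-sub (φ ∧ ψ) g p q = Tr-sub φ g p q ×-⟷ Tr-sub ψ g p q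
  Tr-sub (φ ∨ ψ) g p q = C-⟷ (Tr-sub φ g p q ⊎-⟷ Tr-sub ψ g p q)
  Tr-sub (φ ⇒ ψ) g p q = Tr-sub φ g p q →-⟷ Tr-sub ψ g p q
  Tr-sub {σ = σ} (∀ⁿ φ) g p q = ∀-⟷ λ d → Tr-sub φ g p (⟦⟧-lift σ q d)
  Tr-sub {σ = σ} (∃ⁿ φ) g p q = C-⟷ (Σ-⟷ λ d → Tr-sub φ g p (⟦⟧-lift σ q d))
  Tr-sub (∀ˢ φ)  g p q = ⟷-refl
  Tr-sub (∃ˢ φ)  g p q = ⟷-refl

  Tr-embed : (φ : Formula L₁ m n) → ∀ {ρ ρ′ e} → Tr (embed φ) ρ e ⟷ Tr φ ρ′ e
  Tr-embed (s ≐ t) = ⟷-refl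
  Tr-embed (s < t) = ⟷-refl
  Tr-embed (_∈_ ⦃ () ⦄ t X)
  Tr-embed ⊥       = ⟷-refl
  Tr-embed (φ ∧ ψ) = Tr-embed φ ×-⟷ Tr-embed ψ
  Tr-embed (φ ∨ ψ) = C-⟷ (Tr-embed φ ⊎-⟷ Tr-embed ψ)
  Tr-embed (φ ⇒ ψ) = Tr-embed φ →-⟷ Tr-embed ψ
  Tr-embed (∀ⁿ φ)  = ∀-⟷ λ d → Tr-embed φ
  Tr-embed (∃ⁿ φ)  = C-⟷ (Σ-⟷ λ d → Tr-embed φ)
  Tr-embed (∀ˢ_ ⦃ () ⦄ φ)
  Tr-embed (∃ˢ_ ⦃ () ⦄ φ)

  module _ (𝔉 : Frame) where
    open Frame 𝔉
    open Forcing 𝔉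

    J⟷C : ∀ {P : W → Set₁} {A : Set} → (∀ {w} → P w ⟷ A) → ∀ {w} → J P w ⟷ C A
    J⟷C h = (λ j k → j ⊑-refl λ _ → k ∘ proj₁ h) , (λ c p k → c (k ⊑-refl ∘ proj₂ h))

    -- No clause of an arithmetical formula sees which sets a world contains, so `J` collapses to
    -- `C`. Facts forced in an extension thereby become facts about the original structure.
    ⊩⟷Tr : ∀ (φ : Formula L m n) → Arith φ → ∀ {w ρ e} → (w ⊩ φ [ ρ , e ]) ⟷ Tr φ ρ e
    ⊩⟷Tr (s ≐ t) a = lower , lift
    ⊩⟷Tr (s < t) a = lower , lift
    ⊩⟷Tr (t ∈ X) a = lower , lift
    ⊩⟷Tr ⊥       a = lower , lift
    ⊩⟷Tr (φ ∧ ψ) (a , b) = ⊩⟷Tr φ a ×-⟷ ⊩⟷Tr ψ b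
    ⊩⟷Tr (φ ∨ ψ) (a , b) = J⟷C (⊩⟷Tr φ a ⊎-⟷ ⊩⟷Tr ψ b)
    ⊩⟷Tr (φ ⇒ ψ) (a , b) =
      (λ f x → proj₁ (⊩⟷Tr ψ b) (f ⊑-refl (proj₂ (⊩⟷Tr φ a) x))) ,
      (λ f _ x → proj₂ (⊩⟷Tr ψ b) (f (proj₁ (⊩⟷Tr φ a) x)))
    ⊩⟷Tr (∀ⁿ φ) a = ∀-⟷ λ d → ⊩⟷Tr φ a
    ⊩⟷Tr (∃ⁿ φ) a = J⟷C (Σ-⟷ λ d → ⊩⟷Tr φ a)

    ⊩-embed : (φ : Formula L₁ m n) → ∀ {w ρ ρ′ e} → (w ⊩ embed φ [ ρ , e ]) ⟷ Tr φ ρ′ e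
    ⊩-embed φ = ⟷-trans (⊩⟷Tr (embed φ) (Arith-embed φ)) (Tr-embed φ)

-- Countable syntax

infixl 8 _·′_
infixl 7 _+′_
infix  6 _≐′_ _<′_ _∈′_
infixr 4 _∧′_
infixr 2 _⇒′_

data Tm (A : Set) (n : ℕ) : Set where
  vr        : Fin n → Tm A n
  con       : A → Tm A n
  O′        : Tm A n
  S′ H′ T′  : Tm A n → Tm A n
  _+′_ _·′_ : Tm A n → Tm A n → Tm A n
  ⟪_,_⟫′    : Tm A n → Tm A n → Tm A n

-- Δ⁰₀ formulas, up to classical equivalence, with constants from A.
data Code (A : Set) (m n : ℕ) : Set where
  _≐′_ _<′_ : Tm A n → Tm A n → Code A m n
  _∈′_      : Tm A n → Fin m → Code A m n
  ⊥′        : Code A m n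
  _∧′_ _⇒′_ : Code A m n → Code A m n → Code A m n
  ∀<′       : Tm A n → Code A m (suc n) → Code A m n

data Tree : Set where
  leaf : Tree
  node : Tree → Tree → Tree

-- Binary digits read as a program for a stack machine that builds trees.
run : ℕᵇ → List Tree
run zeroᵇ    = []ᴸ
run 2[1+ b ] = leaf ∷ᴸ run b
run 1+[2 b ] with run b
... | s ∷ᴸ t ∷ᴸ ts = node s t ∷ᴸ ts
... | ts           = ts

run-push : ∀ t b → ∃ λ b′ → run b′ ≡ t ∷ᴸ run b
run-push leaf       b = 2[1+ b ] , refl
run-push (node s t) b with run-push t b
... | b₁ , p₁ with run-push s b₁
... | b₂ , p₂ = 1+[2 b₂ ] , q
  where
  q : run 1+[2 b₂ ] ≡ node s t ∷ᴸ run b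
  q rewrite p₂ | p₁ = refl

top : List Tree → Tree
top []ᴸ       = leaf
top (t ∷ᴸ ts) = t

tree : ℕ → Tree
tree = top ∘ run ∘ fromℕ

tree-onto : ∀ t → ∃ λ k → tree k ≡ t
tree-onto t with run-push t zeroᵇ
... | b , p = toℕ b , trans (cong (top ∘ run) (fromℕ-toℕ b)) (cong top p)

-- Enumerating by trees instead of numbers: a node pairs two codes at no cost, and decoders of
-- syntax recurse structurally. Only `tree` relates trees to numbers.
record Countable (A : Set) : Set where
  field
    decode : Tree → A
    onto   : ∀ a → ∃ λ t → decode t ≡ a

open Countable

enumerate : Countable A → ℕ → A
enumerate c = decode c ∘ tree

enumerate-onto : (c : Countable A) → ∀ a → ∃ λ k → enumerate c k ≡ a
enumerate-onto c a with onto c a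
... | t , refl with tree-onto t
... | k , p = k , cong (decode c) p

countable-ℕ : Countable ℕ
countable-ℕ = record { decode = d ; onto = o }
  where
  d : Tree → ℕ
  d leaf       = zero
  d (node _ t) = suc (d t)
  o : ∀ k → ∃ λ t → d t ≡ k
  o zero    = leaf , refl
  o (suc k) with o k
  ... | t , refl = node leaf t , refl

countable-map : (f : A → B) → (∀ b → ∃ λ a → f a ≡ b) → Countable A → Countable B
countable-map f f-onto c = record { decode = f ∘ decode c ; onto = o }
  where
  o : ∀ b → ∃ λ t → f (decode c t) ≡ b
  o b with f-onto b
  ... | a , refl with onto c a
  ... | t , p = t , cong f p

countable-Σ : {B : A → Set} → Countable A → (∀ a → Countable (B a)) → Countable (Σ A B)
countable-Σ {A} {B} c c′ = record { decode = d ; onto = o }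
  where
  d : Tree → Σ A B
  d leaf       = decode c leaf , decode (c′ _) leaf
  d (node s t) = decode c s , decode (c′ _) t
  o : ∀ p → ∃ λ t → d t ≡ p
  o (a , b) with onto c a
  ... | s , refl with onto (c′ _) b
  ... | t , refl = node s t , refl

countable-× : Countable A → Countable B → Countable (A × B)
countable-× c c′ = countable-Σ c λ _ → c′

countable-Vec : Countable A → ∀ n → Countable (Vec A n)
countable-Vec c zero    = record { decode = λ _ → []ᵛ ; onto = λ { []ᵛ → leaf , refl } }
countable-Vec c (suc n) =
  countable-map (λ (a , v) → a ∷ᵛ v) (λ { (a ∷ᵛ v) → (a , v) , refl })
    (countable-× c (countable-Vec c n))

finOr : ∀ n → ℕ → (Fin n → A) → A → A
finOr zero    k       f a = a
finOr (suc n) zero    f a = f zero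
finOr (suc n) (suc k) f a = finOr n k (f ∘ suc) a

finOr-toℕ : ∀ {n} (i : Fin n) (f : Fin n → A) a → finOr n (toℕᶠ i) f a ≡ f i
finOr-toℕ zero    f a = refl
finOr-toℕ (suc i) f a = finOr-toℕ i (f ∘ suc) a

tag : ℕ → Tree
tag k = proj₁ (onto countable-ℕ k)

untag : Tree → ℕ
untag = decode countable-ℕ

untag-tag : ∀ k → untag (tag k) ≡ k
untag-tag k = proj₂ (onto countable-ℕ k)

module _ {A : Set} (c : Countable A) where

  -- In `node t (node a b)` the number `untag t` selects the constructor, and `a`, `b` code its
  -- arguments. All other trees get the junk value `O′`.
  decodeTm : Tree → Tm A n
  decodeTm leaf       = O′
  decodeTm (node t leaf) = O′
  decodeTm {n} (node t (node a b)) = go (untag t)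
    where
    go : ℕ → Tm A n
    go 0 = finOr n (untag a) vr O′
    go 1 = con (decode c a)
    go 2 = S′ (decodeTm a)
    go 3 = H′ (decodeTm a)
    go 4 = T′ (decodeTm a)
    go 5 = decodeTm a +′ decodeTm b
    go 6 = decodeTm a ·′ decodeTm b
    go 7 = ⟪ decodeTm a , decodeTm b ⟫′
    go _ = O′

  decodeTm-onto : ∀ (t : Tm A n) → ∃ λ u → decodeTm u ≡ t
  decodeTm-onto (vr i) = node (tag 0) (node (tag (toℕᶠ i)) leaf) ,
    trans (cong (λ k → finOr _ k vr O′) (untag-tag (toℕᶠ i))) (finOr-toℕ i vr O′)
  decodeTm-onto (con a) with onto c a
  ... | u , p = node (tag 1) (node u leaf) , cong con p
  decodeTm-onto O′ = leaf , refl
  decodeTm-onto (S′ t) with decodeTm-onto t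
  ... | u , p = node (tag 2) (node u leaf) , cong S′ p
  decodeTm-onto (H′ t) with decodeTm-onto t
  ... | u , p = node (tag 3) (node u leaf) , cong H′ p
  decodeTm-onto (T′ t) with decodeTm-onto t
  ... | u , p = node (tag 4) (node u leaf) , cong T′ p
  decodeTm-onto (s +′ t) with decodeTm-onto s | decodeTm-onto t
  ... | u , p | v , q = node (tag 5) (node u v) , cong₂ _+′_ p q
  decodeTm-onto (s ·′ t) with decodeTm-onto s | decodeTm-onto t
  ... | u , p | v , q = node (tag 6) (node u v) , cong₂ _·′_ p q
  decodeTm-onto ⟪ s , t ⟫′ with decodeTm-onto s | decodeTm-onto t
  ... | u , p | v , q = node (tag 7) (node u v) , cong₂ ⟪_,_⟫′ p q

  countable-Tm : ∀ n → Countable (Tm A n)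
  countable-Tm n = record { decode = decodeTm ; onto = decodeTm-onto }

  decodeCode : Tree → Code A m n
  decodeCode leaf = ⊥′
  decodeCode (node t leaf) = ⊥′
  decodeCode {m} {n} (node t (node a b)) = go (untag t)
    where
    go : ℕ → Code A m n
    go 0 = decodeTm a ≐′ decodeTm b
    go 1 = decodeTm a <′ decodeTm b
    go 2 = finOr m (untag b) (λ X → decodeTm a ∈′ X) ⊥′
    go 3 = decodeCode a ∧′ decodeCode b
    go 4 = decodeCode a ⇒′ decodeCode b
    go 5 = ∀<′ (decodeTm a) (decodeCode b)
    go _ = ⊥′

  decodeCode-onto : ∀ (t : Code A m n) → ∃ λ u → decodeCode u ≡ t
  decodeCode-onto (s ≐′ t) with decodeTm-onto s | decodeTm-onto t
  ... | u , p | v , q = node (tag 0) (node u v) , cong₂ _≐′_ p q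
  decodeCode-onto (s <′ t) with decodeTm-onto s | decodeTm-onto t
  ... | u , p | v , q = node (tag 1) (node u v) , cong₂ _<′_ p q
  decodeCode-onto (t ∈′ X) with decodeTm-onto t
  ... | u , refl = node (tag 2) (node u (tag (toℕᶠ X))) ,
    trans (cong (λ k → finOr _ k (λ X → decodeTm u ∈′ X) ⊥′) (untag-tag (toℕᶠ X)))
          (finOr-toℕ X (λ X → decodeTm u ∈′ X) ⊥′)
  decodeCode-onto ⊥′ = leaf , refl
  decodeCode-onto (φ ∧′ ψ) with decodeCode-onto φ | decodeCode-onto ψ
  ... | u , p | v , q = node (tag 3) (node u v) , cong₂ _∧′_ p q
  decodeCode-onto (φ ⇒′ ψ) with decodeCode-onto φ | decodeCode-onto ψ
  ... | u , p | v , q = node (tag 4) (node u v) , cong₂ _⇒′_ p q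
  decodeCode-onto (∀<′ t φ) with decodeTm-onto t | decodeCode-onto φ
  ... | u , p | v , q = node (tag 5) (node u v) , cong₂ ∀<′ p q

  countable-Code : ∀ m n → Countable (Code A m n)
  countable-Code m n = record { decode = decodeCode ; onto = decodeCode-onto }

decodeTerm : Tree → Term n
decodeTerm leaf       = O
decodeTerm (node t leaf) = O
decodeTerm {n} (node t (node a b)) = go (untag t)
  where
  go : ℕ → Term n
  go 0 = finOr n (untag a) var O
  go 1 = S (decodeTerm a)
  go 2 = H (decodeTerm a)
  go 3 = T (decodeTerm a)
  go 4 = decodeTerm a + decodeTerm b
  go 5 = decodeTerm a · decodeTerm b
  go 6 = ⟪ decodeTerm a , decodeTerm b ⟫
  go _ = O

decodeTerm-onto : ∀ (t : Term n) → ∃ λ u → decodeTerm u ≡ t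
decodeTerm-onto (var i) = node (tag 0) (node (tag (toℕᶠ i)) leaf) ,
  trans (cong (λ k → finOr _ k var O) (untag-tag (toℕᶠ i))) (finOr-toℕ i var O)
decodeTerm-onto O = leaf , refl
decodeTerm-onto (S t) with decodeTerm-onto t
... | u , p = node (tag 1) (node u leaf) , cong S p
decodeTerm-onto (H t) with decodeTerm-onto t
... | u , p = node (tag 2) (node u leaf) , cong H p
decodeTerm-onto (T t) with decodeTerm-onto t
... | u , p = node (tag 3) (node u leaf) , cong T p
decodeTerm-onto (s + t) with decodeTerm-onto s | decodeTerm-onto t
... | u , p | v , q = node (tag 4) (node u v) , cong₂ _+_ p q
decodeTerm-onto (s · t) with decodeTerm-onto s | decodeTerm-onto t
... | u , p | v , q = node (tag 5) (node u v) , cong₂ _·_ p q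
decodeTerm-onto ⟪ s , t ⟫ with decodeTerm-onto s | decodeTerm-onto t
... | u , p | v , q = node (tag 6) (node u v) , cong₂ ⟪_,_⟫ p q

withSets : ∀ L → (⦃ HasSets L ⦄ → A) → A → A
withSets L₁ f a = a
withSets L₂ f a = f

decodeFormula : ∀ L → Tree → Formula L m n
decodeFormula L leaf = ⊥
decodeFormula L (node t leaf) = ⊥
decodeFormula {m} {n} L (node t (node a b)) = go (untag t)
  where
  go : ℕ → Formula L m n
  go 0 = decodeTerm a ≐ decodeTerm b
  go 1 = decodeTerm a < decodeTerm b
  go 2 = withSets L (finOr m (untag b) (λ X → decodeTerm a ∈ X) ⊥) ⊥
  go 3 = decodeFormula L a ∧ decodeFormula L b
  go 4 = decodeFormula L a ∨ decodeFormula L b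
  go 5 = decodeFormula L a ⇒ decodeFormula L b
  go 6 = ∀ⁿ decodeFormula L a
  go 7 = ∃ⁿ decodeFormula L a
  go 8 = withSets L (∀ˢ decodeFormula L a) ⊥
  go 9 = withSets L (∃ˢ decodeFormula L a) ⊥
  go _ = ⊥

decodeFormula-onto : ∀ (φ : Formula L m n) → ∃ λ u → decodeFormula L u ≡ φ
decodeFormula-onto (s ≐ t) with decodeTerm-onto s | decodeTerm-onto t
... | u , p | v , q = node (tag 0) (node u v) , cong₂ _≐_ p q
decodeFormula-onto (s < t) with decodeTerm-onto s | decodeTerm-onto t
... | u , p | v , q = node (tag 1) (node u v) , cong₂ _<_ p q
decodeFormula-onto (_∈_ ⦃ hasSets ⦄ t X) with decodeTerm-onto t
... | u , refl = node (tag 2) (node u (tag (toℕᶠ X))) ,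
  trans (cong (λ k → finOr _ k (λ X → decodeTerm u ∈ X) ⊥) (untag-tag (toℕᶠ X)))
        (finOr-toℕ X (λ X → decodeTerm u ∈ X) ⊥)
decodeFormula-onto ⊥ = leaf , refl
decodeFormula-onto (φ ∧ ψ) with decodeFormula-onto φ | decodeFormula-onto ψ
... | u , p | v , q = node (tag 3) (node u v) , cong₂ _∧_ p q
decodeFormula-onto (φ ∨ ψ) with decodeFormula-onto φ | decodeFormula-onto ψ
... | u , p | v , q = node (tag 4) (node u v) , cong₂ _∨_ p q
decodeFormula-onto (φ ⇒ ψ) with decodeFormula-onto φ | decodeFormula-onto ψ
... | u , p | v , q = node (tag 5) (node u v) , cong₂ _⇒_ p q
decodeFormula-onto (∀ⁿ φ) with decodeFormula-onto φ
... | u , p = node (tag 6) (node u leaf) , cong ∀ⁿ_ p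
decodeFormula-onto (∃ⁿ φ) with decodeFormula-onto φ
... | u , p = node (tag 7) (node u leaf) , cong ∃ⁿ_ p
decodeFormula-onto (∀ˢ_ ⦃ hasSets ⦄ φ) with decodeFormula-onto φ
... | u , p = node (tag 8) (node u leaf) , cong ∀ˢ_ p
decodeFormula-onto (∃ˢ_ ⦃ hasSets ⦄ φ) with decodeFormula-onto φ
... | u , p = node (tag 9) (node u leaf) , cong ∃ˢ_ p

countable-Formula : ∀ L m n → Countable (Formula L m n)
countable-Formula L m n = record { decode = decodeFormula L ; onto = decodeFormula-onto }

-- Completeness

-- A sequence of finite lists grown by classically total and functional choices.
module Chain (R : Set) {A : Set} (Step : ℕ → List A → List A → Set) (Ok : List A → Set)
  (total      : ∀ i l → Ok l → ((∃ λ l′ → Step i l l′) → R) → R)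
  (functional : ∀ {i l l₁ l₂} → Step i l l₁ → Step i l l₂ → (l₁ ≡ l₂ → R) → R)
  (extends    : ∀ {i l l′} → Step i l l′ → l ⊆ᴸ l′)
  (preserves  : ∀ {i l l′} → Step i l l′ → Ok l → Ok l′)
  (l₀ : List A) (ok₀ : Ok l₀) where

  data State : ℕ → List A → Set where
    start : State zero l₀
    step  : ∀ {i l l′} → State i l → Step i l l′ → State (suc i) l′

  State-ok : ∀ {i l} → State i l → Ok l
  State-ok start      = ok₀
  State-ok (step s p) = preserves p (State-ok s)

  State-total : ∀ i → ((∃ λ l → State i l) → R) → R
  State-total zero    k = k (l₀ , start)
  State-total (suc i) k = State-total i λ (l , s) →
    total i l (State-ok s) λ (l′ , p) → k (l′ , step s p)

  State-functional : ∀ {i l l′} → State i l → State i l′ → (l ≡ l′ → R) → R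
  State-functional start start k = k refl
  State-functional (step s p) (step s′ p′) k =
    State-functional s s′ λ { refl → functional p p′ k }

  State-extend : ∀ {i l} → State i l → ∀ j →
                 ((∃ λ l′ → State (j ℕ.+ i) l′ × l ⊆ᴸ l′) → R) → R
  State-extend {l = l} s zero    k = k (l , s , ⊆-refl)
  State-extend {i} s (suc j) k = State-extend s j λ (l′ , s′ , sub′) →
    total (j ℕ.+ i) l′ (State-ok s′) λ (l″ , p) →
      k (l″ , step s′ p , ⊆-trans sub′ (extends p))

  State-join : ∀ {i j l l′} → State i l → State j l′ →
               ((∃₂ λ k l″ → State k l″ × l ⊆ᴸ l″ × l′ ⊆ᴸ l″) → R) → R
  State-join {i} {j} s s′ k = State-extend s j λ (l₁ , s₁ , p₁) →
    State-extend s′ i λ (l₂ , s₂ , p₂) →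
      State-functional s₁ (subst (λ k → State k l₂) (ℕ.+-comm i j) s₂) λ where
        refl → k (j ℕ.+ i , l₁ , s₁ , p₁ , p₂)

  -- The union of the chain, up to double negation.
  In : A → Set
  In c = ((∃₂ λ i l → State i l × c ∈ᴸ l) → R) → R

  gather : ∀ {cs} → All In cs → ∀ {i l} → State i l →
           ((∃₂ λ k l′ → State k l′ × l ⊆ᴸ l′ × All (_∈ᴸ l′) cs) → R) → R
  gather []ᵃ       {i} {l} s k = k (i , l , s , ⊆-refl , []ᵃ)
  gather (p ∷ᵃ ps) s k = gather ps s λ (_ , _ , s′ , sub′ , qs) →
    p λ (_ , _ , s″ , q) → State-join s′ s″ λ (_ , _ , t , sub₁ , sub₂) →
      k (_ , _ , t , ⊆-trans sub′ sub₁ , sub₂ q ∷ᵃ All.map sub₁ qs)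

-- Derived rules of natural deduction

weaken : ∀ {𝒯 : Theory L} {Γ Δ : List (Formula L m n)} {φ} → Γ ⊆ᴸ Δ → 𝒯 ∣ Γ ⊢ φ → 𝒯 ∣ Δ ⊢ φ
weaken p (axiom a)      = axiom a
weaken p (hyp i)        = hyp (p i)
weaken p (raa d)        = raa (weaken (∷⁺ʳ _ p) d)
weaken p (∧I d d′)      = ∧I (weaken p d) (weaken p d′)
weaken p (∧E₁ d)        = ∧E₁ (weaken p d)
weaken p (∧E₂ d)        = ∧E₂ (weaken p d)
weaken p (∨I₁ d)        = ∨I₁ (weaken p d)
weaken p (∨I₂ d)        = ∨I₂ (weaken p d)
weaken p (∨E d d₁ d₂)   = ∨E (weaken p d) (weaken (∷⁺ʳ _ p) d₁) (weaken (∷⁺ʳ _ p) d₂)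
weaken p (⇒I d)         = ⇒I (weaken (∷⁺ʳ _ p) d)
weaken p (⇒E d d′)      = ⇒E (weaken p d) (weaken p d′)
weaken p (∀ⁿI d)        = ∀ⁿI (weaken (map⁺ _ p) d)
weaken p (∀ⁿE d t)      = ∀ⁿE (weaken p d) t
weaken p (∃ⁿI t d)      = ∃ⁿI t (weaken p d)
weaken p (∃ⁿE d d′)     = ∃ⁿE (weaken p d) (weaken (∷⁺ʳ _ (map⁺ _ p)) d′)
weaken p (∀ˢI d)        = ∀ˢI (weaken (map⁺ _ p) d)
weaken p (∀ˢE d X)      = ∀ˢE (weaken p d) X
weaken p (∃ˢI X d)      = ∃ˢI X (weaken p d)
weaken p (∃ˢE d d′)     = ∃ˢE (weaken p d) (weaken (∷⁺ʳ _ (map⁺ _ p)) d′)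
weaken p ≐I             = ≐I
weaken p (≐E φ d d′)    = ≐E φ (weaken p d) (weaken p d′)

⊢-subst : ∀ {𝒯 : Theory L} {Γ : List (Formula L m n)} {φ ψ} → φ ≡ ψ → 𝒯 ∣ Γ ⊢ φ → 𝒯 ∣ Γ ⊢ ψ
⊢-subst refl d = d

wkᵗ-inst : ∀ (s t : Term n) → wkᵗ s [ t ∷ var ]ᵗ ≡ s
wkᵗ-inst s t = trans ([]ᵗ-∘ s) ([]ᵗ-var s)

module _ {𝒯 : Theory L} {Γ : List (Formula L m n)} where

  replace : ∀ φ {s t α β} → φ [ s ] ≡ α → φ [ t ] ≡ β → 𝒯 ∣ Γ ⊢ s ≐ t → 𝒯 ∣ Γ ⊢ α → 𝒯 ∣ Γ ⊢ β
  replace φ refl refl d d′ = ≐E φ d d′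

  ≐-sym : ∀ {s t} → 𝒯 ∣ Γ ⊢ s ≐ t → 𝒯 ∣ Γ ⊢ t ≐ s
  ≐-sym {s} d = replace (x₀ ≐ wkᵗ s)
    (cong (_ ≐_) (wkᵗ-inst s _)) (cong (_ ≐_) (wkᵗ-inst s _)) d ≐I

  ≐-trans : ∀ {s t u} → 𝒯 ∣ Γ ⊢ s ≐ t → 𝒯 ∣ Γ ⊢ t ≐ u → 𝒯 ∣ Γ ⊢ s ≐ u
  ≐-trans {s} d d′ = replace (wkᵗ s ≐ x₀)
    (cong (_≐ _) (wkᵗ-inst s _)) (cong (_≐ _) (wkᵗ-inst s _)) d′ d

  ≐-cong : ∀ (u : Term (suc n)) {s t a b} → u [ s ∷ var ]ᵗ ≡ a → u [ t ∷ var ]ᵗ ≡ b →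
           𝒯 ∣ Γ ⊢ s ≐ t → 𝒯 ∣ Γ ⊢ a ≐ b
  ≐-cong u {s} {t} refl refl d = replace (wkᵗ (u [ s ∷ var ]ᵗ) ≐ u)
    (cong (_≐ u [ s ∷ var ]ᵗ) (wkᵗ-inst (u [ s ∷ var ]ᵗ) s))
    (cong (_≐ u [ t ∷ var ]ᵗ) (wkᵗ-inst (u [ s ∷ var ]ᵗ) t)) d ≐I

  ≐-cong₂ : (_⊙_ : ∀ {n} → Term n → Term n → Term n) →
            (∀ {n n′} {σ : Fin n → Term n′} s t → (s ⊙ t) [ σ ]ᵗ ≡ (s [ σ ]ᵗ) ⊙ (t [ σ ]ᵗ)) →
            ∀ {s s′ t t′} → 𝒯 ∣ Γ ⊢ s ≐ s′ → 𝒯 ∣ Γ ⊢ t ≐ t′ → 𝒯 ∣ Γ ⊢ (s ⊙ t) ≐ (s′ ⊙ t′)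
  ≐-cong₂ _⊙_ h {s} {s′} {t} {t′} d d′ = ≐-trans
    (≐-cong (x₀ ⊙ wkᵗ t) (trans (h _ _) (cong (_ ⊙_) (wkᵗ-inst t _)))
                         (trans (h _ _) (cong (_ ⊙_) (wkᵗ-inst t _))) d)
    (≐-cong (wkᵗ s′ ⊙ x₀) (trans (h _ _) (cong (_⊙ _) (wkᵗ-inst s′ _)))
                          (trans (h _ _) (cong (_⊙ _) (wkᵗ-inst s′ _))) d′)

  <-replace : ∀ {s s′ t t′} → 𝒯 ∣ Γ ⊢ s ≐ s′ → 𝒯 ∣ Γ ⊢ t ≐ t′ → 𝒯 ∣ Γ ⊢ s < t → 𝒯 ∣ Γ ⊢ s′ < t′
  <-replace {s} {s′} {t} {t′} d d′ e =
    replace (wkᵗ s′ < x₀) (cong (_< _) (wkᵗ-inst s′ _)) (cong (_< _) (wkᵗ-inst s′ _)) d′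
      (replace (x₀ < wkᵗ t) (cong (_ <_) (wkᵗ-inst t _)) (cong (_ <_) (wkᵗ-inst t _)) d e)

  ∈-replace : ⦃ _ : HasSets L ⦄ → ∀ {s t X} → 𝒯 ∣ Γ ⊢ s ≐ t → 𝒯 ∣ Γ ⊢ s ∈ X → 𝒯 ∣ Γ ⊢ t ∈ X
  ∈-replace {X = X} d e = replace (x₀ ∈ X) refl refl d e

  ex-falso : ∀ {φ} → 𝒯 ∣ Γ ⊢ ⊥ → 𝒯 ∣ Γ ⊢ φ
  ex-falso d = raa (weaken there d)

  -- The Henkin construction supplies witnesses for existential formulas only; counterexamples to
  -- universal formulas are obtained through this rule.
  ¬∀ⁿ⊢∃ⁿ¬ : ∀ {φ} → 𝒯 ∣ (¬ (∀ⁿ φ)) ∷ᴸ Γ ⊢ ∃ⁿ ¬ φ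
  ¬∀ⁿ⊢∃ⁿ¬ {φ} = raa (⇒E (hyp (there (here refl))) (∀ⁿI (raa
    (⇒E (hyp (there (here refl))) (∃ⁿI x₀ (⊢-subst (sym eq′) (hyp (here refl))))))))
    where
    eq′ : sub id (liftⁿ (var ∘ suc)) (¬ φ) [ x₀ ] ≡ (¬ φ)
    eq′ = trans (sub-∘ (¬ φ)) (sub-id (λ _ → refl) (λ { zero → refl ; (suc i) → refl }) (¬ φ))

  ¬∀ˢ⊢∃ˢ¬ : ⦃ _ : HasSets L ⦄ → ∀ {φ} → 𝒯 ∣ (¬ (∀ˢ φ)) ∷ᴸ Γ ⊢ ∃ˢ ¬ φ
  ¬∀ˢ⊢∃ˢ¬ {φ} = raa (⇒E (hyp (there (here refl))) (∀ˢI (raa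
    (⇒E (hyp (there (here refl))) (∃ˢI zero (⊢-subst (sym eq′) (hyp (here refl))))))))
    where
    eq′ : sub (liftˢ suc) var (¬ φ) [ zero ]ˢ ≡ (¬ φ)
    eq′ = trans (sub-∘ (¬ φ)) (sub-id (λ { zero → refl ; (suc i) → refl }) (λ _ → refl) (¬ φ))

-- The elements of the term model: closed terms in constants 0, 1, 2, …
Dᵗ : Set
Dᵗ = Tm ℕ 0

countable-Dᵗ : Countable Dᵗ
countable-Dᵗ = countable-Tm countable-ℕ 0

_⟨_⟩ : Dᵗ → (ℕ → Term n) → Term n
con k      ⟨ f ⟩ = f k
O′         ⟨ f ⟩ = O
S′ t       ⟨ f ⟩ = S (t ⟨ f ⟩)
H′ t       ⟨ f ⟩ = H (t ⟨ f ⟩)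
T′ t       ⟨ f ⟩ = T (t ⟨ f ⟩)
(s +′ t)   ⟨ f ⟩ = (s ⟨ f ⟩) + (t ⟨ f ⟩)
(s ·′ t)   ⟨ f ⟩ = (s ⟨ f ⟩) · (t ⟨ f ⟩)
⟪ s , t ⟫′ ⟨ f ⟩ = ⟪ s ⟨ f ⟩ , t ⟨ f ⟩ ⟫

boundᵗ : Dᵗ → ℕ
boundᵗ (con k)    = suc k
boundᵗ O′         = 0
boundᵗ (S′ t)     = boundᵗ t
boundᵗ (H′ t)     = boundᵗ t
boundᵗ (T′ t)     = boundᵗ t
boundᵗ (s +′ t)   = boundᵗ s ⊔ boundᵗ t
boundᵗ (s ·′ t)   = boundᵗ s ⊔ boundᵗ t
boundᵗ ⟪ s , t ⟫′ = boundᵗ s ⊔ boundᵗ t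

⟨⟩-bound : ∀ {f : ℕ → Term n} {f′ : ℕ → Term n′} {σ : Fin n → Term n′} {v} t → boundᵗ t ℕ.≤ v →
           (∀ k → k ℕ.< v → f k [ σ ]ᵗ ≡ f′ k) → t ⟨ f ⟩ [ σ ]ᵗ ≡ t ⟨ f′ ⟩
⟨⟩-bound (con k)    b p = p k b
⟨⟩-bound O′         b p = refl
⟨⟩-bound (S′ t)     b p = cong S (⟨⟩-bound t b p)
⟨⟩-bound (H′ t)     b p = cong H (⟨⟩-bound t b p)
⟨⟩-bound (T′ t)     b p = cong T (⟨⟩-bound t b p)
⟨⟩-bound (s +′ t)   b p = cong₂ _+_ (⟨⟩-bound s (ℕ.m⊔n≤o⇒m≤o (boundᵗ s) _ b) p)
                                    (⟨⟩-bound t (ℕ.m⊔n≤o⇒n≤o (boundᵗ s) _ b) p)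
⟨⟩-bound (s ·′ t)   b p = cong₂ _·_ (⟨⟩-bound s (ℕ.m⊔n≤o⇒m≤o (boundᵗ s) _ b) p)
                                    (⟨⟩-bound t (ℕ.m⊔n≤o⇒n≤o (boundᵗ s) _ b) p)
⟨⟩-bound ⟪ s , t ⟫′ b p = cong₂ ⟪_,_⟫ (⟨⟩-bound s (ℕ.m⊔n≤o⇒m≤o (boundᵗ s) _ b) p)
                                      (⟨⟩-bound t (ℕ.m⊔n≤o⇒n≤o (boundᵗ s) _ b) p)

-- In the term model sets are named by numbers, provided the language has sets.
SetName : Lang → Set
SetName L = HasSets L × ℕ

-- A sentence with Henkin constants is kept as an ordinary formula together with the closed terms
-- and set names to be put for its variables. The calculus thus stays that of the given language.
record Closure (L : Lang) : Set where
  constructor closure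
  field
    {#sets #nums} : ℕ
    body          : Formula L #sets #nums
    sets          : Vec (SetName L) #sets
    nums          : Vec Dᵗ #nums

countable-Closure : ∀ L → Countable (Closure L)
countable-Closure L₁ = countable-map
  (λ (n , φ , e) → closure φ []ᵛ e)
  (λ { (closure φ []ᵛ e) → (_ , φ , e) , refl ; (closure φ ((() , _) ∷ᵛ _) e) })
  (countable-Σ countable-ℕ λ n →
    countable-× (countable-Formula L₁ 0 n) (countable-Vec countable-Dᵗ n))
countable-Closure L₂ = countable-map
  (λ (m , n , φ , ρ , e) → closure φ ρ e)
  (λ (closure φ ρ e) → (_ , _ , φ , ρ , e) , refl)
  (countable-Σ countable-ℕ λ m → countable-Σ countable-ℕ λ n →
    countable-× (countable-Formula L₂ m n)
      (countable-× (countable-Vec countable-name m) (countable-Vec countable-Dᵗ n)))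
  where
  countable-name : Countable (SetName L₂)
  countable-name =
    countable-map (hasSets ,_) (λ { (hasSets , k) → k , refl }) countable-ℕ

bound-nums : Vec Dᵗ n → ℕ
bound-nums []ᵛ      = 0
bound-nums (t ∷ᵛ e) = boundᵗ t ⊔ bound-nums e

bound-sets : Vec (SetName L) m → ℕ
bound-sets []ᵛ            = 0
bound-sets ((_ , k) ∷ᵛ ρ) = suc k ⊔ bound-sets ρ

bound-num : ∀ (e : Vec Dᵗ n) i → boundᵗ (lookup e i) ℕ.≤ bound-nums e
bound-num (t ∷ᵛ e) zero    = ℕ.m≤m⊔n _ _
bound-num (t ∷ᵛ e) (suc i) = ℕ.≤-trans (bound-num e i) (ℕ.m≤n⊔m (boundᵗ t) _)

bound-set : ∀ (ρ : Vec (SetName L) m) i → proj₂ (lookup ρ i) ℕ.< bound-sets ρ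
bound-set ((_ , k) ∷ᵛ ρ) zero    = ℕ.m≤m⊔n (suc k) (bound-sets ρ)
bound-set ((_ , k) ∷ᵛ ρ) (suc i) = ℕ.≤-trans (bound-set ρ i) (ℕ.m≤n⊔m (suc k) _)

bound : Closure L → ℕ
bound (closure φ ρ e) = bound-sets ρ ⊔ bound-nums e

bounds : List (Closure L) → ℕ
bounds []ᴸ      = 0
bounds (c ∷ᴸ l) = bound c ⊔ bounds l

NumVal : ℕ → Set
NumVal n = ℕ → Term n

numsOf : NumVal n′ → Vec Dᵗ n → Fin n → Term n′
numsOf f e i = lookup e i ⟨ f ⟩

module _ {L : Lang} where

  SetVal : ℕ → Set
  SetVal m = HasSets L → ℕ → Fin m

  setsOf : SetVal m′ → Vec (SetName L) m → Fin m → Fin m′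
  setsOf g ρ i = g (proj₁ (lookup ρ i)) (proj₂ (lookup ρ i))

  instan : NumVal n → SetVal m → Closure L → Formula L m n
  instan f g (closure φ ρ e) = sub (setsOf g ρ) (numsOf f e) φ

  instan-fresh : ∀ {f : NumVal n} {f′ : NumVal n′} {g : SetVal m} {g′ : SetVal m′}
                 {r : Fin m → Fin m′} {σ : Fin n → Term n′} {v} →
                 (∀ k → k ℕ.< v → f k [ σ ]ᵗ ≡ f′ k) → (∀ h k → k ℕ.< v → r (g h k) ≡ g′ h k) →
                 ∀ c → bound c ℕ.≤ v → sub r σ (instan f g c) ≡ instan f′ g′ c
  instan-fresh p q (closure φ ρ e) b = trans (sub-∘ φ) (sub-cong
    (λ i → q _ _ (ℕ.≤-trans (bound-set ρ i) (ℕ.m⊔n≤o⇒m≤o (bound-sets ρ) _ b)))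
    (λ i → ⟨⟩-bound (lookup e i)
      (ℕ.≤-trans (bound-num e i) (ℕ.m⊔n≤o⇒n≤o (bound-sets ρ) _ b)) p) φ)

  instan-fresh* : ∀ {f : NumVal n} {f′ : NumVal n′} {g : SetVal m} {g′ : SetVal m′}
                  {r : Fin m → Fin m′} {σ : Fin n → Term n′} {v} →
                  (∀ k → k ℕ.< v → f k [ σ ]ᵗ ≡ f′ k) → (∀ h k → k ℕ.< v → r (g h k) ≡ g′ h k) →
                  ∀ l → bounds l ℕ.≤ v → map (sub r σ) (map (instan f g) l) ≡ map (instan f′ g′) l
  instan-fresh* p q []ᴸ      b = refl
  instan-fresh* p q (c ∷ᴸ l) b = cong₂ _∷ᴸ_
    (instan-fresh p q c (ℕ.m⊔n≤o⇒m≤o (bound c) _ b))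
    (instan-fresh* p q l (ℕ.m⊔n≤o⇒n≤o (bound c) _ b))

update : ∀ {A : Set} → ℕ → A → (ℕ → A) → ℕ → A
update v a f k with k ℕ.≟ v
... | yes _ = a
... | no  _ = f k

update-here : ∀ {A : Set} v (a : A) f → update v a f v ≡ a
update-here v a f with v ℕ.≟ v
... | yes _ = refl
... | no  q = ⊥-elim (q refl)

update-below : ∀ {A : Set} {v} {a : A} {f} k → k ℕ.< v → f k ≡ update v a f k
update-below {v = v} k p with k ℕ.≟ v
... | yes refl = ⊥-elim (ℕ.<-irrefl refl p)
... | no  _    = refl

-- Henkin construction of a model of 𝒯 in which falsity is the provability of φ₀.
module Henkin {L : Lang} (𝒯 : Theory L) (φ₀ : Sentence L) (m₀ : ℕ) (g₀ : HasSets L → ℕ → Fin m₀)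
  (extract : 𝒯 ∣ inScope {m = m₀} {n = 0} (¬ φ₀) ∷ᴸ []ᴸ ⊢ ⊥ → 𝒯 ⊢ φ₀) where

  R : Set
  R = 𝒯 ⊢ φ₀

  infix 0 _⊩̇_
  -- Constants have no place in the calculus, so derivability is required for every reading of them
  -- as terms and set variables. A fresh constant can then be read as an eigenvariable.
  record _⊩̇_ (Γ : List (Closure L)) (c : Closure L) : Set where
    constructor uniformly
    field
      at : ∀ {m n} (f : NumVal n) (g : SetVal {L} m) →
           𝒯 ∣ map (instan f g) Γ ⊢ instan f g c

  open _⊩̇_

  falsum : Closure L
  falsum = closure {#sets = 0} {#nums = 0} ⊥ []ᵛ []ᵛ

  cut : ∀ {Γ c d} → Γ ⊩̇ c → c ∷ᴸ Γ ⊩̇ d → Γ ⊩̇ d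
  cut p q = uniformly λ f g → ⇒E (⇒I (at q f g)) (at p f g)

  wk-⊩̇ : ∀ {Γ Δ c} → Γ ⊆ᴸ Δ → Γ ⊩̇ c → Δ ⊩̇ c
  wk-⊩̇ s p = uniformly λ f g → weaken (map⁺ (instan f g) s) (at p f g)

  ⊩̇-hyp : ∀ {Γ c} → c ∈ᴸ Γ → Γ ⊩̇ c
  ⊩̇-hyp i = uniformly λ f g → hyp (∈-map⁺ (instan f g) i)

  Con : List (Closure L) → Set
  Con Γ = Γ ⊩̇ falsum → R

  witness : ℕ → Closure L → List (Closure L)
  witness v (closure (∃ⁿ φ) ρ e)         = closure φ ρ (con v ∷ᵛ e) ∷ᴸ []ᴸ
  witness v (closure (∃ˢ_ ⦃ h ⦄ φ) ρ e)  = closure φ ((h , v) ∷ᵛ ρ) e ∷ᴸ []ᴸ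
  witness v _                            = []ᴸ

  instan-∃ⁿ : ∀ {v} {f : NumVal n′} {g : SetVal {L} m′} (φ : Formula L m (suc n)) ρ e →
              bound-nums e ℕ.≤ v →
              instan (update v (var zero) (wkᵗ ∘ f)) g (closure φ ρ (con v ∷ᵛ e)) ≡
              sub (setsOf g ρ) (liftⁿ (numsOf f e)) φ
  instan-∃ⁿ {v = v} {f} φ ρ e b = sub-cong (λ _ → refl) (λ where
    zero    → update-here v (var zero) (wkᵗ ∘ f)
    (suc i) → sym (⟨⟩-bound (lookup e i) (ℕ.≤-trans (bound-num e i) b) update-below)) φ

  instan-∃ˢ : ∀ {v} {f : NumVal n′} {g : SetVal {L} m′} ⦃ h : HasSets L ⦄
              (φ : Formula L (suc m) n) ρ e → bound-sets ρ ℕ.≤ v →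
              instan f (λ h → update v zero (suc ∘ g h)) (closure φ ((h , v) ∷ᵛ ρ) e) ≡
              sub (liftˢ (setsOf g ρ)) (numsOf f e) φ
  instan-∃ˢ {v = v} {g = g} ⦃ h ⦄ φ ρ e b = sub-cong (λ where
    zero    → update-here v zero (suc ∘ g h)
    (suc i) → sym (update-below _ (ℕ.≤-trans (bound-set ρ i) b))) (λ _ → refl) φ

  -- The constant `v` lies beyond all those occurring in `c` and `Γ`; reading it as the
  -- eigenvariable of the elimination rule leaves these formulas unchanged up to weakening.
  henkin : ∀ c Γ {v} → c ∈ᴸ Γ → bounds (c ∷ᴸ Γ) ℕ.≤ v →
           witness v c ++ Γ ⊩̇ falsum → Γ ⊩̇ falsum
  henkin (closure (∃ⁿ φ) ρ e) Γ {v} i b p = uniformly λ f g → ∃ⁿE (hyp (∈-map⁺ _ i))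
    (subst (λ Δ → 𝒯 ∣ Δ ⊢ ⊥)
      (cong₂ _∷ᴸ_ (instan-∃ⁿ {g = g} φ ρ e (ℕ.m⊔n≤o⇒n≤o (bound-sets ρ) _ (ℕ.m⊔n≤o⇒m≤o _ _ b)))
        (sym (instan-fresh* {g = g} update-below (λ _ _ _ → refl) Γ (ℕ.m⊔n≤o⇒n≤o _ _ b))))
      (at p (update v (var zero) (wkᵗ ∘ f)) g))
  henkin (closure (∃ˢ_ ⦃ h ⦄ φ) ρ e) Γ {v} i b p = uniformly λ f g → ∃ˢE (hyp (∈-map⁺ _ i))
    (subst (λ Δ → 𝒯 ∣ Δ ⊢ ⊥)
      (cong₂ _∷ᴸ_ (instan-∃ˢ {g = g} φ ρ e (ℕ.m⊔n≤o⇒m≤o (bound-sets ρ) _ (ℕ.m⊔n≤o⇒m≤o _ _ b)))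
        (sym (instan-fresh* {g = g} {σ = var} {v = v} (λ k _ → []ᵗ-var (f k)) (λ _ → update-below) Γ
          (ℕ.m⊔n≤o⇒n≤o _ _ b))))
      (at p f λ h → update v zero (suc ∘ g h)))
  henkin (closure (s ≐ t) ρ e) Γ i b p = p
  henkin (closure (s < t) ρ e) Γ i b p = p
  henkin (closure (t ∈ X) ρ e) Γ i b p = p
  henkin (closure ⊥ ρ e)       Γ i b p = p
  henkin (closure (φ ∧ ψ) ρ e) Γ i b p = p
  henkin (closure (φ ∨ ψ) ρ e) Γ i b p = p
  henkin (closure (φ ⇒ ψ) ρ e) Γ i b p = p
  henkin (closure (∀ⁿ φ) ρ e)  Γ i b p = p
  henkin (closure (∀ˢ φ) ρ e)  Γ i b p = p

  candidate : ℕ → Closure L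
  candidate = enumerate (countable-Closure L)

  data Step (i : ℕ) (Γ : List (Closure L)) : List (Closure L) → Set where
    add  : (let c = candidate i) → Con (c ∷ᴸ Γ) →
           -- `c` is listed twice because `henkin` is applied to `c` in the context `c ∷ᴸ Γ`.
           Step i Γ (witness (bounds (c ∷ᴸ c ∷ᴸ Γ)) c ++ c ∷ᴸ Γ)
    skip : (Con (candidate i ∷ᴸ Γ) → R) → Step i Γ Γ

  ¬′_ : Closure L → Closure L
  ¬′ closure φ ρ e = closure (¬ φ) ρ e

  start-con : Con (closure {#sets = 0} {#nums = 0} (¬ φ₀) []ᵛ []ᵛ ∷ᴸ []ᴸ)
  start-con p = extract (subst (λ φ → 𝒯 ∣ φ ∷ᴸ []ᴸ ⊢ ⊥)
    (sub-cong (λ ()) (λ ()) (¬ φ₀)) (at p {m₀} {0} (λ _ → O) g₀))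

  Step-total : ∀ i Γ → Con Γ → ((∃ λ Γ′ → Step i Γ Γ′) → R) → R
  Step-total i Γ _ k = k (_ , skip λ q → k (_ , add q))

  Step-functional : ∀ {i Γ Γ₁ Γ₂} → Step i Γ Γ₁ → Step i Γ Γ₂ → (Γ₁ ≡ Γ₂ → R) → R
  Step-functional (add _)  (add _)  k = k refl
  Step-functional (add q)  (skip r) k = r q
  Step-functional (skip r) (add q)  k = r q
  Step-functional (skip _) (skip _) k = k refl

  Step-extends : ∀ {i Γ Γ′} → Step i Γ Γ′ → Γ ⊆ᴸ Γ′
  Step-extends (add q)  x = xs⊆ys++xs _ _ (there x)
  Step-extends (skip _) x = x

  Step-con : ∀ {i Γ Γ′} → Step i Γ Γ′ → Con Γ → Con Γ′
  Step-con (add q)  ok p = q (henkin _ _ (here refl) ℕ.≤-refl p)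
  Step-con (skip _) ok   = ok

  open Chain R Step Con Step-total Step-functional Step-extends Step-con _ start-con public

  -- When the turn of `c` comes, it is consistent with the stage reached: an inconsistency would, by
  -- `cut`, reappear at a later stage that also contains `cs`.
  ⊩̇-consequence : ∀ {cs c} → All In cs → cs ⊩̇ c → In c
  ⊩̇-consequence {c = c} ps d k with enumerate-onto (countable-Closure L) c
  ... | i , refl = State-total i λ (Γ , s) →
    k (suc i , _ , step s (add λ p → gather ps s λ (_ , Δ , t , sub₁ , qs) →
          State-ok t (cut (wk-⊩̇ (All.lookup qs) d) (wk-⊩̇ (∷⁺ʳ _ sub₁) p)))
      , witness-in c)
    where
    witness-in : ∀ c {v Γ} → c ∈ᴸ witness v c ++ c ∷ᴸ Γ
    witness-in c = xs⊆ys++xs _ _ (here refl)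

  In-⊥ : In falsum → R
  In-⊥ p = p λ (_ , Γ , s , q) → State-ok s (⊩̇-hyp q)

  -- Maximality. If `c` is inconsistent with the stage at its turn, then its negation is a
  -- consequence of that stage; otherwise `c` is added, against the hypothesis.
  In-¬ : ∀ c → (In c → R) → In (¬′ c)
  In-¬ c n k with enumerate-onto (countable-Closure L) c
  ... | i , refl = State-total i λ (Γ , s) → n λ j →
    j (suc i , _ , step s (add λ p → ⊩̇-consequence
        (All.tabulate λ q j → j (i , Γ , s , q)) (uniformly λ f g → ⇒I (at p f g)) k)
      , xs⊆ys++xs _ _ (here refl))

  In-≡ : ∀ {c d} → (∀ {m n} (f : NumVal n) (g : SetVal {L} m) → instan f g c ≡ instan f g d) →
         In c → In d
  In-≡ {c} e p = ⊩̇-consequence {cs = c ∷ᴸ []ᴸ} (p ∷ᵃ []ᵃ) (uniformly λ f g →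
    ⊢-subst (e f g) (hyp (here refl)))

  In-stable : ∀ {c} → ((In c → R) → R) → In c
  In-stable p k = p λ i → i k

  In-∃ⁿ : ∀ {m n} {φ : Formula L m (suc n)} {ρ e} →
          In (closure (∃ⁿ φ) ρ e) → ((∃ λ d → In (closure φ ρ (d ∷ᵛ e))) → R) → R
  In-∃ⁿ {φ = φ} {ρ} {e} p k with enumerate-onto (countable-Closure L) (closure (∃ⁿ φ) ρ e)
  ... | i , q = State-total i λ (Γ , s) →
    k (con (bounds (closure (∃ⁿ φ) ρ e ∷ᴸ closure (∃ⁿ φ) ρ e ∷ᴸ Γ)) , λ j →
      j (suc i , _ , step s (subst (λ c → Con (c ∷ᴸ Γ) →
            Step i Γ (witness (bounds (c ∷ᴸ c ∷ᴸ Γ)) c ++ c ∷ᴸ Γ)) q add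
          λ d → p λ (_ , Δ , t , r) → State-join s t λ (_ , _ , u , sub₁ , sub₂) →
            State-ok u (cut (⊩̇-hyp (sub₂ r)) (wk-⊩̇ (∷⁺ʳ _ sub₁) d)))
        , here refl))

  In-∃ˢ : ∀ ⦃ h : HasSets L ⦄ {m n} {φ : Formula L (suc m) n} {ρ e} →
          In (closure (∃ˢ φ) ρ e) → ((∃ λ v → In (closure φ ((h , v) ∷ᵛ ρ) e)) → R) → R
  In-∃ˢ {φ = φ} {ρ} {e} p k with enumerate-onto (countable-Closure L) (closure (∃ˢ φ) ρ e)
  ... | i , q = State-total i λ (Γ , s) →
    k (bounds (closure (∃ˢ φ) ρ e ∷ᴸ closure (∃ˢ φ) ρ e ∷ᴸ Γ) , λ j →
      j (suc i , _ , step s (subst (λ c → Con (c ∷ᴸ Γ) →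
            Step i Γ (witness (bounds (c ∷ᴸ c ∷ᴸ Γ)) c ++ c ∷ᴸ Γ)) q add
          λ d → p λ (_ , Δ , t , r) → State-join s t λ (_ , _ , u , sub₁ , sub₂) →
            State-ok u (cut (⊩̇-hyp (sub₂ r)) (wk-⊩̇ (∷⁺ʳ _ sub₁) d)))
        , here refl))

  pred : SetName L → Dᵗ → Set
  pred (h , v) d = In (closure (_∈_ ⦃ h ⦄ x₀ zero) ((h , v) ∷ᵛ []ᵛ) (d ∷ᵛ []ᵛ))

  eqᵗ lessᵗ : Dᵗ → Dᵗ → Closure L
  eqᵗ   s t = closure {#sets = 0} (x₀ ≐ x₁) []ᵛ (s ∷ᵛ t ∷ᵛ []ᵛ)
  lessᵗ s t = closure {#sets = 0} (x₀ < x₁) []ᵛ (s ∷ᵛ t ∷ᵛ []ᵛ)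

  consequence₀ : ∀ {c} → (∀ {m n} (f : NumVal n) (g : SetVal {L} m) → 𝒯 ∣ []ᴸ ⊢ instan f g c) → In c
  consequence₀ d = ⊩̇-consequence []ᵃ (uniformly d)

  consequence₁ : ∀ {a c} → (∀ {m n} (f : NumVal n) (g : SetVal {L} m) →
                   𝒯 ∣ instan f g a ∷ᴸ []ᴸ ⊢ instan f g c) → In a → In c
  consequence₁ d p = ⊩̇-consequence (p ∷ᵃ []ᵃ) (uniformly d)

  consequence₂ : ∀ {a b c} → (∀ {m n} (f : NumVal n) (g : SetVal {L} m) →
                   𝒯 ∣ instan f g a ∷ᴸ instan f g b ∷ᴸ []ᴸ ⊢ instan f g c) → In a → In b → In c
  consequence₂ d p q = ⊩̇-consequence (p ∷ᵃ q ∷ᵃ []ᵃ) (uniformly d)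

  hyp₀ : ∀ {Γ : List (Formula L m n)} {φ} → 𝒯 ∣ φ ∷ᴸ Γ ⊢ φ
  hyp₀ = hyp (here refl)

  hyp₁ : ∀ {Γ : List (Formula L m n)} {φ ψ} → 𝒯 ∣ ψ ∷ᴸ φ ∷ᴸ Γ ⊢ φ
  hyp₁ = hyp (there (here refl))

  𝔐 : Str
  𝔐 = record
    { D        = Dᵗ
    ; R        = R
    ; _≈_      = λ s t → In (eqᵗ s t)
    ; _⊏_      = λ s t → In (lessᵗ s t)
    ; 0ᴰ       = O′
    ; Sᴰ       = S′
    ; Hᴰ       = H′
    ; Tᴰ       = T′
    ; _+ᴰ_     = _+′_
    ; _·ᴰ_     = _·′_
    ; ⟪_,_⟫ᴰ   = ⟪_,_⟫′
    ; ≈-refl   = λ {x} → consequence₀ {eqᵗ x x} λ f g → ≐I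
    ; ≈-sym    = λ {x} {y} → consequence₁ {eqᵗ x y} {eqᵗ y x} λ f g → ≐-sym hyp₀
    ; ≈-trans  = λ {x} {y} {z} → consequence₂ {eqᵗ x y} {eqᵗ y z} {eqᵗ x z} λ f g →
                   ≐-trans hyp₀ hyp₁
    ; S-cong   = λ {x} {y} → consequence₁ {eqᵗ x y} {eqᵗ (S′ x) (S′ y)} λ f g →
                   ≐-cong (S x₀) refl refl hyp₀
    ; H-cong   = λ {x} {y} → consequence₁ {eqᵗ x y} {eqᵗ (H′ x) (H′ y)} λ f g →
                   ≐-cong (H x₀) refl refl hyp₀
    ; T-cong   = λ {x} {y} → consequence₁ {eqᵗ x y} {eqᵗ (T′ x) (T′ y)} λ f g →
                   ≐-cong (T x₀) refl refl hyp₀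
    ; +-cong   = λ {x} {x′} {y} {y′} →
                   consequence₂ {eqᵗ x x′} {eqᵗ y y′} {eqᵗ (x +′ y) (x′ +′ y′)} λ f g →
                   ≐-cong₂ _+_ (λ _ _ → refl) hyp₀ hyp₁
    ; ·-cong   = λ {x} {x′} {y} {y′} →
                   consequence₂ {eqᵗ x x′} {eqᵗ y y′} {eqᵗ (x ·′ y) (x′ ·′ y′)} λ f g →
                   ≐-cong₂ _·_ (λ _ _ → refl) hyp₀ hyp₁
    ; ⟪⟫-cong  = λ {x} {x′} {y} {y′} →
                   consequence₂ {eqᵗ x x′} {eqᵗ y y′} {eqᵗ ⟪ x , y ⟫′ ⟪ x′ , y′ ⟫′} λ f g →
                   ≐-cong₂ ⟪_,_⟫ (λ _ _ → refl) hyp₀ hyp₁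
    ; ⊏-resp   = λ {x} {x′} {y} {y′} p q r → ⊩̇-consequence
                   {cs = eqᵗ x x′ ∷ᴸ eqᵗ y y′ ∷ᴸ lessᵗ x y ∷ᴸ []ᴸ} {c = lessᵗ x′ y′}
                   (p ∷ᵃ q ∷ᵃ r ∷ᵃ []ᵃ)
                   (uniformly λ f g → <-replace hyp₀ hyp₁ (hyp (there (there (here refl)))))
    ; ≈-stable = λ {x} {y} → In-stable {eqᵗ x y}
    ; ⊏-stable = λ {x} {y} → In-stable {lessᵗ x y}
    }

  open Str 𝔐 using (Good; ≈-refl; _≈_)
  open Truth 𝔐

  pred-good : ∀ v → Good (pred v)
  pred-good (h , v) = record
    { stable = In-stable
    ; resp   = λ {d} {d′} → consequence₂
        {eqᵗ d d′} {closure (_∈_ ⦃ h ⦄ x₀ zero) ((h , v) ∷ᵛ []ᵛ) (d ∷ᵛ []ᵛ)} λ f g →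
          ∈-replace ⦃ h ⦄ hyp₀ hyp₁
    }

  𝔉 : Frame
  𝔉 = flat (λ X → Σ (SetName L) λ v → X ≡ pred v) λ { (v , refl) → pred-good v }

  open Forcing 𝔉

  ⟦⟧-⟨⟩ : ∀ (t : Term n) {ê : Fin n → Dᵗ} (e : Vec Dᵗ n) → (∀ i → ê i ≡ lookup e i) →
          ∀ {n′} (f : NumVal n′) → ⟦ t ⟧ ê ⟨ f ⟩ ≡ t [ numsOf f e ]ᵗ
  ⟦⟧-⟨⟩ (var i)   e q f = cong (_⟨ f ⟩) (q i)
  ⟦⟧-⟨⟩ O         e q f = refl
  ⟦⟧-⟨⟩ (S t)     e q f = cong S (⟦⟧-⟨⟩ t e q f)
  ⟦⟧-⟨⟩ (H t)     e q f = cong H (⟦⟧-⟨⟩ t e q f)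
  ⟦⟧-⟨⟩ (T t)     e q f = cong T (⟦⟧-⟨⟩ t e q f)
  ⟦⟧-⟨⟩ (s + t)   e q f = cong₂ _+_ (⟦⟧-⟨⟩ s e q f) (⟦⟧-⟨⟩ t e q f)
  ⟦⟧-⟨⟩ (s · t)   e q f = cong₂ _·_ (⟦⟧-⟨⟩ s e q f) (⟦⟧-⟨⟩ t e q f)
  ⟦⟧-⟨⟩ ⟪ s , t ⟫ e q f = cong₂ ⟪_,_⟫ (⟦⟧-⟨⟩ s e q f) (⟦⟧-⟨⟩ t e q f)

  instan-∀ⁿ : ∀ {f : NumVal n′} {g : SetVal {L} m′} (φ : Formula L m (suc n)) ρ e d →
              sub (setsOf g ρ) (liftⁿ (numsOf f e)) φ [ d ⟨ f ⟩ ] ≡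
              instan f g (closure φ ρ (d ∷ᵛ e))
  instan-∀ⁿ φ ρ e d = trans (sub-∘ φ) (sub-cong (λ _ → refl)
    (λ { zero → refl ; (suc i) → wkᵗ-inst _ _ }) φ)

  instan-∀ˢ : ∀ {f : NumVal n′} {g : SetVal {L} m′} (φ : Formula L (suc m) n) ρ e h v →
              sub (liftˢ (setsOf g ρ)) (numsOf f e) φ [ g h v ]ˢ ≡
              instan f g (closure φ ((h , v) ∷ᵛ ρ) e)
  instan-∀ˢ φ ρ e h v = trans (sub-∘ φ) (sub-cong
    (λ { zero → refl ; (suc i) → refl }) (λ _ → []ᵗ-var _) φ)


  HasSets-unique : (h h′ : HasSets L) → h ≡ h′
  HasSets-unique hasSets hasSets = refl

  -- For implications and universal formulas, membership is shown by contradiction: otherwise the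
  -- negation belongs to the union by `In-¬`, and so does a true premise with a false conclusion, or
  -- a named counterexample.
  truth : ∀ (φ : Formula L m n) {ρ̂ ê} ρ e → (∀ i → ρ̂ i ≡ pred (lookup ρ i)) →
          (∀ i → ê i ≡ lookup e i) → ∀ {w} → (w ⊩ φ [ ρ̂ , ê ]) ⟷ In (closure φ ρ e)
  truth (s ≐ t) ρ e p q =
    (λ (lift x) → In-≡ (λ f g → cong₂ _≐_ (⟦⟧-⟨⟩ s e q f) (⟦⟧-⟨⟩ t e q f)) x) ,
    (λ x → lift (In-≡ (λ f g → sym (cong₂ _≐_ (⟦⟧-⟨⟩ s e q f) (⟦⟧-⟨⟩ t e q f))) x))
  truth (s < t) ρ e p q =
    (λ (lift x) → In-≡ (λ f g → cong₂ _<_ (⟦⟧-⟨⟩ s e q f) (⟦⟧-⟨⟩ t e q f)) x) ,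
    (λ x → lift (In-≡ (λ f g → sym (cong₂ _<_ (⟦⟧-⟨⟩ s e q f) (⟦⟧-⟨⟩ t e q f))) x))
  truth (_∈_ ⦃ h ⦄ t X) ρ e p q =
    (λ (lift x) → In-≡ (λ f g → eq′ f g) (subst (λ Y → Y _) (p X) x)) ,
    (λ x → lift (subst (λ Y → Y _) (sym (p X)) (In-≡ (λ f g → sym (eq′ f g)) x)))
    where
    eq′ : ∀ {m n} (f : NumVal n) (g : SetVal {L} m) →
          _∈_ ⦃ proj₁ (lookup ρ X) ⦄ (⟦ t ⟧ _ ⟨ f ⟩) (setsOf g ρ X) ≡
          _∈_ ⦃ h ⦄ (t [ numsOf f e ]ᵗ) (setsOf g ρ X)
    eq′ f g = cong₂ (λ h t → _∈_ ⦃ h ⦄ t _) (HasSets-unique _ h) (⟦⟧-⟨⟩ t e q f)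
  truth ⊥ ρ e p q = (λ (lift r) _ → r) , (λ x → lift (In-⊥ (In-≡ (λ _ _ → refl) x)))
  truth (φ ∧ ψ) ρ e p q =
    (λ (x , y) → consequence₂ {closure φ ρ e} {closure ψ ρ e} (λ f g → ∧I hyp₀ hyp₁)
                   (proj₁ (truth φ ρ e p q) x) (proj₁ (truth ψ ρ e p q) y)) ,
    (λ x → proj₂ (truth φ ρ e p q) (consequence₁ {closure (φ ∧ ψ) ρ e} (λ f g → ∧E₁ hyp₀) x) ,
           proj₂ (truth ψ ρ e p q) (consequence₁ {closure (φ ∧ ψ) ρ e} (λ f g → ∧E₂ hyp₀) x))
  truth (φ ∨ ψ) ρ e p q =
    (λ j → In-stable {closure (φ ∨ ψ) ρ e} λ k → j _ λ where
      _ (inj₁ x) → k (consequence₁ {closure φ ρ e} (λ f g → ∨I₁ hyp₀) (proj₁ (truth φ ρ e p q) x))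
      _ (inj₂ y) →
        k (consequence₁ {closure ψ ρ e} (λ f g → ∨I₂ hyp₀) (proj₁ (truth ψ ρ e p q) y))) ,
    (λ x _ k → In-⊥ (⊩̇-consequence
      {cs = closure (φ ∨ ψ) ρ e ∷ᴸ closure (¬ φ) ρ e ∷ᴸ closure (¬ ψ) ρ e ∷ᴸ []ᴸ}
      (x ∷ᵃ In-¬ _ (λ y → k _ (inj₁ (proj₂ (truth φ ρ e p q) y)))
         ∷ᵃ In-¬ _ (λ y → k _ (inj₂ (proj₂ (truth ψ ρ e p q) y))) ∷ᵃ []ᵃ)
      (uniformly λ f g → ∨E hyp₀ (⇒E (hyp (there (there (here refl)))) hyp₀)
                                 (⇒E (hyp (there (there (there (here refl))))) hyp₀))))
  truth (φ ⇒ ψ) ρ e p q =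
    (λ h → In-stable {closure (φ ⇒ ψ) ρ e} λ k →
      let n = In-¬ (closure (φ ⇒ ψ) ρ e) k in
      k (consequence₁ {closure ψ ρ e} (λ f g → ⇒I hyp₁) (proj₁ (truth ψ ρ e p q) (h _
        (proj₂ (truth φ ρ e p q) (consequence₁ {closure (¬ (φ ⇒ ψ)) ρ e}
          (λ f g → raa (⇒E hyp₁ (⇒I (ex-falso (⇒E hyp₁ hyp₀))))) n)))))) ,
    (λ x _ y → proj₂ (truth ψ ρ e p q) (consequence₂ {closure (φ ⇒ ψ) ρ e} {closure φ ρ e}
      (λ f g → ⇒E hyp₀ hyp₁) x (proj₁ (truth φ ρ e p q) y)))
  truth (∀ⁿ φ) ρ e p q =
    (λ h → In-stable {closure (∀ⁿ φ) ρ e} λ k → In-∃ⁿ {φ = ¬ φ}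
      (consequence₁ {closure (¬ (∀ⁿ φ)) ρ e} (λ f g → ¬∀ⁿ⊢∃ⁿ¬) (In-¬ (closure (∀ⁿ φ) ρ e) k))
      λ (d , n) → In-⊥ (consequence₂ {closure (¬ φ) ρ (d ∷ᵛ e)} {closure φ ρ (d ∷ᵛ e)}
        (λ f g → ⇒E hyp₀ hyp₁) n (proj₁ (truth φ ρ (d ∷ᵛ e) p (q⁺ d)) (h d)))) ,
    (λ x d → proj₂ (truth φ ρ (d ∷ᵛ e) p (q⁺ d)) (consequence₁ {closure (∀ⁿ φ) ρ e}
      (λ f g → ⊢-subst (instan-∀ⁿ {g = g} φ ρ e d) (∀ⁿE hyp₀ (d ⟨ f ⟩))) x))
    where
    q⁺ : ∀ d i → (d ∷ _) i ≡ lookup (d ∷ᵛ e) i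
    q⁺ d zero    = refl
    q⁺ d (suc i) = q i
  truth (∃ⁿ φ) ρ e p q =
    (λ j → In-stable {closure (∃ⁿ φ) ρ e} λ k → j _ λ _ (d , x) →
      k (consequence₁ {closure φ ρ (d ∷ᵛ e)} (λ f g → ∃ⁿI (d ⟨ f ⟩)
          (⊢-subst (sym (instan-∀ⁿ {g = g} φ ρ e d)) hyp₀))
        (proj₁ (truth φ ρ (d ∷ᵛ e) p (q⁺ d)) x))) ,
    (λ x _ k → In-∃ⁿ x λ (d , y) → k _ (d , proj₂ (truth φ ρ (d ∷ᵛ e) p (q⁺ d)) y))
    where
    q⁺ : ∀ d i → (d ∷ _) i ≡ lookup (d ∷ᵛ e) i
    q⁺ d zero    = refl
    q⁺ d (suc i) = q i
  truth (∀ˢ_ ⦃ h ⦄ φ) {ρ̂} ρ e p q =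
    (λ r → In-stable {closure (∀ˢ φ) ρ e} λ k → In-∃ˢ {φ = ¬ φ}
      (consequence₁ {closure (¬ (∀ˢ φ)) ρ e} (λ f g → ¬∀ˢ⊢∃ˢ¬) (In-¬ (closure (∀ˢ φ) ρ e) k))
      λ (v , n) → In-⊥ (consequence₂ {closure (¬ φ) ((h , v) ∷ᵛ ρ) e} {closure φ ((h , v) ∷ᵛ ρ) e}
        (λ f g → ⇒E hyp₀ hyp₁) n
        (proj₁ (truth φ ((h , v) ∷ᵛ ρ) e (p⁺ refl) q) (r _ ((h , v) , refl))))) ,
    (λ { x _ ((h , v) , r) → proj₂ (truth φ ((h , v) ∷ᵛ ρ) e (p⁺ r) q)
      (consequence₁ {closure (∀ˢ φ) ρ e}
        (λ f g → ⊢-subst (instan-∀ˢ {g = g} φ ρ e h v) (∀ˢE hyp₀ (g h v))) x) })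
    where
    p⁺ : ∀ {X v} → X ≡ pred v → ∀ i → (X ∷ ρ̂) i ≡ pred (lookup (v ∷ᵛ ρ) i)
    p⁺ r zero    = r
    p⁺ r (suc i) = p i
  truth (∃ˢ_ ⦃ h ⦄ φ) {ρ̂} ρ e p q =
    (λ j → In-stable {closure (∃ˢ φ) ρ e} λ k → j _ λ { _ (X , ((h , v) , r) , x) →
      k (consequence₁ {closure φ ((h , v) ∷ᵛ ρ) e} (λ f g → ∃ˢI (g h v)
          (⊢-subst (sym (instan-∀ˢ {g = g} φ ρ e h v)) hyp₀))
        (proj₁ (truth φ ((h , v) ∷ᵛ ρ) e (p⁺ r) q) x)) }) ,
    (λ x _ k → In-∃ˢ x λ (v , y) →
      k _ (pred (h , v) , ((h , v) , refl) , proj₂ (truth φ ((h , v) ∷ᵛ ρ) e (p⁺ refl) q) y))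
    where
    p⁺ : ∀ {X v} → X ≡ pred v → ∀ i → (X ∷ ρ̂) i ≡ pred (lookup (v ∷ᵛ ρ) i)
    p⁺ r zero    = r
    p⁺ r (suc i) = p i

  model : ∀ {φ} → 𝒯 φ → ∀ {w} → w ⊩ φ [ [] , [] ]
  model {φ} a = proj₂ (truth φ []ᵛ []ᵛ (λ ()) (λ ()))
    (consequence₀ λ f g → ⊢-subst (sub-cong (λ ()) (λ ()) φ) (axiom a))

  -- `¬ φ₀` belongs to the first stage, so the truth of `φ₀` puts falsum into the union; and falsity
  -- is the provability of `φ₀`.
  complete : ∀ {w} → w ⊩ φ₀ [ [] , [] ] → R
  complete x = In-⊥ (consequence₂ {closure {#sets = 0} {#nums = 0} φ₀ []ᵛ []ᵛ}
    {closure (¬ φ₀) []ᵛ []ᵛ} (λ f g → ⇒E hyp₁ hyp₀)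
    (proj₁ (truth φ₀ []ᵛ []ᵛ (λ ()) (λ ())) x) λ k → k (0 , _ , start , here refl))

-- Definable predicates

tsub : Tm A n → (Fin n → Tm A n′) → Tm A n′
tsub (vr i)     σ = σ i
tsub (con a)    σ = con a
tsub O′         σ = O′
tsub (S′ t)     σ = S′ (tsub t σ)
tsub (H′ t)     σ = H′ (tsub t σ)
tsub (T′ t)     σ = T′ (tsub t σ)
tsub (s +′ t)   σ = tsub s σ +′ tsub t σ
tsub (s ·′ t)   σ = tsub s σ ·′ tsub t σ
tsub ⟪ s , t ⟫′ σ = ⟪ tsub s σ , tsub t σ ⟫′

weakenᵗ : Tm A n → Tm A (suc n)
weakenᵗ t = tsub t (vr ∘ suc)

liftᵗ : (Fin n → Tm A n′) → Fin (suc n) → Tm A (suc n′)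
liftᵗ σ = vr zero ∷ (weakenᵗ ∘ σ)

-- Substitution of terms for number variables and of the codes α, with
-- parameters q, for set variables.
plug : (Fin m → Code A m′ (suc k)) → (Fin k → Tm A n′) → (Fin n → Tm A n′) →
       Code A m n → Code A m′ n′

csub : (Fin n → Tm A n′) → Code A m n → Code A m n′
csub σ (s ≐′ t)  = tsub s σ ≐′ tsub t σ
csub σ (s <′ t)  = tsub s σ <′ tsub t σ
csub σ (t ∈′ X)  = tsub t σ ∈′ X
csub σ ⊥′        = ⊥′
csub σ (c ∧′ d)  = csub σ c ∧′ csub σ d
csub σ (c ⇒′ d)  = csub σ c ⇒′ csub σ d
csub σ (∀<′ t c) = ∀<′ (tsub t σ) (csub (liftᵗ σ) c)

plug α q σ (s ≐′ t)  = tsub s σ ≐′ tsub t σ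
plug α q σ (s <′ t)  = tsub s σ <′ tsub t σ
plug α q σ (t ∈′ X)  = csub (tsub t σ ∷ q) (α X)
plug α q σ ⊥′        = ⊥′
plug α q σ (c ∧′ d)  = plug α q σ c ∧′ plug α q σ d
plug α q σ (c ⇒′ d)  = plug α q σ c ⇒′ plug α q σ d
plug α q σ (∀<′ t c) = ∀<′ (tsub t σ) (plug α (weakenᵗ ∘ q) (liftᵗ σ) c)

module Codes (𝔖 : Str) where
  open Str 𝔖

  evᵗ : Tm D n → (Fin n → D) → D
  evᵗ (vr i)     e = e i
  evᵗ (con a)    e = a
  evᵗ O′         e = 0ᴰ
  evᵗ (S′ t)     e = Sᴰ (evᵗ t e)
  evᵗ (H′ t)     e = Hᴰ (evᵗ t e)
  evᵗ (T′ t)     e = Tᴰ (evᵗ t e)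
  evᵗ (s +′ t)   e = evᵗ s e +ᴰ evᵗ t e
  evᵗ (s ·′ t)   e = evᵗ s e ·ᴰ evᵗ t e
  evᵗ ⟪ s , t ⟫′ e = ⟪ evᵗ s e , evᵗ t e ⟫ᴰ

  ev : Code D m n → (Fin m → D → Set) → (Fin n → D) → Set
  ev (s ≐′ t)  X e = evᵗ s e ≈ evᵗ t e
  ev (s <′ t)  X e = evᵗ s e ⊏ evᵗ t e
  ev (t ∈′ i)  X e = X i (evᵗ t e)
  ev ⊥′        X e = R
  ev (c ∧′ d)  X e = ev c X e × ev d X e
  ev (c ⇒′ d)  X e = ev c X e → ev d X e
  ev (∀<′ t c) X e = ∀ d → d ⊏ evᵗ t e → ev c X (d ∷ e)

  evᵗ-tsub : {σ : Fin n → Tm D n′} {e : Fin n′ → D} {e′ : Fin n → D} →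
             (∀ i → evᵗ (σ i) e ≡ e′ i) → ∀ t → evᵗ (tsub t σ) e ≡ evᵗ t e′
  evᵗ-tsub p (vr i)     = p i
  evᵗ-tsub p (con a)    = refl
  evᵗ-tsub p O′         = refl
  evᵗ-tsub p (S′ t)     = cong Sᴰ (evᵗ-tsub p t)
  evᵗ-tsub p (H′ t)     = cong Hᴰ (evᵗ-tsub p t)
  evᵗ-tsub p (T′ t)     = cong Tᴰ (evᵗ-tsub p t)
  evᵗ-tsub p (s +′ t)   = cong₂ _+ᴰ_ (evᵗ-tsub p s) (evᵗ-tsub p t)
  evᵗ-tsub p (s ·′ t)   = cong₂ _·ᴰ_ (evᵗ-tsub p s) (evᵗ-tsub p t)
  evᵗ-tsub p ⟪ s , t ⟫′ = cong₂ ⟪_,_⟫ᴰ (evᵗ-tsub p s) (evᵗ-tsub p t)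

  evᵗ-lift : (σ : Fin n → Tm D n′) {e : Fin n′ → D} {e′ : Fin n → D} →
             (∀ i → evᵗ (σ i) e ≡ e′ i) → ∀ d i → evᵗ (liftᵗ σ i) (d ∷ e) ≡ (d ∷ e′) i
  evᵗ-lift σ p d zero    = refl
  evᵗ-lift σ p d (suc i) = trans (evᵗ-tsub (λ _ → refl) (σ i)) (p i)

  ev-csub : {X : Fin m → D → Set} {σ : Fin n → Tm D n′} {e : Fin n′ → D} {e′ : Fin n → D} →
            (∀ i → evᵗ (σ i) e ≡ e′ i) → ∀ c → ev (csub σ c) X e ⟷ ev c X e′
  ev-csub {σ = σ} {e} {e′} p (s ≐′ t)
    rewrite evᵗ-tsub {σ = σ} {e} {e′} p s | evᵗ-tsub {σ = σ} {e} {e′} p t = ⟷-refl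
  ev-csub {σ = σ} {e} {e′} p (s <′ t)
    rewrite evᵗ-tsub {σ = σ} {e} {e′} p s | evᵗ-tsub {σ = σ} {e} {e′} p t = ⟷-refl
  ev-csub {σ = σ} {e} {e′} p (t ∈′ i)
    rewrite evᵗ-tsub {σ = σ} {e} {e′} p t = ⟷-refl
  ev-csub p ⊥′ = ⟷-refl
  ev-csub p (c ∧′ d) = ev-csub p c ×-⟷ ev-csub p d
  ev-csub p (c ⇒′ d) = ev-csub p c →-⟷ ev-csub p d
  ev-csub {σ = σ} {e} {e′} p (∀<′ t c)
    rewrite evᵗ-tsub {σ = σ} {e} {e′} p t =
    ∀-⟷ λ d → ∀-⟷ λ _ → ev-csub (evᵗ-lift σ p d) c

  ev-plug : {X : Fin m → D → Set} {Y : Fin m′ → D → Set} {α : Fin m → Code D m′ (suc k)}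
            {q : Fin k → Tm D n′} {σ : Fin n → Tm D n′} {e : Fin n′ → D} {e′ : Fin n → D}
            {r : Fin k → D} →
            (∀ i d → ev (α i) Y (d ∷ r) ⟷ X i d) →
            (∀ i → evᵗ (q i) e ≡ r i) → (∀ i → evᵗ (σ i) e ≡ e′ i) →
            ∀ c → ev (plug α q σ c) Y e ⟷ ev c X e′
  ev-plug {σ = σ} {e} {e′} a u p (s ≐′ t)
    rewrite evᵗ-tsub {σ = σ} {e} {e′} p s | evᵗ-tsub {σ = σ} {e} {e′} p t = ⟷-refl
  ev-plug {σ = σ} {e} {e′} a u p (s <′ t)
    rewrite evᵗ-tsub {σ = σ} {e} {e′} p s | evᵗ-tsub {σ = σ} {e} {e′} p t = ⟷-refl
  ev-plug {α = α} {q} {σ} {e} {e′} {r} a u p (t ∈′ i) =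
    ⟷-trans (ev-csub w (α i)) (a i _)
    where
    w : ∀ j → evᵗ ((tsub t σ ∷ q) j) e ≡ (evᵗ t e′ ∷ r) j
    w zero    = evᵗ-tsub p t
    w (suc j) = u j
  ev-plug a u p ⊥′ = ⟷-refl
  ev-plug a u p (c ∧′ d) = ev-plug a u p c ×-⟷ ev-plug a u p d
  ev-plug a u p (c ⇒′ d) = ev-plug a u p c →-⟷ ev-plug a u p d
  ev-plug {q = q} {σ} {e} {e′} a u p (∀<′ t c)
    rewrite evᵗ-tsub {σ = σ} {e} {e′} p t =
    ∀-⟷ λ d → ∀-⟷ λ _ →
      ev-plug a (λ i → trans (evᵗ-tsub (λ _ → refl) (q i)) (u i)) (evᵗ-lift σ p d) c

  evᵗ-resp : {e e′ : Fin n → D} → (∀ i → e i ≈ e′ i) → ∀ t → evᵗ t e ≈ evᵗ t e′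
  evᵗ-resp p (vr i)     = p i
  evᵗ-resp p (con a)    = ≈-refl
  evᵗ-resp p O′         = ≈-refl
  evᵗ-resp p (S′ t)     = S-cong (evᵗ-resp p t)
  evᵗ-resp p (H′ t)     = H-cong (evᵗ-resp p t)
  evᵗ-resp p (T′ t)     = T-cong (evᵗ-resp p t)
  evᵗ-resp p (s +′ t)   = +-cong (evᵗ-resp p s) (evᵗ-resp p t)
  evᵗ-resp p (s ·′ t)   = ·-cong (evᵗ-resp p s) (evᵗ-resp p t)
  evᵗ-resp p ⟪ s , t ⟫′ = ⟪⟫-cong (evᵗ-resp p s) (evᵗ-resp p t)

  module _ {X : Fin m → D → Set} (g : ∀ i → Good (X i)) where

    ev-stable : ∀ (c : Code D m n) {e} → Stable (ev c X e)
    ev-stable (s ≐′ t)  x = ≈-stable x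
    ev-stable (s <′ t)  x = ⊏-stable x
    ev-stable (t ∈′ i)  x = Good.stable (g i) x
    ev-stable ⊥′        x = x id
    ev-stable (c ∧′ d)  x =
      ev-stable c (λ k → x (k ∘ proj₁)) , ev-stable d (λ k → x (k ∘ proj₂))
    ev-stable (c ⇒′ d)  x y = ev-stable d λ k → x λ f → k (f y)
    ev-stable (∀<′ t c) x d p = ev-stable c λ k → x λ f → k (f d p)

    ev-resp : ∀ (c : Code D m n) {e e′} → (∀ i → e i ≈ e′ i) → ev c X e → ev c X e′
    ev-resp (s ≐′ t)  p x = ≈-trans (≈-sym (evᵗ-resp p s)) (≈-trans x (evᵗ-resp p t))
    ev-resp (s <′ t)  p x = ⊏-resp (evᵗ-resp p s) (evᵗ-resp p t) x
    ev-resp (t ∈′ i)  p x = Good.resp (g i) (evᵗ-resp p t) x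
    ev-resp ⊥′        p x = x
    ev-resp (c ∧′ d)  p (x , y) = ev-resp c p x , ev-resp d p y
    ev-resp (c ⇒′ d)  p f x = ev-resp d p (f (ev-resp c (≈-sym ∘ p) x))
    ev-resp (∀<′ t c) p f d q =
      ev-resp c (λ { zero → ≈-refl ; (suc i) → p i })
        (f d (⊏-resp ≈-refl (≈-sym (evᵗ-resp p t)) q))

  at₂ : ∀ {e : Fin n → D} {s t : Tm D n} → ∀ i →
        evᵗ ((s ∷ t ∷ []) i) e ≡ (evᵗ s e ∷ evᵗ t e ∷ []) i
  at₂ 0F = refl
  at₂ 1F = refl

  at₃ : ∀ {e : Fin n → D} {s t u : Tm D n} → ∀ i →
        evᵗ ((s ∷ t ∷ u ∷ []) i) e ≡ (evᵗ s e ∷ evᵗ t e ∷ evᵗ u e ∷ []) i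
  at₃ 0F = refl
  at₃ 1F = refl
  at₃ 2F = refl

  -- Induction and collection are available for codes only. The combinators below assemble the code
  -- alongside the predicate, so that later arguments can speak of predicates.
  record Def (X : Fin m → D → Set) (Q : (Fin n → D) → Set) : Set where
    constructor def
    field
      code : Code D m n
      spec : ∀ e → ev code X e ⟷ Q e

  open Def public

  module _ {X : Fin m → D → Set} where

    def-code : (c : Code D m n) → Def X (ev c X)
    def-code c = def c λ _ → ⟷-refl

    infixr 4 _∧ᵈ_
    infixr 2 _⇒ᵈ_
    _∧ᵈ_ : {P Q : (Fin n → D) → Set} → Def X P → Def X Q → Def X (λ e → P e × Q e)
    def c p ∧ᵈ def d q = def (c ∧′ d) λ e → p e ×-⟷ q e

    _⇒ᵈ_ : {P Q : (Fin n → D) → Set} → Def X P → Def X Q → Def X (λ e → P e → Q e)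
    def c p ⇒ᵈ def d q = def (c ⇒′ d) λ e → p e →-⟷ q e

    ⊥ᵈ : Def {n = n} X (λ e → R)
    ⊥ᵈ = def-code ⊥′

    ¬ᵈ_ : {P : (Fin n → D) → Set} → Def X P → Def X (λ e → P e → R)
    ¬ᵈ p = p ⇒ᵈ ⊥ᵈ

    ∀ᵈ : (t : Tm D n) {P : (Fin (suc n) → D) → Set} → Def X P →
         Def X (λ e → ∀ d → d ⊏ evᵗ t e → P (d ∷ e))
    ∀ᵈ t (def c p) = def (∀<′ t c) λ e → ∀-⟷ λ d → ∀-⟷ λ _ → p (d ∷ e)

    ∃ᵈ : (t : Tm D n) {P : (Fin (suc n) → D) → Set} → Def X P →
         Def X (λ e → C (Σ D λ d → d ⊏ evᵗ t e × P (d ∷ e)))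
    ∃ᵈ t (def c p) = def (∀<′ t (c ⇒′ ⊥′) ⇒′ ⊥′) λ e →
      (λ f k → f λ d q x → k (d , q , proj₁ (p (d ∷ e)) x)) ,
      (λ f k → f λ (d , q , x) → k d q (proj₂ (p (d ∷ e)) x))

    _∨ᵈ_ : {P Q : (Fin n → D) → Set} → Def X P → Def X Q → Def X (λ e → C (P e ⊎ Q e))
    def c p ∨ᵈ def d q = def ((c ⇒′ ⊥′) ∧′ (d ⇒′ ⊥′) ⇒′ ⊥′) λ e →
      (λ f k → f ((λ x → k (inj₁ (proj₁ (p e) x))) , (λ x → k (inj₂ (proj₁ (q e) x))))) ,
      (λ f (k , l) → f λ { (inj₁ x) → k (proj₂ (p e) x) ; (inj₂ x) → l (proj₂ (q e) x) })

    subᵈ : (σ : Fin n → Tm D n′) {P : (Fin n → D) → Set} → Def X P →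
           Def X (λ e → P (λ i → evᵗ (σ i) e))
    subᵈ σ (def c p) = def (csub σ c) λ e → ⟷-trans (ev-csub (λ _ → refl) c) (p _)

    -- Environments are functions on `Fin` and can be matched only pointwise; `f` gives the
    -- environment in the form in which the predicate is to be read.
    def-subst : {Q : (Fin n → D) → Set} → Def X Q → (f : (Fin n′ → D) → Fin n → D)
                (σ : Fin n → Tm D n′) → (∀ e i → evᵗ (σ i) e ≡ f e i) → Def X (λ e → Q (f e))
    def-subst (def c p) f σ h = def (csub σ c) λ e → ⟷-trans (ev-csub (h e) c) (p _)

    def-stable : (∀ i → Good (X i)) → {Q : (Fin n → D) → Set} → Def X Q → ∀ {e} → Stable (Q e)
    def-stable g (def c p) x = proj₁ (p _) (ev-stable g c λ k → x (k ∘ proj₂ (p _)))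

    def-resp : (∀ i → Good (X i)) → {Q : (Fin n → D) → Set} → Def X Q → ∀ {e e′} →
               (∀ i → e i ≈ e′ i) → Q e → Q e′
    def-resp g (def c p) q x = proj₁ (p _) (ev-resp g c q (proj₂ (p _) x))

  raiseᵈ : {X : Fin m → D → Set} {Q : (Fin n → D) → Set} → Def {m = 0} [] Q → Def X Q
  raiseᵈ (def c p) = def (plug (λ ()) [] vr c) λ e →
    ⟷-trans (ev-plug {q = []} {r = []} (λ ()) (λ ()) (λ _ → refl) c) (p e)

  Inductive : (Fin m → D → Set) → Set
  Inductive {m} X = (c : Code D m 1) → ev c X (0ᴰ ∷ []) →
                    (∀ x → ev c X (x ∷ []) → ev c X (Sᴰ x ∷ [])) → ∀ x → ev c X (x ∷ [])

  inductᵈ : {X : Fin m → D → Set} → Inductive X → {P : D → Set} →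
            Def {n = 1} X (λ e → P (e 0F)) → P 0ᴰ → (∀ x → P x → P (Sᴰ x)) → ∀ x → P x
  inductᵈ indX (def c p) b s x = proj₁ (p _) (indX c (proj₂ (p _) b)
    (λ x y → proj₂ (p _) (s x (proj₁ (p _) y))) x)

  -- The invariant that every extension preserves. Its collection for bounded formulas is what the
  -- next extension consumes, in `guard-total` and `uniform-failure`.
  record Base (X : Fin m → D → Set) : Set where
    field
      good       : ∀ i → Good (X i)
      induction  : Inductive X
      collection : (c : Code D m 2) → ∀ a → (∀ x → x ⊏ a → C (Σ D λ y → ev c X (y ∷ x ∷ []))) →
                   C (Σ D λ b → ∀ x → x ⊏ a → C (Σ D λ y → y ⊏ b × ev c X (y ∷ x ∷ [])))

    induct : {P : D → Set} → Def {n = 1} X (λ e → P (e 0F)) → P 0ᴰ → (∀ x → P x → P (Sᴰ x)) →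
             ∀ x → P x
    induct = inductᵈ induction

    collect : {P : D → D → Set} → Def {n = 2} X (λ e → P (e 1F) (e 0F)) → ∀ a →
              (∀ x → x ⊏ a → C (Σ D λ y → P x y)) →
              C (Σ D λ b → ∀ x → x ⊏ a → C (Σ D λ y → y ⊏ b × P x y))
    collect (def c p) a h =
      collection c a (λ x q k → h x q λ (y , z) → k (y , proj₂ (p _) z)) >>= λ (b , r) →
      return (b , λ x q k → r x q λ (y , z , w) → k (y , z , proj₁ (p _) w))

  record IsFunction (f : D → Set) : Set where
    field
      total  : ∀ x → C (Σ D λ y → f ⟪ x , y ⟫ᴰ)
      single : ∀ x y y′ → f ⟪ x , y ⟫ᴰ × f ⟪ x , y′ ⟫ᴰ → y ≈ y′
      nonzero : f 0ᴰ → R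

-- The axioms of BASIC and bounded formulas in a structure

record Basic (𝔖 : Str) : Set where
  open Str 𝔖
  field
    S≢0ᴰ    : ∀ x → Sᴰ x ≈ 0ᴰ → R
    S-injᴰ  : ∀ {x y} → Sᴰ x ≈ Sᴰ y → x ≈ y
    +-0ᴰ    : ∀ x → x +ᴰ 0ᴰ ≈ x
    +-Sᴰ    : ∀ x y → x +ᴰ Sᴰ y ≈ Sᴰ (x +ᴰ y)
    ·-0ᴰ    : ∀ x → x ·ᴰ 0ᴰ ≈ 0ᴰ
    ·-Sᴰ    : ∀ x y → x ·ᴰ Sᴰ y ≈ x ·ᴰ y +ᴰ x
    ≮0ᴰ     : ∀ {x} → x ⊏ 0ᴰ → R
    <-Sᴰ    : ∀ {x y} → x ⊏ Sᴰ y → C (x ⊏ y ⊎ x ≈ y)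
    S-<ᴰ    : ∀ {x y} → C (x ⊏ y ⊎ x ≈ y) → x ⊏ Sᴰ y
    triᴰ    : ∀ x y → C (x ⊏ y ⊎ C (x ≈ y ⊎ y ⊏ x))
    surjᴰ   : ∀ {x} → 0ᴰ ⊏ x → C (Σ D λ y → y ⊏ x × Sᴰ y ≈ x)
    pairᴰ   : ∀ {x y z} → ⟪ x , y ⟫ᴰ ≈ z →
              Sᴰ (Sᴰ 0ᴰ) ·ᴰ z ≈ (x +ᴰ y) ·ᴰ (x +ᴰ y +ᴰ Sᴰ 0ᴰ) +ᴰ Sᴰ (Sᴰ 0ᴰ) ·ᴰ x +ᴰ Sᴰ (Sᴰ 0ᴰ)
    p-surjᴰ : ∀ {z} → 0ᴰ ⊏ z →
              C (Σ D λ x → x ⊏ z × C (Σ D λ y → y ⊏ z × ⟪ x , y ⟫ᴰ ≈ z))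
    H-pairᴰ : ∀ x y → Hᴰ ⟪ x , y ⟫ᴰ ≈ x
    H-0ᴰ    : Hᴰ 0ᴰ ≈ 0ᴰ
    T-pairᴰ : ∀ x y → Tᴰ ⟪ x , y ⟫ᴰ ≈ y
    T-0ᴰ    : Tᴰ 0ᴰ ≈ 0ᴰ

module _ {𝔖 : Str} where
  open Str 𝔖
  open Truth 𝔖

  basic : (∀ {φ : Sentence L} → BASIC φ → Tr φ [] []) → Basic 𝔖
  basic ax = record
    { S≢0ᴰ    = λ x → ax S≢0 x
    ; S-injᴰ  = ax S-inj _ _
    ; +-0ᴰ    = ax +-0
    ; +-Sᴰ    = λ x y → ax +-S y x
    ; ·-0ᴰ    = ax ·-0
    ; ·-Sᴰ    = λ x y → ax ·-S y x
    ; ≮0ᴰ     = ax ≮0 _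
    ; <-Sᴰ    = proj₁ (ax <-S _ _)
    ; S-<ᴰ    = proj₂ (ax <-S _ _)
    ; triᴰ    = λ x y → ax <-tri y x
    ; surjᴰ   = ax S-surj _
    ; pairᴰ   = proj₁ (ax pair _ _ _)
    ; p-surjᴰ = ax p-surj _
    ; H-pairᴰ = λ x y → ax H-pair y x
    ; H-0ᴰ    = ax H-0
    ; T-pairᴰ = λ x y → ax T-pair y x
    ; T-0ᴰ    = ax T-0
    }

toTm : Term n → Tm A n
toTm (var i)   = vr i
toTm O         = O′
toTm (S t)     = S′ (toTm t)
toTm (H t)     = H′ (toTm t)
toTm (T t)     = T′ (toTm t)
toTm (s + t)   = toTm s +′ toTm t
toTm (s · t)   = toTm s ·′ toTm t
toTm ⟪ s , t ⟫ = ⟪ toTm s , toTm t ⟫′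

module DefinableFormulas (𝔖 : Str) where
  open Str 𝔖
  open Truth 𝔖
  open Codes 𝔖

  evᵗ-toTm : ∀ (t : Term n) {e} → evᵗ (toTm t) e ≡ ⟦ t ⟧ e
  evᵗ-toTm (var i)   = refl
  evᵗ-toTm O         = refl
  evᵗ-toTm (S t)     = cong Sᴰ (evᵗ-toTm t)
  evᵗ-toTm (H t)     = cong Hᴰ (evᵗ-toTm t)
  evᵗ-toTm (T t)     = cong Tᴰ (evᵗ-toTm t)
  evᵗ-toTm (s + t)   = cong₂ _+ᴰ_ (evᵗ-toTm s) (evᵗ-toTm t)
  evᵗ-toTm (s · t)   = cong₂ _·ᴰ_ (evᵗ-toTm s) (evᵗ-toTm t)
  evᵗ-toTm ⟪ s , t ⟫ = cong₂ ⟪_,_⟫ᴰ (evᵗ-toTm s) (evᵗ-toTm t)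

  below-toTm : ∀ (t : Term n) {d e} → d ⊏ evᵗ (toTm t) e ⟷ d ⊏ ⟦ wkᵗ t ⟧ (d ∷ e)
  below-toTm t {d} {e} rewrite evᵗ-toTm t {e} =
    ⊏-resp ≈-refl (≈-sym (⟦⟧-sub (λ _ → ≈-refl) t)) , ⊏-resp ≈-refl (⟦⟧-sub (λ _ → ≈-refl) t)

  Tr-def : ∀ {X : Fin m → D → Set} {φ : Formula L m n} → IsΔ₀ φ → Def X (Tr φ X)
  Tr-def (eq {s} {t})   = def (toTm s ≐′ toTm t) λ e → ≡⇒⟷ (cong₂ _≈_ (evᵗ-toTm s) (evᵗ-toTm t))
  Tr-def (less {s} {t}) = def (toTm s <′ toTm t) λ e → ≡⇒⟷ (cong₂ _⊏_ (evᵗ-toTm s) (evᵗ-toTm t))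
  Tr-def {X = X} (mem {t} {i}) = def (toTm t ∈′ i) λ e → ≡⇒⟷ (cong (X i) (evᵗ-toTm t))
  Tr-def bot       = ⊥ᵈ
  Tr-def (and p q) = Tr-def p ∧ᵈ Tr-def q
  Tr-def (or p q)  = Tr-def p ∨ᵈ Tr-def q
  Tr-def (imp p q) = Tr-def p ⇒ᵈ Tr-def q
  Tr-def (ball t p) = def (code d) λ e →
    ⟷-trans (spec d e) (∀-⟷ λ x → below-toTm t →-⟷ ⟷-refl)
    where
    d = ∀ᵈ (toTm t) (Tr-def p)
  Tr-def (bex t p) = def (code d) λ e →
    ⟷-trans (spec d e) (C-⟷ (Σ-⟷ λ x → below-toTm t ×-⟷ ⟷-refl))
    where
    d = ∃ᵈ (toTm t) (Tr-def p)

-- Arithmetic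

module Arithmetic {𝔖 : Str} (𝔅 : Basic 𝔖) (ind₀ : Codes.Inductive 𝔖 {m = 0} []) where

  open Str 𝔖
  open Codes 𝔖

  open Basic 𝔅 public

  induct₀ : {P : D → Set} → Def {m = 0} {n = 1} [] (λ e → P (e 0F)) →
            P 0ᴰ → (∀ x → P x → P (Sᴰ x)) → ∀ x → P x
  induct₀ = inductᵈ ind₀

  ≈-setoid : Setoid _ _
  ≈-setoid = record
    { Carrier = D ; _≈_ = _≈_
    ; isEquivalence = record { refl = ≈-refl ; sym = ≈-sym ; trans = ≈-trans } }

  open SetoidReasoning ≈-setoid

  x⊏Sx : ∀ x → x ⊏ Sᴰ x
  x⊏Sx x = S-<ᴰ (return (inj₂ ≈-refl))

  ⊏⇒⊏S : ∀ {x y} → x ⊏ y → x ⊏ Sᴰ y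
  ⊏⇒⊏S p = S-<ᴰ (return (inj₁ p))

  ≈⇒⊏S : ∀ {x y} → x ≈ y → x ⊏ Sᴰ y
  ≈⇒⊏S p = S-<ᴰ (return (inj₂ p))

  ⊏-respʳ : ∀ {x y y′} → y ≈ y′ → x ⊏ y → x ⊏ y′
  ⊏-respʳ = ⊏-resp ≈-refl

  ⊏-respˡ : ∀ {x x′ y} → x ≈ x′ → x ⊏ y → x′ ⊏ y
  ⊏-respˡ p = ⊏-resp p ≈-refl

  ⊏-trans : ∀ {x y z} → x ⊏ y → y ⊏ z → x ⊏ z
  ⊏-trans {x} {y} {z} p = induct₀ {λ z → y ⊏ z → x ⊏ z}
    (def-code (con y <′ vr 0F ⇒′ con x <′ vr 0F))
    (λ q → ⊏-stable λ _ → ≮0ᴰ q)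
    (λ z h q → ⊏-stable do
      inj₁ r ← <-Sᴰ q
        where inj₂ r → return (⊏⇒⊏S (⊏-respʳ r p))
      return (⊏⇒⊏S (h r))) z

  0⊏S : ∀ x → 0ᴰ ⊏ Sᴰ x
  0⊏S = induct₀ (def-code (O′ <′ S′ (vr 0F))) (x⊏Sx 0ᴰ) (λ x p → ⊏-trans p (x⊏Sx _))

  S-mono : ∀ {x y} → x ⊏ y → Sᴰ x ⊏ Sᴰ y
  S-mono {x} {y} = induct₀ {λ y → x ⊏ y → Sᴰ x ⊏ Sᴰ y}
    (def-code (con x <′ vr 0F ⇒′ S′ (con x) <′ S′ (vr 0F)))
    (λ p → ⊏-stable λ _ → ≮0ᴰ p)
    (λ y h p → ⊏-stable do
      inj₁ r ← <-Sᴰ p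
        where inj₂ r → return (≈⇒⊏S (S-cong r))
      return (⊏⇒⊏S (h r))) y

  S-mono⁻ : ∀ {x y} → Sᴰ x ⊏ Sᴰ y → x ⊏ y
  S-mono⁻ p = ⊏-stable do
    inj₁ r ← <-Sᴰ p
      where inj₂ r → return (⊏-respʳ r (x⊏Sx _))
    return (⊏-trans (x⊏Sx _) r)

  ⊏-irrefl : ∀ {x} → x ⊏ x → R
  ⊏-irrefl {x} = induct₀ {λ x → x ⊏ x → R} (def-code (vr 0F <′ vr 0F ⇒′ ⊥′))
    ≮0ᴰ (λ x h p → h (S-mono⁻ p)) x

  -- From here on `x ⊏ Sᴰ y` plays the role of x ≤ y; it is a single atomic formula where the
  -- official definition is a disjunction.
  ⊏S-⊏-trans : ∀ {x y z} → x ⊏ Sᴰ y → y ⊏ z → x ⊏ z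
  ⊏S-⊏-trans p q = ⊏-stable do
    inj₁ r ← <-Sᴰ p
      where inj₂ r → return (⊏-respˡ (≈-sym r) q)
    return (⊏-trans r q)

  ⊏-⊏S-trans : ∀ {x y z} → x ⊏ y → y ⊏ Sᴰ z → x ⊏ z
  ⊏-⊏S-trans p q = ⊏-stable do
    inj₁ r ← <-Sᴰ q
      where inj₂ r → return (⊏-respʳ r p)
    return (⊏-trans p r)

  ⊏S-trans : ∀ {x y z} → x ⊏ Sᴰ y → y ⊏ Sᴰ z → x ⊏ Sᴰ z
  ⊏S-trans p q = ⊏S-⊏-trans p q

  compare : ∀ x y → C (x ⊏ y ⊎ y ⊏ Sᴰ x)
  compare x y = do
    inj₂ p ← triᴰ x y
      where inj₁ p → return (inj₁ p)
    inj₂ q ← p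
      where inj₁ q → return (inj₂ (≈⇒⊏S (≈-sym q)))
    return (inj₂ (⊏⇒⊏S q))

  S-⊏⇒⊏ : ∀ {x y} → Sᴰ x ⊏ y → x ⊏ y
  S-⊏⇒⊏ p = ⊏-trans (x⊏Sx _) p

  ⊏S-antisym : ∀ {x y} → x ⊏ Sᴰ y → y ⊏ Sᴰ x → x ≈ y
  ⊏S-antisym p q = ≈-stable do
    inj₁ r ← <-Sᴰ p
      where inj₂ r → return r
    λ _ → ⊏-irrefl (⊏-⊏S-trans r q)

  upper-bound : ∀ x y → C (Σ D λ z → x ⊏ Sᴰ z × y ⊏ Sᴰ z)
  upper-bound x y = do
    inj₁ p ← compare x y
      where inj₂ p → return (x , x⊏Sx x , p)
    return (y , ⊏⇒⊏S p , x⊏Sx y)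

  zero-or-suc : ∀ x → C (x ≈ 0ᴰ ⊎ Σ D λ y → Sᴰ y ≈ x)
  zero-or-suc x = do
    inj₁ p ← compare 0ᴰ x
      where inj₂ p → do
              inj₂ q ← <-Sᴰ p
                where inj₁ q → λ _ → ≮0ᴰ q
              return (inj₁ q)
    (y , _ , q) ← surjᴰ p
    return (inj₂ (y , q))

  -- If no element of `P` is least, then by induction on `y` nothing below `y` is in `P`; at `Sᴰ x`
  -- this contradicts `P x`.
  least : ∀ {m} {X : Fin m → D → Set} → Inductive X →
          {P : D → Set} → Def {n = 1} X (λ e → P (e 0F)) → ∀ {x} → P x →
          C (Σ D λ y → P y × (∀ z → z ⊏ y → P z → R))
  least indX {P} d {x} p k = h (Sᴰ x) x (x⊏Sx x) p
    where
    h : ∀ y z → z ⊏ y → P z → R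
    h = inductᵈ indX {λ y → ∀ z → z ⊏ y → P z → R}
      (∀ᵈ (vr 0F) (subᵈ (λ _ → vr 0F) d ⇒ᵈ ⊥ᵈ))
      (λ z q → λ _ → ≮0ᴰ q)
      (λ y h z q r → <-Sᴰ q λ where
        (inj₁ q) → h z q r
        (inj₂ q) → k (z , r , λ w s → h w (⊏-respʳ q s)))

  Sx+y : ∀ x y → Sᴰ x +ᴰ y ≈ Sᴰ (x +ᴰ y)
  Sx+y x = induct₀ (def-code (S′ (con x) +′ vr 0F ≐′ S′ (con x +′ vr 0F)))
    (≈-trans (+-0ᴰ _) (S-cong (≈-sym (+-0ᴰ _))))
    λ y h → begin
      Sᴰ x +ᴰ Sᴰ y      ≈⟨ +-Sᴰ _ _ ⟩
      Sᴰ (Sᴰ x +ᴰ y)    ≈⟨ S-cong h ⟩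
      Sᴰ (Sᴰ (x +ᴰ y))  ≈⟨ S-cong (+-Sᴰ _ _) ⟨
      Sᴰ (x +ᴰ Sᴰ y)    ∎

  0+y : ∀ y → 0ᴰ +ᴰ y ≈ y
  0+y = induct₀ (def-code (O′ +′ vr 0F ≐′ vr 0F)) (+-0ᴰ _)
    λ y h → ≈-trans (+-Sᴰ _ _) (S-cong h)

  +-comm : ∀ x y → x +ᴰ y ≈ y +ᴰ x
  +-comm x = induct₀ (def-code (con x +′ vr 0F ≐′ vr 0F +′ con x))
    (≈-trans (+-0ᴰ _) (≈-sym (0+y _)))
    λ y h → begin
      x +ᴰ Sᴰ y    ≈⟨ +-Sᴰ _ _ ⟩
      Sᴰ (x +ᴰ y)  ≈⟨ S-cong h ⟩
      Sᴰ (y +ᴰ x)  ≈⟨ Sx+y _ _ ⟨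
      Sᴰ y +ᴰ x    ∎

  +-assoc : ∀ x y z → x +ᴰ y +ᴰ z ≈ x +ᴰ (y +ᴰ z)
  +-assoc x y = induct₀
    (def-code (con x +′ con y +′ vr 0F ≐′ con x +′ (con y +′ vr 0F)))
    (≈-trans (+-0ᴰ _) (+-cong ≈-refl (≈-sym (+-0ᴰ _))))
    λ z h → begin
      x +ᴰ y +ᴰ Sᴰ z      ≈⟨ +-Sᴰ _ _ ⟩
      Sᴰ (x +ᴰ y +ᴰ z)    ≈⟨ S-cong h ⟩
      Sᴰ (x +ᴰ (y +ᴰ z))  ≈⟨ +-Sᴰ _ _ ⟨
      x +ᴰ Sᴰ (y +ᴰ z)    ≈⟨ +-cong ≈-refl (+-Sᴰ _ _) ⟨
      x +ᴰ (y +ᴰ Sᴰ z)    ∎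

  +-interchange : ∀ w x y z → (w +ᴰ x) +ᴰ (y +ᴰ z) ≈ (w +ᴰ y) +ᴰ (x +ᴰ z)
  +-interchange w x y z = begin
    w +ᴰ x +ᴰ (y +ᴰ z)    ≈⟨ +-assoc _ _ _ ⟩
    w +ᴰ (x +ᴰ (y +ᴰ z))  ≈⟨ +-cong ≈-refl (+-assoc _ _ _) ⟨
    w +ᴰ (x +ᴰ y +ᴰ z)    ≈⟨ +-cong ≈-refl (+-cong (+-comm _ _) ≈-refl) ⟩
    w +ᴰ (y +ᴰ x +ᴰ z)    ≈⟨ +-cong ≈-refl (+-assoc _ _ _) ⟩
    w +ᴰ (y +ᴰ (x +ᴰ z))  ≈⟨ +-assoc _ _ _ ⟨
    w +ᴰ y +ᴰ (x +ᴰ z)    ∎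

  ·-distribˡ : ∀ x y z → x ·ᴰ (y +ᴰ z) ≈ x ·ᴰ y +ᴰ x ·ᴰ z
  ·-distribˡ x y = induct₀
    (def-code (con x ·′ (con y +′ vr 0F) ≐′ con x ·′ con y +′ con x ·′ vr 0F))
    (begin
      x ·ᴰ (y +ᴰ 0ᴰ)      ≈⟨ ·-cong ≈-refl (+-0ᴰ _) ⟩
      x ·ᴰ y              ≈⟨ +-0ᴰ _ ⟨
      x ·ᴰ y +ᴰ 0ᴰ        ≈⟨ +-cong ≈-refl (·-0ᴰ _) ⟨
      x ·ᴰ y +ᴰ x ·ᴰ 0ᴰ   ∎)
    λ z h → begin
      x ·ᴰ (y +ᴰ Sᴰ z)           ≈⟨ ·-cong ≈-refl (+-Sᴰ _ _) ⟩
      x ·ᴰ Sᴰ (y +ᴰ z)           ≈⟨ ·-Sᴰ _ _ ⟩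
      x ·ᴰ (y +ᴰ z) +ᴰ x         ≈⟨ +-cong h ≈-refl ⟩
      x ·ᴰ y +ᴰ x ·ᴰ z +ᴰ x      ≈⟨ +-assoc _ _ _ ⟩
      x ·ᴰ y +ᴰ (x ·ᴰ z +ᴰ x)    ≈⟨ +-cong ≈-refl (·-Sᴰ _ _) ⟨
      x ·ᴰ y +ᴰ x ·ᴰ Sᴰ z        ∎

  S+S : ∀ x → Sᴰ x +ᴰ Sᴰ x ≈ Sᴰ (Sᴰ (x +ᴰ x))
  S+S x = ≈-trans (+-Sᴰ _ _) (S-cong (Sx+y _ _))

  double : ∀ x → Sᴰ (Sᴰ 0ᴰ) ·ᴰ x ≈ x +ᴰ x
  double = induct₀ (def-code (S′ (S′ O′) ·′ vr 0F ≐′ vr 0F +′ vr 0F))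
    (≈-trans (·-0ᴰ _) (≈-sym (+-0ᴰ _)))
    λ x h → begin
      Sᴰ (Sᴰ 0ᴰ) ·ᴰ Sᴰ x                 ≈⟨ ·-Sᴰ _ _ ⟩
      Sᴰ (Sᴰ 0ᴰ) ·ᴰ x +ᴰ Sᴰ (Sᴰ 0ᴰ)      ≈⟨ +-cong h ≈-refl ⟩
      (x +ᴰ x) +ᴰ Sᴰ (Sᴰ 0ᴰ)             ≈⟨ +-Sᴰ _ _ ⟩
      Sᴰ ((x +ᴰ x) +ᴰ Sᴰ 0ᴰ)             ≈⟨ S-cong (+-Sᴰ _ _) ⟩
      Sᴰ (Sᴰ ((x +ᴰ x) +ᴰ 0ᴰ))           ≈⟨ S-cong (S-cong (+-0ᴰ _)) ⟩
      Sᴰ (Sᴰ (x +ᴰ x))                   ≈⟨ S+S x ⟨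
      Sᴰ x +ᴰ Sᴰ x                       ∎

  ·-1 : ∀ x → x ·ᴰ Sᴰ 0ᴰ ≈ x
  ·-1 x = ≈-trans (·-Sᴰ _ _) (≈-trans (+-cong (·-0ᴰ _) ≈-refl) (0+y x))

  +-monoˡ : ∀ {x y} z → x ⊏ y → x +ᴰ z ⊏ y +ᴰ z
  +-monoˡ {x} {y} z p = induct₀ (def-code (con x +′ vr 0F <′ con y +′ vr 0F))
    (⊏-resp (≈-sym (+-0ᴰ _)) (≈-sym (+-0ᴰ _)) p)
    (λ z h → ⊏-resp (≈-sym (+-Sᴰ _ _)) (≈-sym (+-Sᴰ _ _)) (S-mono h)) z

  x⊏Sx+y : ∀ x y → x ⊏ Sᴰ (x +ᴰ y)
  x⊏Sx+y x = induct₀ (def-code (con x <′ S′ (con x +′ vr 0F)))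
    (≈⇒⊏S (≈-sym (+-0ᴰ _)))
    (λ y h → ⊏-respʳ (S-cong (≈-sym (+-Sᴰ _ _))) (⊏⇒⊏S h))

  double-mono : ∀ {x y} → x ⊏ y → x +ᴰ x ⊏ y +ᴰ y
  double-mono {x} {y} p =
    ⊏-trans (+-monoˡ x p) (⊏-resp (+-comm _ _) ≈-refl (+-monoˡ y p))

  double-mono-S : ∀ {x y} → x ⊏ y → Sᴰ (x +ᴰ x) ⊏ y +ᴰ y
  double-mono-S {x} {y} p = ⊏-⊏S-trans {y = Sᴰ (Sᴰ (x +ᴰ x))} (x⊏Sx _)
    (⊏-stable do
      inj₁ q ← <-Sᴰ (S-mono p)
        where inj₂ q → return (≈⇒⊏S (≈-trans (≈-sym (S+S x)) (+-cong q q)))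
      return (⊏⇒⊏S (⊏-respˡ (S+S x) (double-mono q))))

  double-mono-≤ : ∀ {x y} → x ⊏ Sᴰ y → x +ᴰ x ⊏ Sᴰ (y +ᴰ y)
  double-mono-≤ p = ⊏-stable do
    inj₁ q ← <-Sᴰ p
      where inj₂ q → return (≈⇒⊏S (+-cong q q))
    return (⊏⇒⊏S (double-mono q))

  double-cancel-⊏ : ∀ {x y} → x +ᴰ x ⊏ y +ᴰ y → x ⊏ y
  double-cancel-⊏ {x} {y} p = ⊏-stable do
    inj₂ q ← compare x y
      where inj₁ q → return q
    λ _ → ⊏-irrefl (⊏-⊏S-trans p (double-mono-≤ q))

  -- The equation defining the pair ends in `+ 2`, so twice the pair is a successor.
  0⊏⟪⟫ : ∀ x y → 0ᴰ ⊏ ⟪ x , y ⟫ᴰ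
  0⊏⟪⟫ x y = ⊏-stable do
    inj₂ (z , p) ← zero-or-suc ⟪ x , y ⟫ᴰ
      where inj₁ p → λ _ → S≢0ᴰ _ (≈-trans (≈-sym (+-Sᴰ _ _))
                       (≈-trans (≈-sym (pairᴰ p)) (·-0ᴰ _)))
    return (⊏-respʳ p (0⊏S z))

  H-≤ : ∀ p → Hᴰ p ⊏ Sᴰ p
  H-≤ p = ⊏-stable do
    inj₂ (q , r) ← zero-or-suc p
      where inj₁ q → return (≈⇒⊏S (≈-trans (H-cong q) (≈-trans H-0ᴰ (≈-sym q))))
    (x , s , c) ← p-surjᴰ (⊏-respʳ r (0⊏S q))
    (y , _ , t) ← c
    return (⊏⇒⊏S (⊏-respˡ (≈-trans (≈-sym (H-pairᴰ x y)) (H-cong t)) s))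

-- Generic extensions

-- The code holds of a set Y in place of the set variable 0 when Y contains
-- every number that the given code asks about.
guard : Code A (suc m) n → Code A (suc m) n
guard (s ≐′ t)      = ⊥′ ⇒′ ⊥′
guard (s <′ t)      = ⊥′ ⇒′ ⊥′
guard (t ∈′ zero)   = t ∈′ zero
guard (t ∈′ suc i)  = ⊥′ ⇒′ ⊥′
guard ⊥′            = ⊥′ ⇒′ ⊥′
guard (c ∧′ d)      = guard c ∧′ guard d
guard (c ⇒′ d)      = guard c ∧′ guard d
guard (∀<′ t c)     = ∀<′ t (guard c)

module _ {𝔖 : Str} where
  open Str 𝔖
  open Codes 𝔖

  module _ {X : Fin m → D → Set} where

    guard-agree : ∀ {Y P Q : D → Set} → (∀ s → Y s → P s ⟷ Q s) → ∀ (c : Code D (suc m) n) {e} →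
                  ev (guard c) (Y ∷ X) e → ev c (P ∷ X) e ⟷ ev c (Q ∷ X) e
    guard-agree a (s ≐′ t)      g = ⟷-refl
    guard-agree a (s <′ t)      g = ⟷-refl
    guard-agree a (t ∈′ zero)   g = a _ g
    guard-agree a (t ∈′ suc i)  g = ⟷-refl
    guard-agree a ⊥′            g = ⟷-refl
    guard-agree a (c ∧′ d) (g , h) = guard-agree a c g ×-⟷ guard-agree a d h
    guard-agree a (c ⇒′ d) (g , h) = guard-agree a c g →-⟷ guard-agree a d h
    guard-agree a (∀<′ t c) g = ∀-⟷ λ d → ∀-⟷ λ p → guard-agree a c (g d p)

    guard-mono : ∀ {Y Z : D → Set} → (∀ {s} → Y s → Z s) → ∀ (c : Code D (suc m) n) {e} →
                 ev (guard c) (Y ∷ X) e → ev (guard c) (Z ∷ X) e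
    guard-mono a (s ≐′ t)      g = g
    guard-mono a (s <′ t)      g = g
    guard-mono a (t ∈′ zero)   g = a g
    guard-mono a (t ∈′ suc i)  g = g
    guard-mono a ⊥′            g = g
    guard-mono a (c ∧′ d) (g , h) = guard-mono a c g , guard-mono a d h
    guard-mono a (c ⇒′ d) (g , h) = guard-mono a c g , guard-mono a d h
    guard-mono a (∀<′ t c) g d p = guard-mono a c (g d p)

    -- Replacing the new set by a definable approximation to it yields a bounded formula in the old
    -- sets, with the level and the approximation as parameters.
    plugᵈ : {Z : (Fin (suc k) → D) → Set} → Def {n = suc k} X Z →
            (q : Fin k → Tm D n′) (σ : Fin n → Tm D n′) →
            {r : (Fin n′ → D) → Fin k → D} {e : (Fin n′ → D) → Fin n → D} →
            (∀ f i → evᵗ (q i) f ≡ r f i) → (∀ f i → evᵗ (σ i) f ≡ e f i) →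
            ∀ (c : Code D (suc m) n) → Def X (λ f → ev c ((λ s → Z (s ∷ r f)) ∷ X) (e f))
    plugᵈ (def z h) q σ u p c = def (plug (z ∷ λ i → vr zero ∈′ i) q σ c) λ f →
      ev-plug (λ { zero d → h _ ; (suc i) d → ⟷-refl }) (u f) (p f) c

module Generic {𝔖 : Str} (𝔅 : Basic 𝔖)
  (countable-D : Countable (Str.D 𝔖)) (base₀ : Codes.Base 𝔖 {m = 0} []) where

  open Str 𝔖
  open Codes 𝔖
  open Arithmetic 𝔅 (Base.induction base₀)

  -- K ℓ σ says that σ is an approximation of level ℓ to the set to be added,
  -- A s ℓ σ that this approximation puts s into the set, and Dec s ℓ that
  -- approximations of level ℓ are decisive about s.
  record Approximation {m} (X : Fin m → D → Set) : Set₁ where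
    field
      Kᶠ Decᶠ   : (Fin 2 → D) → Set
      Aᶠ        : (Fin 3 → D) → Set
      Kᵈ        : Def X Kᶠ
      Aᵈ        : Def X Aᶠ
      Decᵈ      : Def X Decᶠ
    K⟨_,_⟩ : D → D → Set
    K⟨ ℓ , σ ⟩ = Kᶠ (ℓ ∷ σ ∷ [])
    A⟨_,_⟩ : D → D → D → Set
    A⟨ ℓ , σ ⟩ s = Aᶠ (s ∷ ℓ ∷ σ ∷ [])
    Dec⟨_⟩ : D → D → Set
    Dec⟨ ℓ ⟩ s = Decᶠ (s ∷ ℓ ∷ [])
    field
      -- This makes a quantifier over all approximations of a level bounded. The bound is `ℓ + 1`
      -- because tree nodes are positive even at level 0.
      K-bound   : ∀ {ℓ σ} → K⟨ ℓ , σ ⟩ → σ ⊏ Sᴰ (Sᴰ ℓ)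
      K-total   : ∀ ℓ → C (Σ D λ σ → K⟨ ℓ , σ ⟩)
      K-res     : ∀ {ℓ ℓ′ σ} → ℓ′ ⊏ Sᴰ ℓ → K⟨ ℓ , σ ⟩ →
                  C (Σ D λ τ → K⟨ ℓ′ , τ ⟩ × ∀ s → Dec⟨ ℓ′ ⟩ s → A⟨ ℓ , σ ⟩ s ⟷ A⟨ ℓ′ , τ ⟩ s)
      Dec-mono  : ∀ {s ℓ ℓ′} → ℓ ⊏ Sᴰ ℓ′ → Dec⟨ ℓ ⟩ s → Dec⟨ ℓ′ ⟩ s
      Dec-total : ∀ s → C (Σ D λ ℓ → Dec⟨ ℓ ⟩ s)
      Dec-bound : ∀ {s ℓ} → Dec⟨ ℓ ⟩ s → s ⊏ Sᴰ ℓ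

  module Extension {m} {X : Fin m → D → Set} (baseX : Base X) (𝔞 : Approximation X) where
    open Approximation 𝔞
    open Base baseX

    -- Every bounded formula is settled at some level. At a bounded quantifier, collection in the
    -- old sets bounds the levels that settle the instances, and `Dec-mono` lifts them all to that
    -- bound.
    guard-total : ∀ (c : Code D (suc m) n) e → C (Σ D λ ℓ → ev (guard c) (Dec⟨ ℓ ⟩ ∷ X) e)

    guard-total₂ : ∀ (c d : Code D (suc m) n) e →
                   C (Σ D λ ℓ → ev (guard c) (Dec⟨ ℓ ⟩ ∷ X) e × ev (guard d) (Dec⟨ ℓ ⟩ ∷ X) e)
    guard-total₂ c d e = do
      (ℓ₁ , g) ← guard-total c e
      (ℓ₂ , h) ← guard-total d e
      (ℓ , p , q) ← upper-bound ℓ₁ ℓ₂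
      return (ℓ , guard-mono (Dec-mono p) c g , guard-mono (Dec-mono q) d h)

    guard-total (s ≐′ t)      e = return (0ᴰ , id)
    guard-total (s <′ t)      e = return (0ᴰ , id)
    guard-total (t ∈′ zero)   e = Dec-total _
    guard-total (t ∈′ suc i)  e = return (0ᴰ , id)
    guard-total ⊥′            e = return (0ᴰ , id)
    guard-total (c ∧′ d)      e = guard-total₂ c d e
    guard-total (c ⇒′ d)      e = guard-total₂ c d e
    guard-total (∀<′ t c)     e = do
      (b , h) ← collect {P = λ x ℓ → ev (guard c) (Dec⟨ ℓ ⟩ ∷ X) (x ∷ e)}
        (plugᵈ Decᵈ (λ _ → vr 0F) (vr 1F ∷ λ i → con (e i))
          (λ { f zero → refl }) (λ { f zero → refl ; f (suc i) → refl }) (guard c))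
        (evᵗ t e) (λ x _ → guard-total c (x ∷ e))
      return (b , λ x p → ev-stable′ (λ k → h x p λ (ℓ , q , g) →
        k (guard-mono (Dec-mono (⊏⇒⊏S q)) c g)))
      where
      ev-stable′ : ∀ {b x} → Stable (ev (guard c) (Dec⟨ b ⟩ ∷ X) (x ∷ e))
      ev-stable′ = ev-stable
        (λ { zero → record { stable = def-stable good Decᵈ
                           ; resp = λ p → def-resp good Decᵈ
                               λ { zero → p ; (suc zero) → ≈-refl } }
           ; (suc i) → good i }) (guard c)

    -- `level` asks the generic path to commit itself to an approximation of that level;
    -- `bounded c a` asks it to provide a counterexample to the premise of collection whenever it
    -- can.
    data Requirement : Set where
      level   : D → Requirement
      bounded : Code D (suc m) 2 → D → Requirement

    countable-Requirement : Countable Requirement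
    countable-Requirement = countable-map
      (λ { (zero , d , c) → level d ; (suc _ , d , c) → bounded c d })
      (λ { (level d) → (0 , d , ⊥′) , refl ; (bounded c d) → (1 , d , c) , refl })
      (countable-× countable-ℕ (countable-× countable-D (countable-Code countable-D _ _)))

    -- The condition (r, z) forces that the generic path passes through z at
    -- level ℓ₀, respectively that z < a and ∃y c(y, z) fails.
    Option : Requirement → D → D → D → Set
    Option (level ℓ₀) ℓ τ z =
      K⟨ ℓ₀ , z ⟩ × (ℓ₀ ⊏ Sᴰ ℓ → ∀ s → s ⊏ Sᴰ ℓ₀ → Dec⟨ ℓ₀ ⟩ s → A⟨ ℓ , τ ⟩ s ⟷ A⟨ ℓ₀ , z ⟩ s)
    Option (bounded c a) ℓ τ z =
      -- Only `y` below the level are excluded, and only where the level is decisive. This keeps the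
      -- option bounded and lets it pass to lower levels.
      z ⊏ a × (∀ y → y ⊏ ℓ → ev (guard c) (Dec⟨ ℓ ⟩ ∷ X) (y ∷ z ∷ []) →
               ev c (A⟨ ℓ , τ ⟩ ∷ X) (y ∷ z ∷ []) → R)

    Kᵈ⟨_,_⟩ : ∀ (s t : Tm D n) → Def X (λ e → K⟨ evᵗ s e , evᵗ t e ⟩)
    Kᵈ⟨ s , t ⟩ = def-subst Kᵈ _ (s ∷ t ∷ []) λ _ → at₂

    Decᵈ⟨_,_⟩ : ∀ (s t : Tm D n) → Def X (λ e → Dec⟨ evᵗ s e ⟩ (evᵗ t e))
    Decᵈ⟨ s , t ⟩ = def-subst Decᵈ _ (t ∷ s ∷ []) λ _ → at₂

    Aᵈ⟨_,_,_⟩ : ∀ (s t u : Tm D n) → Def X (λ e → A⟨ evᵗ s e , evᵗ t e ⟩ (evᵗ u e))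
    Aᵈ⟨ s , t , u ⟩ = def-subst Aᵈ _ (u ∷ s ∷ t ∷ []) λ _ → at₃

    optionᵈ : ∀ r → Def {n = 3} X (λ e → Option r (e 0F) (e 1F) (e 2F))
    optionᵈ (level ℓ₀) =
      Kᵈ⟨ con ℓ₀ , vr 2F ⟩ ∧ᵈ
      (def-code (con ℓ₀ <′ S′ (vr 0F)) ⇒ᵈ ∀ᵈ (S′ (con ℓ₀))
        (Decᵈ⟨ con ℓ₀ , vr 0F ⟩ ⇒ᵈ
          ((Aᵈ⟨ vr 1F , vr 2F , vr 0F ⟩ ⇒ᵈ Aᵈ⟨ con ℓ₀ , vr 3F , vr 0F ⟩) ∧ᵈ
           (Aᵈ⟨ con ℓ₀ , vr 3F , vr 0F ⟩ ⇒ᵈ Aᵈ⟨ vr 1F , vr 2F , vr 0F ⟩))))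
    optionᵈ (bounded c a) =
      def-code (vr 2F <′ con a) ∧ᵈ
      ∀ᵈ (vr 0F) (plugᵈ Decᵈ (vr 1F ∷ []) (vr 0F ∷ vr 3F ∷ [])
                    {r = λ f → f 1F ∷ []} {e = λ f → f 0F ∷ f 3F ∷ []} (λ { f 0F → refl })
                    (λ { f 0F → refl ; f 1F → refl }) (guard c) ⇒ᵈ
        ¬ᵈ plugᵈ Aᵈ (vr 1F ∷ vr 2F ∷ []) (vr 0F ∷ vr 3F ∷ [])
             {r = λ f → f 1F ∷ f 2F ∷ []} {e = λ f → f 0F ∷ f 3F ∷ []}
             (λ { f 0F → refl ; f 1F → refl })
             (λ { f 0F → refl ; f 1F → refl }) c)

    Option-res : ∀ r {ℓ ℓ′ τ τ′ z} → ℓ′ ⊏ Sᴰ ℓ →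
                 (∀ s → Dec⟨ ℓ′ ⟩ s → A⟨ ℓ , τ ⟩ s ⟷ A⟨ ℓ′ , τ′ ⟩ s) →
                 Option r ℓ τ z → Option r ℓ′ τ′ z
    Option-res (level ℓ₀) p a (k , h) = k , λ q s u w →
      (λ x → proj₁ (h (⊏S-trans q p) s u w) (proj₂ (a s (Dec-mono q w)) x)) ,
      (λ x → proj₁ (a s (Dec-mono q w)) (proj₂ (h (⊏S-trans q p) s u w) x))
    Option-res (bounded c b) p a (k , h) = k , λ y q g x →
      h y (⊏-⊏S-trans q p) (guard-mono (Dec-mono p) c g) (proj₂ (guard-agree a c g) x)

    Condition : Set
    Condition = Requirement × D

    Meets : List Condition → D → D → Set
    Meets []ᴸ             ℓ τ = K⟨ ℓ , τ ⟩
    Meets ((r , z) ∷ᴸ l)  ℓ τ = Option r ℓ τ z × Meets l ℓ τ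

    meetsᵈ : ∀ l → Def {n = 2} X (λ e → Meets l (e 0F) (e 1F))
    meetsᵈ []ᴸ            = Kᵈ⟨ vr 0F , vr 1F ⟩
    meetsᵈ ((r , z) ∷ᴸ l) = subᵈ (vr 0F ∷ vr 1F ∷ con z ∷ []) (optionᵈ r) ∧ᵈ meetsᵈ l

    Meets-K : ∀ l {ℓ τ} → Meets l ℓ τ → K⟨ ℓ , τ ⟩
    Meets-K []ᴸ      x       = x
    Meets-K (c ∷ᴸ l) (_ , x) = Meets-K l x

    Meets-∈ : ∀ {l r z ℓ τ} → (r , z) ∈ᴸ l → Meets l ℓ τ → Option r ℓ τ z
    Meets-∈ (here refl) (x , _) = x
    Meets-∈ (there i)   (_ , x) = Meets-∈ i x

    Meets-⊆ : ∀ {l l′ ℓ τ} → l ⊆ᴸ l′ → Meets l′ ℓ τ → Meets l ℓ τ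
    Meets-⊆ {[]ᴸ}          {l′} s x = Meets-K l′ x
    Meets-⊆ {(r , z) ∷ᴸ l} s x = Meets-∈ (s (here refl)) x , Meets-⊆ (s ∘ there) x

    Meets-res′ : ∀ l {ℓ ℓ′ τ τ′} → ℓ′ ⊏ Sᴰ ℓ → K⟨ ℓ′ , τ′ ⟩ →
                 (∀ s → Dec⟨ ℓ′ ⟩ s → A⟨ ℓ , τ ⟩ s ⟷ A⟨ ℓ′ , τ′ ⟩ s) →
                 Meets l ℓ τ → Meets l ℓ′ τ′
    Meets-res′ []ᴸ            p k a x       = k
    Meets-res′ ((r , z) ∷ᴸ l) p k a (x , y) = Option-res r p a x , Meets-res′ l p k a y

    Meets-res : ∀ l {ℓ ℓ′ τ} → ℓ′ ⊏ Sᴰ ℓ → Meets l ℓ τ → C (Σ D λ τ′ → Meets l ℓ′ τ′)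
    Meets-res l p x = do
      (τ′ , k , a) ← K-res p (Meets-K l x)
      return (τ′ , Meets-res′ l p k a x)

    -- Since `Meets-res` passes to lower levels, this amounts to `l` being met at unboundedly many
    -- levels.
    Inf : List Condition → Set
    Inf l = ∀ ℓ → C (Σ D λ τ → Meets l ℓ τ)

    limit : Requirement → D
    limit (level ℓ₀)    = Sᴰ (Sᴰ ℓ₀)
    limit (bounded c a) = a

    -- Each `z` below the limit fails at some level, which by `K-bound` is a bounded statement, so
    -- collection bounds these levels. Failure persists upwards, because approximations that meet a
    -- list can be restricted.
    uniform-failure : ∀ r l → (∀ z → Inf ((r , z) ∷ᴸ l) → R) →
                      C (Σ D λ ℓ → ∀ z → z ⊏ limit r → ∀ τ → Meets ((r , z) ∷ᴸ l) ℓ τ → R)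
    uniform-failure r l h = do
      (b , g) ← collect {P = λ z ℓ → ∀ τ → τ ⊏ Sᴰ (Sᴰ ℓ) → Option r ℓ τ z × Meets l ℓ τ → R}
        (∀ᵈ (S′ (S′ (vr 0F))) (¬ᵈ (subᵈ (vr 1F ∷ vr 0F ∷ vr 2F ∷ []) (optionᵈ r) ∧ᵈ
          subᵈ (vr 1F ∷ vr 0F ∷ []) (meetsᵈ l)))) (limit r)
        (λ z _ k → h z λ ℓ j → k (ℓ , λ τ _ x → j (τ , x)))
      return (b , λ z p τ x → g z p λ (ℓ , q , f) →
        Meets-res ((r , z) ∷ᴸ l) (⊏⇒⊏S q) x λ (τ′ , y) →
        f τ′ (K-bound (Meets-K ((r , z) ∷ᴸ l) y)) y)

    element : ℕ → D
    element = enumerate countable-D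

    requirement : ℕ → Requirement
    requirement = enumerate countable-Requirement

    -- Taking the least viable index makes the choice unique up to `C`, as `Chain` requires.
    data Step (i : ℕ) (l : List Condition) : List Condition → Set where
      pick : ∀ j → Inf ((requirement i , element j) ∷ᴸ l) →
             (∀ k → k ℕ.< j → Inf ((requirement i , element k) ∷ᴸ l) → R) →
             Step i l ((requirement i , element j) ∷ᴸ l)
      none : (∀ z → Inf ((requirement i , z) ∷ᴸ l) → R) → Step i l l

    Step-total : ∀ i l → C (∃ λ l′ → Step i l l′)
    Step-total i l k = k (l , none λ z x → search z x)
      where
      least-pick : ∀ b j → j ℕ.< b → Inf ((requirement i , element j) ∷ᴸ l) → R
      least-pick (suc b) j p x = k (_ , pick j x λ j′ q →
        least-pick b j′ (ℕ.<-≤-trans q (ℕ.s≤s⁻¹ p)))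
      search : ∀ z → Inf ((requirement i , z) ∷ᴸ l) → R
      search z x with enumerate-onto countable-D z
      ... | j , refl = least-pick (suc j) j ℕ.≤-refl x

    Step-functional : ∀ {i l l₁ l₂} → Step i l l₁ → Step i l l₂ → C (l₁ ≡ l₂)
    Step-functional (pick j x f) (pick j′ x′ f′) k with ℕ.<-cmp j j′
    ... | tri< p _ _    = f′ j p x
    ... | tri≈ _ refl _ = k refl
    ... | tri> _ _ p    = f j′ p x′
    Step-functional (pick j x f) (none g)     k = g _ x
    Step-functional (none g)     (pick j x f) k = g _ x
    Step-functional (none g)     (none g′)    k = k refl

    Step-extends : ∀ {i l l′} → Step i l l′ → l ⊆ᴸ l′
    Step-extends (pick _ _ _) = there
    Step-extends (none _)     = id

    Step-inf : ∀ {i l l′} → Step i l l′ → Inf l → Inf l′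
    Step-inf (pick _ x _) _ = x
    Step-inf (none _)     x = x

    Step-total′ : ∀ i l → Inf l → C (∃ λ l′ → Step i l l′)
    Step-total′ i l _ = Step-total i l

    open Chain R Step Inf Step-total′ Step-functional Step-extends Step-inf []ᴸ K-total

    -- Finitely many conditions of the union occur together in one stage, and a stage is met at
    -- every level.
    meet : ∀ {cs} → All In cs → ∀ ℓ → C (Σ D λ τ → All (λ (r , z) → Option r ℓ τ z) cs)
    meet ps ℓ = do
      (_ , s) ← State-total 0
      (_ , l , s′ , _ , qs) ← gather ps s
      (τ , x) ← State-ok s′ ℓ
      return (τ , All.map (λ q → Meets-∈ q x) qs)

    Path : D → D → Set
    Path ℓ z = In (level ℓ , z)

    path-K : ∀ {ℓ z} → Path ℓ z → K⟨ ℓ , z ⟩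
    path-K p = def-stable good Kᵈ do
      (τ , (x , _) ∷ᵃ []ᵃ) ← meet (p ∷ᵃ []ᵃ) 0ᴰ
      return x

    -- Were no `z` viable, all would fail at some `ℓ₁`. But an approximation above `ℓ` and `ℓ₁`
    -- restricts to some `z` of level `ℓ`, and its restriction to `ℓ₁` shows that this `z` does not
    -- fail there.
    path-total : ∀ ℓ → C (Σ D λ z → Path ℓ z)
    path-total ℓ k with enumerate-onto countable-Requirement (level ℓ)
    ... | i , e = State-total i λ (l , s) → Step-total i l λ where
      (_ , st@(pick j x f)) →
        k (element j , subst (λ r → In (r , element j)) e λ k →
          k (suc i , _ , step s st , here refl))
      (_ , none f) → uniform-failure (level ℓ) l
          (λ z → subst (λ r → Inf ((r , z) ∷ᴸ l) → R) e (f z)) λ (ℓ₁ , h) →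
        upper-bound ℓ ℓ₁ λ (L , p , q) → State-ok s L λ (τ , x) →
        K-res p (Meets-K l x) λ (z , y , a) →
        Meets-res ((level ℓ , z) ∷ᴸ l) q ((y , λ _ s _ w → a s w) , x) λ (τ′ , w) →
        h z (K-bound y) τ′ w

    P : D → Set
    P s = C (Σ D λ ℓ → Σ D λ z → Path ℓ z × Dec⟨ ℓ ⟩ s × A⟨ ℓ , z ⟩ s)

    -- Both points of the path are met by one approximation at a level above `ℓ` and `ℓ′`, which
    -- agrees with each of them about `s`.
    path-agree : ∀ {ℓ z ℓ′ z′ s} → Path ℓ z → Path ℓ′ z′ → Dec⟨ ℓ ⟩ s → Dec⟨ ℓ′ ⟩ s →
                 A⟨ ℓ , z ⟩ s → A⟨ ℓ′ , z′ ⟩ s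
    path-agree {ℓ} {z} {ℓ′} {z′} {s} p p′ d d′ a = def-stable good Aᵈ do
      (L , q , q′) ← upper-bound ℓ ℓ′
      (τ , (_ , x) ∷ᵃ (_ , y) ∷ᵃ []ᵃ) ← meet (p ∷ᵃ p′ ∷ᵃ []ᵃ) L
      return (proj₁ (y q′ s (Dec-bound d′) d′) (proj₂ (x q s (Dec-bound d) d) a))

    P-path : ∀ {ℓ z} → Path ℓ z → ∀ s → Dec⟨ ℓ ⟩ s → P s ⟷ A⟨ ℓ , z ⟩ s
    P-path {ℓ} {z} p s d =
      (λ x → def-stable good Aᵈ do
        (ℓ′ , z′ , p′ , d′ , a) ← x
        return (path-agree p′ p d′ d a)) ,
      (λ a → return (ℓ , z , p , d , a))

    P-good : Good P
    P-good = record
      { stable = λ x k → x λ y → y k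
      ; resp   = λ e x → do
          (ℓ , z , p , d , a) ← x
          return (ℓ , z , p ,
            def-resp good Decᵈ (λ { 0F → e ; 1F → ≈-refl }) d ,
            def-resp good Aᵈ (λ { 0F → e ; 1F → ≈-refl ; 2F → ≈-refl }) a)
      }

    good⁺ : ∀ i → Good ((P ∷ X) i)
    good⁺ zero    = P-good
    good⁺ (suc i) = good i

    P-truth : ∀ {ℓ z} → Path ℓ z → ∀ (c : Code D (suc m) n) {e} →
              ev (guard c) (Dec⟨ ℓ ⟩ ∷ X) e → ev c (P ∷ X) e ⟷ ev c (A⟨ ℓ , z ⟩ ∷ X) e
    P-truth p = guard-agree (P-path p)

    induction⁺ : ∀ (c : Code D (suc m) 1) → ev c (P ∷ X) (0ᴰ ∷ []) →
                 (∀ x → ev c (P ∷ X) (x ∷ []) → ev c (P ∷ X) (Sᴰ x ∷ [])) →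
                 ∀ x → ev c (P ∷ X) (x ∷ [])
    induction⁺ c b s x = ev-stable good⁺ c do
      -- Guarding the bounded quantifier gives one level that settles `c` for all arguments up to
      -- `x`, so a single approximation stands in for `P` throughout the induction.
      (ℓ , g) ← guard-total (∀<′ (S′ (con x)) c) []
      (z , p) ← path-total ℓ
      return (proj₂ (P-truth p c (g x (x⊏Sx x))) (induct
        {λ y → y ⊏ Sᴰ x → ev c (A⟨ ℓ , z ⟩ ∷ X) (y ∷ [])}
        (def-code (vr 0F <′ S′ (con x)) ⇒ᵈ plugᵈ Aᵈ (con ℓ ∷ con z ∷ []) (vr 0F ∷ [])
          (λ { f 0F → refl ; f 1F → refl }) (λ { f 0F → refl }) c)
        (λ q → proj₁ (P-truth p c (g _ q)) b)
        (λ y h q → proj₁ (P-truth p c (g _ q))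
          (s y (proj₂ (P-truth p c (g _ (S-⊏⇒⊏ q))) (h (S-⊏⇒⊏ q)))))
        x (x⊏Sx x)))

    collection⁺ : ∀ (c : Code D (suc m) 2) a →
                  (∀ x → x ⊏ a → C (Σ D λ y → ev c (P ∷ X) (y ∷ x ∷ []))) →
                  C (Σ D λ b → ∀ x → x ⊏ a → C (Σ D λ y → y ⊏ b × ev c (P ∷ X) (y ∷ x ∷ [])))
    collection⁺ c a h k with enumerate-onto countable-Requirement (bounded c a)
    ... | i , e = State-total i λ (l , s) → Step-total i l λ where
        (_ , st@(pick j x f)) →
          refute (element j) (subst (λ r → In (r , element j)) e λ k →
            k (suc i , _ , step s st , here refl))
        (_ , none f) → uniform-failure (bounded c a) l
            (λ z → subst (λ r → Inf ((r , z) ∷ᴸ l) → R) e (f z)) λ (ℓ , g) →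
          -- The level of uniform failure also bounds the witnesses. If `x` had no witness below
          -- `ℓ`, then an approximation agreeing with the path at level `ℓ` would realise the option
          -- that was found to fail.
          k (ℓ , λ x p → do
            (w , path) ← path-total ℓ
            (_ , l′ , s′ , sub′ , q ∷ᵃ []ᵃ) ← gather (path ∷ᵃ []ᵃ) s
            (τ , y) ← State-ok s′ ℓ
            let (_ , o) = Meets-∈ q y
            λ k′ → g x p τ ((p , λ y r gd t → k′ (y , r , proj₂ (P-truth path c gd)
                  (proj₁ (guard-agree (λ s d → o (x⊏Sx ℓ) s (Dec-bound d) d) c gd) t)))
              , Meets-⊆ sub′ y))
      where
      -- At a level above the witness `y` that settles `c`, the path and the condition have a common
      -- approximation; on it `c` holds by the path and fails by the condition.
      refute : ∀ z → In (bounded c a , z) → R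
      refute z p = meet (p ∷ᵃ []ᵃ) 0ᴰ λ { (_ , (z⊏a , _) ∷ᵃ []ᵃ) →
        h z z⊏a λ (y , t) →
        guard-total c (y ∷ z ∷ []) λ (ℓ₁ , g₁) →
        upper-bound ℓ₁ (Sᴰ y) λ (ℓ , q₁ , q₂) →
        path-total ℓ λ (w , path) →
        meet (p ∷ᵃ path ∷ᵃ []ᵃ) ℓ λ { (τ , (_ , o) ∷ᵃ (_ , o′) ∷ᵃ []ᵃ) →
        let gd = guard-mono (Dec-mono q₁) c g₁ in
        o y (S-mono⁻ q₂) gd
          (proj₂ (guard-agree (λ s d → o′ (x⊏Sx ℓ) s (Dec-bound d) d) c gd)
            (proj₁ (P-truth path c gd) t)) } }

    extension : Base (P ∷ X)
    extension = record { good = good⁺ ; induction = induction⁺ ; collection = collection⁺ }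

    approximated : ∀ ℓ → C (Σ D λ z → K⟨ ℓ , z ⟩ × ∀ s → Dec⟨ ℓ ⟩ s → P s ⟷ A⟨ ℓ , z ⟩ s)
    approximated ℓ = do
      (z , p) ← path-total ℓ
      return (z , path-K p , P-path p)

-- Initial segments of binary sequences

record Exponentiation (𝔖 : Str) (exp : ExpGraph) : Set where
  open Str 𝔖
  open Truth 𝔖
  open ExpGraph exp using (graph)
  field
    exp-base : ∀ p → Tr graph [] (0ᴰ ∷ p ∷ []) ⟷ p ≈ Sᴰ 0ᴰ
    exp-step : ∀ y p → Tr graph [] (Sᴰ y ∷ p ∷ []) ⟷
                       C (Σ D λ z → Tr graph [] (y ∷ z ∷ []) × p ≈ Sᴰ (Sᴰ 0ᴰ) ·ᴰ z)

module Prefix {𝔖 : Str} (𝔅 : Basic 𝔖) (base₀ : Codes.Base 𝔖 {m = 0} [])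
  {exp : ExpGraph} (𝔢 : Exponentiation 𝔖 exp) where

  open Str 𝔖
  open Codes 𝔖
  open Truth 𝔖
  open ExpGraph exp using (graph; isΔ₀)
  open Exponentiation 𝔢
  open Arithmetic 𝔅 (Base.induction base₀)
  open DefinableFormulas 𝔖

  Ex : D → D → Set
  Ex y p = Tr graph [] (y ∷ p ∷ [])

  Exᵈ⟨_,_⟩ : ∀ {m n} {X : Fin m → D → Set} (s t : Tm D n) → Def X (λ e → Ex (evᵗ s e) (evᵗ t e))
  Exᵈ⟨ s , t ⟩ = def-subst (raiseᵈ (Tr-def isΔ₀)) _ (s ∷ t ∷ []) λ _ → at₂

  Ex-resp : ∀ {y y′ p p′} → y ≈ y′ → p ≈ p′ → Ex y p → Ex y′ p′
  Ex-resp q r = def-resp {X = []} (λ ()) (Tr-def isΔ₀) λ { 0F → q ; 1F → r }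

  -- For the induction formula to be bounded, `q` ranges only up to the given `p`. The step respects
  -- this bound because it halves `q`.
  Ex-< : ∀ {y p} → Ex y p → y ⊏ p
  Ex-< {y} {p} x = induct₀ {λ y → ∀ q → q ⊏ Sᴰ p → Ex y q → y ⊏ q}
    (∀ᵈ (S′ (con p)) (Exᵈ⟨ vr 1F , vr 0F ⟩ ⇒ᵈ def-code (vr 1F <′ vr 0F)))
    (λ q _ x → ⊏-respʳ (≈-sym (proj₁ (exp-base q) x)) (x⊏Sx 0ᴰ))
    (λ y h q l x → ⊏-stable do
      (z , u , v) ← proj₁ (exp-step y q) x
      let w = ≈-trans v (double z)
      let r = h z (⊏S-trans (⊏-respʳ (S-cong (≈-sym w)) (x⊏Sx+y z z)) l) u
      return (⊏-respʳ (≈-sym w) (⊏S-⊏-trans (S-mono (x⊏Sx+y y y)) (double-mono-S r))))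
    y p (x⊏Sx p) x

  -- `u` is the floor of τ/2: the sequence `τ` without its last bit.
  Half : D → D → Set
  Half τ u = C (τ ≈ u +ᴰ u ⊎ τ ≈ Sᴰ (u +ᴰ u))

  half-lower : ∀ {τ u} → Half τ u → u +ᴰ u ⊏ Sᴰ τ
  half-lower h = ⊏-stable do
    inj₂ p ← h
      where inj₁ p → return (≈⇒⊏S (≈-sym p))
    return (⊏⇒⊏S (⊏-respʳ (≈-sym p) (x⊏Sx _)))

  half-upper : ∀ {τ u} → Half τ u → τ ⊏ Sᴰ (Sᴰ (u +ᴰ u))
  half-upper h = ⊏-stable do
    inj₂ p ← h
      where inj₁ p → return (⊏⇒⊏S (≈⇒⊏S p))
    return (≈⇒⊏S p)

  half-≤ : ∀ {τ u} → Half τ u → u ⊏ Sᴰ τ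
  half-≤ h = ⊏S-trans (x⊏Sx+y _ _) (half-lower h)

  half-total : ∀ τ → C (Σ D λ u → u ⊏ Sᴰ τ × Half τ u)
  half-total = induct₀
    (∃ᵈ (S′ (vr 0F))
      (def-code (vr 1F ≐′ vr 0F +′ vr 0F) ∨ᵈ def-code (vr 1F ≐′ S′ (vr 0F +′ vr 0F))))
    (return (0ᴰ , x⊏Sx 0ᴰ , return (inj₁ (≈-sym (+-0ᴰ _)))))
    λ τ h → do
      (u , p , q) ← h
      inj₂ r ← q
        where inj₁ r → return (u , ⊏⇒⊏S p , return (inj₂ (S-cong r)))
      return (Sᴰ u , S-mono p , return (inj₁ (≈-trans (S-cong r) (≈-sym (S+S u)))))

  half-unique-⊏ : ∀ {τ u v} → Half τ u → Half τ v → u ⊏ v → R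
  half-unique-⊏ p q r = ⊏-irrefl (⊏-⊏S-trans
    (⊏-⊏S-trans (double-mono-S r) (half-lower q)) (half-upper p))

  half-unique : ∀ {τ u v} → Half τ u → Half τ v → u ≈ v
  half-unique p q = ≈-stable do
    inj₂ r ← triᴰ _ _
      where inj₁ r → λ _ → half-unique-⊏ p q r
    inj₁ s ← r
      where inj₂ s → λ _ → half-unique-⊏ q p s
    return s

  half-< : ∀ {τ u} → 0ᴰ ⊏ τ → Half τ u → u ⊏ τ
  half-< {τ} {u} p h = ⊏-stable do
    inj₁ q ← <-Sᴰ (half-≤ h)
      where inj₂ q → λ _ → ⊏-irrefl (⊏-respʳ (≈-trans (≈-sym q) (≈-sym (0+y u)))
              (⊏-⊏S-trans (+-monoˡ u (⊏-respʳ (≈-sym q) p)) (half-lower h)))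
    return q

  infix 4 _⊴_
  _⊴_ : D → D → Set
  σ ⊴ τ = C (Σ D λ p → p ⊏ Sᴰ τ × C (Σ D λ y → y ⊏ Sᴰ τ × C (Σ D λ x → x ⊏ p ×
            Ex y p × τ ≈ σ ·ᴰ p +ᴰ x)))

  ⊴ᵈ⟨_,_⟩ : ∀ {m n} {X : Fin m → D → Set} (s t : Tm D n) → Def X (λ e → evᵗ s e ⊴ evᵗ t e)
  ⊴ᵈ⟨ s , t ⟩ = def-subst {Q = λ e → e 0F ⊴ e 1F}
    (∃ᵈ (S′ (vr 1F)) (∃ᵈ (S′ (vr 2F)) (∃ᵈ (vr 1F)
      (Exᵈ⟨ vr 1F , vr 2F ⟩ ∧ᵈ def-code (vr 4F ≐′ vr 3F ·′ vr 2F +′ vr 0F)))))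
    _ (s ∷ t ∷ []) λ _ → at₂

  ⊴-intro : ∀ {σ τ p y x} → p ⊏ Sᴰ τ → y ⊏ Sᴰ τ → x ⊏ p → Ex y p → τ ≈ σ ·ᴰ p +ᴰ x → σ ⊴ τ
  ⊴-intro a b c d e = return (_ , a , return (_ , b , return (_ , c , d , e)))

  ⊴-resp : ∀ {σ σ′ τ τ′} → σ ≈ σ′ → τ ≈ τ′ → σ ⊴ τ → σ′ ⊴ τ′
  ⊴-resp p q = def-resp {X = []} (λ ()) ⊴ᵈ⟨ vr 0F , vr 1F ⟩ {e = _ ∷ _ ∷ []} {e′ = _ ∷ _ ∷ []}
    λ { 0F → p ; 1F → q }

  ⊴-stable : ∀ {σ τ} → Stable (σ ⊴ τ)
  ⊴-stable x k = x λ y → y k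

  ⊴-refl : ∀ {τ} → 0ᴰ ⊏ τ → τ ⊴ τ
  ⊴-refl p = ⊴-intro (S-mono p) (0⊏S _) (x⊏Sx 0ᴰ) (proj₂ (exp-base _) ≈-refl)
    (≈-sym (≈-trans (+-0ᴰ _) (·-1 _)))

  ⊴-0 : ∀ {σ} → σ ⊴ 0ᴰ → R
  ⊴-0 h = h λ (p , a , h) → h λ (y , b , h) → h λ (x , c , d , e) → ≮0ᴰ (⊏-⊏S-trans c a)

  0-⊴ : ∀ {τ} → 0ᴰ ⊴ τ → R
  0-⊴ h = h λ (p , a , h) → h λ (y , b , h) → h λ (x , c , d , e) →
    ⊏-irrefl (⊏-⊏S-trans
      (⊏-respˡ (≈-sym (≈-trans e (≈-trans (+-cong (0·y p) ≈-refl) (0+y x)))) c) a)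
    where
    0·y : ∀ y → 0ᴰ ·ᴰ y ≈ 0ᴰ
    0·y = induct₀ (def-code (O′ ·′ vr 0F ≐′ O′)) (·-0ᴰ _)
      λ y h → ≈-trans (·-Sᴰ _ _) (≈-trans (+-0ᴰ _) h)

  -- The power of two is doubled, and the last bit of `τ` is appended to the remainder. The exponent
  -- stays within its bound since `y + 1 ≤ 2p ≤ τ`.
  ⊴-up : ∀ {σ τ u} → Half τ u → σ ⊴ u → σ ⊴ τ
  ⊴-up {σ} {τ} {u} hf h = ⊴-stable do
    (p , a , h) ← h
    (y , b , h) ← h
    (x , c , d , e) ← h
    inj₂ q ← hf
      where inj₁ q → return (intro a c d (≈-trans q (≈-trans (+-cong e e) (+-interchange _ _ _ _)))
                      (double-mono c))
    return (intro a c d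
      (≈-trans q (≈-trans (S-cong (≈-trans (+-cong e e) (+-interchange _ _ _ _)))
        (≈-sym (+-Sᴰ _ _))))
      (double-mono-S c))
    where
    intro : ∀ {p y x x₂} → p ⊏ Sᴰ u → x ⊏ p → Ex y p →
            τ ≈ (σ ·ᴰ p +ᴰ σ ·ᴰ p) +ᴰ x₂ → x₂ ⊏ p +ᴰ p → σ ⊴ τ
    intro {p} {y} a c d e l = ⊴-intro
      (⊏S-trans (double-mono-≤ a) (half-lower hf))
      (⊏S-trans (⊏⇒⊏S (S-mono (Ex-< d)))
        (⊏S-trans (⊏S-trans (double-step (⊏S-⊏-trans (0≤ _) c)) (double-mono-≤ a)) (half-lower hf)))
      l (proj₂ (exp-step y _) (return (p , d , ≈-sym (double p))))
      (≈-trans e (+-cong (≈-sym (·-distribˡ σ p p)) ≈-refl))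
      where
      0≤ : ∀ x → 0ᴰ ⊏ Sᴰ x
      0≤ = 0⊏S
      double-step : ∀ {p} → 0ᴰ ⊏ p → Sᴰ p ⊏ Sᴰ (p +ᴰ p)
      double-step {p} q = S-mono (⊏-respˡ (0+y p) (+-monoˡ p q))

  -- Exponent 0 forces `σ ≈ τ`. Otherwise power and remainder are halved, and uniqueness of halves
  -- identifies the result with `u`. With `⊴-up` this describes `⊴` by recursion on `τ`, so that its
  -- order properties follow without calculating with powers.
  ⊴-down : ∀ {σ τ u} → Half τ u → σ ⊴ τ → C (σ ≈ τ ⊎ σ ⊴ u)
  ⊴-down {σ} {τ} {u} hf h = do
    (p , a , h) ← h
    (y , b , h) ← h
    (x , c , d , e) ← h
    inj₂ (y′ , q) ← zero-or-suc y
      where inj₁ q → do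
              let r = proj₁ (exp-base p) (Ex-resp q ≈-refl d)
              inj₂ s ← <-Sᴰ (⊏-respʳ r c)
                where inj₁ s → λ _ → ≮0ᴰ s
              return (inj₁ (≈-sym (≈-trans e (≈-trans (+-cong (·-cong ≈-refl r) s)
                (≈-trans (+-0ᴰ _) (·-1 σ))))))
    (p′ , d′ , r) ← proj₁ (exp-step y′ p) (Ex-resp (≈-sym q) ≈-refl d)
    (x′ , _ , hx) ← half-total x
    let r′ = ≈-trans r (double p′)
        w  = σ ·ᴰ p′ +ᴰ x′
        e′ = ≈-trans e (+-cong (≈-trans (·-cong ≈-refl r′) (·-distribˡ σ p′ p′)) ≈-refl)
        hw : Half τ w
        hw = hx >>= λ where
          (inj₁ s) → return (inj₁ (≈-trans e′ (≈-trans (+-cong ≈-refl s) (+-interchange _ _ _ _))))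
          (inj₂ s) → return (inj₂ (≈-trans e′ (≈-trans (+-cong ≈-refl s)
                       (≈-trans (+-Sᴰ _ _) (S-cong (+-interchange _ _ _ _))))))
        x′<p′ = double-cancel-⊏ (⊏S-⊏-trans (half-lower hx) (⊏-respʳ r′ c))
    inj₂ l ← compare u p′
      where inj₁ l → λ _ → ⊏-irrefl (⊏-⊏S-trans (⊏-⊏S-trans (double-mono-S l)
                       (⊏-respˡ r′ a)) (half-upper hf))
    return (inj₂ (⊴-intro l (⊏-trans (Ex-< d′) l) x′<p′ d′ (half-unique hf hw)))

  strong-induct : {Q : D → Set} → Def {m = 0} {n = 1} [] (λ e → Q (e 0F)) →
                  (∀ τ → (∀ τ′ → τ′ ⊏ τ → Q τ′) → Q τ) → ∀ τ → Q τ
  strong-induct {Q} d s τ = h (Sᴰ τ) τ (x⊏Sx τ)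
    where
    stableQ : ∀ {τ} → Stable (Q τ)
    stableQ {τ} = def-stable {X = []} (λ ()) d {e = τ ∷ []}
    respQ : ∀ {τ τ′} → τ ≈ τ′ → Q τ → Q τ′
    respQ {τ} {τ′} p = def-resp {X = []} (λ ()) d {e = τ ∷ []} {e′ = τ′ ∷ []} λ { 0F → p }
    h : ∀ τ τ′ → τ′ ⊏ τ → Q τ′
    h = induct₀ {λ τ → ∀ τ′ → τ′ ⊏ τ → Q τ′} (∀ᵈ (vr 0F) (subᵈ (λ _ → vr 0F) d))
      (λ τ′ p → stableQ λ _ → ≮0ᴰ p)
      (λ τ h τ′ p → stableQ do
        inj₂ q ← <-Sᴰ p
          where inj₁ q → return (h τ′ q)
        return (respQ (≈-sym q) (s τ h)))

  ⊴-positive : ∀ {σ τ} → σ ⊴ τ → 0ᴰ ⊏ τ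
  ⊴-positive {σ} {τ} h = ⊏-stable do
    inj₂ p ← compare 0ᴰ τ
      where inj₁ p → return p
    inj₂ q ← <-Sᴰ p
      where inj₁ q → λ _ → ≮0ᴰ q
    λ _ → ⊴-0 (⊴-resp ≈-refl q h)

  ⊴-≤ : ∀ {σ τ} → σ ⊴ τ → σ ⊏ Sᴰ τ
  ⊴-≤ {σ} {τ} = strong-induct {λ τ → σ ⊴ τ → σ ⊏ Sᴰ τ}
    (⊴ᵈ⟨ con σ , vr 0F ⟩ ⇒ᵈ def-code (con σ <′ S′ (vr 0F)))
    (λ τ h p → ⊏-stable do
      (u , _ , hu) ← half-total τ
      inj₂ q ← ⊴-down hu p
        where inj₁ q → return (≈⇒⊏S q)
      let l = half-< (⊴-positive p) hu
      return (⊏⇒⊏S (⊏S-⊏-trans (h u l q) l))) τ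

  ⊴-trans : ∀ {ρ σ τ} → ρ ⊴ σ → σ ⊴ τ → ρ ⊴ τ
  ⊴-trans {ρ} {σ} {τ} p = strong-induct {λ τ → σ ⊴ τ → ρ ⊴ τ}
    (⊴ᵈ⟨ con σ , vr 0F ⟩ ⇒ᵈ ⊴ᵈ⟨ con ρ , vr 0F ⟩)
    (λ τ h q → ⊴-stable do
      (u , _ , hu) ← half-total τ
      inj₂ r ← ⊴-down hu q
        where inj₁ r → return (⊴-resp ≈-refl r p)
      return (⊴-up hu (h u (half-< (⊴-positive q) hu) r))) τ

  ⊴-linear : ∀ {ρ σ τ} → ρ ⊴ τ → σ ⊴ τ → C (ρ ⊴ σ ⊎ σ ⊴ ρ)
  ⊴-linear {ρ} {σ} {τ} p q = strong-induct {λ τ → ρ ⊴ τ → σ ⊴ τ → C (ρ ⊴ σ ⊎ σ ⊴ ρ)}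
    (⊴ᵈ⟨ con ρ , vr 0F ⟩ ⇒ᵈ ⊴ᵈ⟨ con σ , vr 0F ⟩ ⇒ᵈ
      (⊴ᵈ⟨ con ρ , con σ ⟩ ∨ᵈ ⊴ᵈ⟨ con σ , con ρ ⟩))
    (λ τ h p q → do
      (u , _ , hu) ← half-total τ
      inj₂ r ← ⊴-down hu p
        where inj₁ r → return (inj₂ (⊴-resp ≈-refl (≈-sym r) q))
      inj₂ s ← ⊴-down hu q
        where inj₁ s → return (inj₁ (⊴-resp ≈-refl (≈-sym s) p))
      h u (half-< (⊴-positive p) hu) r s) τ p q

  -- Last bits are removed until `τ` equals `L` or its half `u` drops below `L`. In the latter case
  -- `L < τ ≤ 2u + 1` yields `L ≤ 2u`.
  restrict : ∀ {L τ} → 0ᴰ ⊏ L → L ⊏ Sᴰ τ →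
             C (Σ D λ σ → σ ⊏ Sᴰ τ × σ ⊴ τ × σ ⊏ Sᴰ L × L ⊏ Sᴰ (σ +ᴰ σ))
  restrict {L} {τ} 0<L = strong-induct
    {λ τ → L ⊏ Sᴰ τ → C (Σ D λ σ → σ ⊏ Sᴰ τ × σ ⊴ τ × σ ⊏ Sᴰ L × L ⊏ Sᴰ (σ +ᴰ σ))}
    (def-code (con L <′ S′ (vr 0F)) ⇒ᵈ ∃ᵈ (S′ (vr 0F)) (⊴ᵈ⟨ vr 0F , vr 1F ⟩ ∧ᵈ
      def-code (vr 0F <′ S′ (con L)) ∧ᵈ def-code (con L <′ S′ (vr 0F +′ vr 0F))))
    (λ τ h p → do
      let 0<τ = ⊏-⊏S-trans 0<L p
      inj₁ q ← compare L τ
        where inj₂ q → return (τ , x⊏Sx τ , ⊴-refl 0<τ , q , ⊏S-trans p (x⊏Sx+y τ τ))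
      (u , l , hu) ← half-total τ
      inj₂ r ← compare u L
        where inj₁ r → return (u , l , ⊴-up hu (⊴-refl (positive hu q)) , ⊏⇒⊏S r ,
                               ⊏-⊏S-trans q (half-upper hu))
      (σ , a , b , c) ← h u (half-< 0<τ hu) r
      return (σ , ⊏S-trans a l , ⊴-up hu b , c)) τ
    where
    positive : ∀ {τ u} → Half τ u → L ⊏ τ → 0ᴰ ⊏ u
    positive {τ} {u} hu q = ⊏-stable do
      inj₂ r ← compare 0ᴰ u
        where inj₁ r → return r
      inj₂ s ← <-Sᴰ r
        where inj₁ s → λ _ → ≮0ᴰ s
      λ _ → ⊏-irrefl (⊏-⊏S-trans 0<L (⊏-respʳ
        (S-cong (≈-trans (+-cong s s) (+-0ᴰ _))) (⊏-⊏S-trans q (half-upper hu))))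

-- The frame of all extensions

Arith-Δ₀ : {φ : Formula L m n} → IsΔ₀ φ → Arith φ
Arith-Δ₀ eq         = _
Arith-Δ₀ less       = _
Arith-Δ₀ mem        = _
Arith-Δ₀ bot        = _
Arith-Δ₀ (and p q)  = Arith-Δ₀ p , Arith-Δ₀ q
Arith-Δ₀ (or p q)   = Arith-Δ₀ p , Arith-Δ₀ q
Arith-Δ₀ (imp p q)  = Arith-Δ₀ p , Arith-Δ₀ q
Arith-Δ₀ (ball t p) = _ , Arith-Δ₀ p
Arith-Δ₀ (bex t p)  = _ , Arith-Δ₀ p

BASIC-L₂ : ∀ {φ} → BASIC {L₂} φ → ∃ λ ψ → BASIC {L₁} ψ × embed ψ ≡ φ
BASIC-L₂ S≢0    = _ , S≢0 , refl
BASIC-L₂ S-inj  = _ , S-inj , refl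
BASIC-L₂ +-0    = _ , +-0 , refl
BASIC-L₂ +-S    = _ , +-S , refl
BASIC-L₂ ·-0    = _ , ·-0 , refl
BASIC-L₂ ·-S    = _ , ·-S , refl
BASIC-L₂ ≮0     = _ , ≮0 , refl
BASIC-L₂ <-S    = _ , <-S , refl
BASIC-L₂ <-tri  = _ , <-tri , refl
BASIC-L₂ S-surj = _ , S-surj , refl
BASIC-L₂ pair   = _ , pair , refl
BASIC-L₂ p-inj  = _ , p-inj , refl
BASIC-L₂ p-surj = _ , p-surj , refl
BASIC-L₂ H-pair = _ , H-pair , refl
BASIC-L₂ H-0    = _ , H-0 , refl
BASIC-L₂ T-pair = _ , T-pair , refl
BASIC-L₂ T-0    = _ , T-0 , refl

module Worlds (𝔖 : Str) (trBASIC : ∀ {φ} → BASIC {L₁} φ → Truth.Tr 𝔖 φ [] [])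
  (countable-D : Countable (Str.D 𝔖)) (base₀ : Codes.Base 𝔖 {m = 0} []) where

  open Str 𝔖
  open Codes 𝔖
  open Truth 𝔖
  open TruthLemmas 𝔖
  open DefinableFormulas 𝔖

  𝔅 : Basic 𝔖
  𝔅 = basic trBASIC

  open Arithmetic 𝔅 (Base.induction base₀)
  open Generic 𝔅 countable-D base₀

  module _ {X : Fin m → D → Set} (baseX : Base X) where

    -- There is only the approximation 0 at each level, with `A` equal to `Q` and decisive up to
    -- `ℓ`. The generic set is thus forced to be `Q`, and the invariant comes from `extension`.
    comprehension : {Q : D → Set} → Def {n = 1} X (λ e → Q (e 0F)) →
                    Σ (D → Set) λ P → Base (P ∷ X) × (∀ s → P s ⟷ Q s)
    comprehension {Q} d = P , extension , λ s →
      (λ p → def-stable good d {e = s ∷ []} do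
        (_ , _ , h) ← approximated s
        return (proj₁ (h s (x⊏Sx s)) p)) ,
      (λ q → Good.stable (Base.good extension 0F) do
        (_ , _ , h) ← approximated s
        return (proj₂ (h s (x⊏Sx s)) q))
      where
      open Base baseX using (good)
      𝔞 : Approximation X
      𝔞 = record
        { Kᶠ        = λ e → e 1F ≈ 0ᴰ
        ; Decᶠ      = λ e → e 0F ⊏ Sᴰ (e 1F)
        ; Aᶠ        = λ e → Q (e 0F)
        ; Kᵈ        = def-code (vr 1F ≐′ O′)
        ; Aᵈ        = subᵈ (λ _ → vr 0F) d
        ; Decᵈ      = def-code (vr 0F <′ S′ (vr 1F))
        ; K-bound   = λ p → ⊏-respˡ (≈-sym p) (0⊏S _)
        ; K-total   = λ ℓ → return (0ᴰ , ≈-refl)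
        ; K-res     = λ {_} {_} {σ} _ k → return (σ , k , λ _ _ → ⟷-refl)
        ; Dec-mono  = λ p q → ⊏S-trans q p
        ; Dec-total = λ s → return (s , x⊏Sx s)
        ; Dec-bound = id
        }
      open Extension baseX 𝔞

    -- The level bounds the intermediate value: `s` is settled at `ℓ` once h(H s) < ℓ, and from then
    -- on searching for that value below `ℓ` is conclusive. Zero is kept out because functions must
    -- not contain it.
    composition : ∀ h g → IsFunction (X h) → IsFunction (X g) →
                  Σ (D → Set) λ P → Base (P ∷ X) × IsFunction P ×
                    (∀ x y z → X h ⟪ x , z ⟫ᴰ × X g ⟪ z , y ⟫ᴰ → P ⟪ x , y ⟫ᴰ)
    composition h g fh fg = P , extension , record
      { total   = λ x → do
          (z , p) ← IsFunction.total fh x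
          (y , q) ← IsFunction.total fg z
          return (y , compose x y z (p , q))
      ; single  = λ x y y′ (p , q) → ≈-stable do
          (z , u , v) ← decompose x y p
          (z′ , u′ , v′) ← decompose x y′ q
          return (IsFunction.single fg z y y′ (v , Good.resp (good g)
            (⟪⟫-cong (≈-sym (IsFunction.single fh x z z′ (u , u′))) ≈-refl) v′))
      ; nonzero = λ p → at-level 0ᴰ λ (ℓ , _ , d , f) → ≮0ᴰ (proj₁ (proj₁ f p))
      } , compose
      where
      open Base baseX using (good)
      𝔞 : Approximation X
      𝔞 = record
        { Kᶠ        = λ e → e 1F ≈ 0ᴰ
        ; Decᶠ      = λ e → e 0F ⊏ Sᴰ (e 1F) ×
                        C (Σ D λ z → z ⊏ e 1F × X h ⟪ Hᴰ (e 0F) , z ⟫ᴰ)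
        ; Aᶠ        = λ e → 0ᴰ ⊏ e 0F × C (Σ D λ z → z ⊏ e 1F ×
                        X h ⟪ Hᴰ (e 0F) , z ⟫ᴰ × X g ⟪ z , Tᴰ (e 0F) ⟫ᴰ)
        ; Kᵈ        = def-code (vr 1F ≐′ O′)
        ; Aᵈ        = def-code (O′ <′ vr 0F) ∧ᵈ ∃ᵈ (vr 1F)
                        (def-code (⟪ H′ (vr 1F) , vr 0F ⟫′ ∈′ h ∧′ ⟪ vr 0F , T′ (vr 1F) ⟫′ ∈′ g))
        ; Decᵈ      = def-code (vr 0F <′ S′ (vr 1F)) ∧ᵈ
                        ∃ᵈ (vr 1F) (def-code (⟪ H′ (vr 1F) , vr 0F ⟫′ ∈′ h))
        ; K-bound   = λ p → ⊏-respˡ (≈-sym p) (0⊏S _)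
        ; K-total   = λ ℓ → return (0ᴰ , ≈-refl)
        ; K-res     = λ {_} {_} {σ} l k → return (σ , k , λ s (_ , d) →
            (λ (p , x) → p , do
              (z , a , b) ← d
              (z′ , _ , u , v) ← x
              return (z , a , b , Good.resp (good g)
                (⟪⟫-cong (IsFunction.single fh (Hᴰ s) z′ z (u , b)) ≈-refl) v)) ,
            (λ (p , x) → p , do
              (z , a , b) ← x
              return (z , ⊏-⊏S-trans a l , b)))
        ; Dec-mono  = λ p (q , x) → ⊏S-trans q p , (do
            (z , a , b) ← x
            return (z , ⊏-⊏S-trans a p , b))
        ; Dec-total = λ s → do
            (z , p) ← IsFunction.total fh (Hᴰ s)
            (ℓ , a , b) ← upper-bound s (Sᴰ z)
            return (ℓ , a , return (z , S-mono⁻ b , p))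
        ; Dec-bound = proj₁
        }
      open Extension baseX 𝔞
      open Approximation 𝔞

      at-level : ∀ s → C (Σ D λ ℓ → Σ D λ σ → Dec⟨ ℓ ⟩ s × (P s ⟷ A⟨ ℓ , σ ⟩ s))
      at-level s = do
        (ℓ , d) ← Dec-total s
        (σ , _ , f) ← approximated ℓ
        return (ℓ , σ , d , f s d)

      compose : ∀ x y z → X h ⟪ x , z ⟫ᴰ × X g ⟪ z , y ⟫ᴰ → P ⟪ x , y ⟫ᴰ
      compose x y z (p , q) = Good.stable (Base.good extension 0F) do
        (ℓ , _ , (_ , d) , f) ← at-level ⟪ x , y ⟫ᴰ
        (z′ , a , b) ← d
        let b′   = Good.resp (good h) (⟪⟫-cong (H-pairᴰ x y) ≈-refl) b
            z≈z′ = IsFunction.single fh x z z′ (p , b′)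
        return (proj₂ f (0⊏⟪⟫ x y , return (z′ , a , b ,
          Good.resp (good g) (⟪⟫-cong z≈z′ (≈-sym (T-pairᴰ x y))) q)))

      decompose : ∀ x y → P ⟪ x , y ⟫ᴰ → C (Σ D λ z → X h ⟪ x , z ⟫ᴰ × X g ⟪ z , y ⟫ᴰ)
      decompose x y p = do
        (ℓ , _ , d , f) ← at-level ⟪ x , y ⟫ᴰ
        (z , _ , u , v) ← proj₂ (proj₁ f p)
        return (z , Good.resp (good h) (⟪⟫-cong (H-pairᴰ x y) ≈-refl) u ,
                    Good.resp (good g) (⟪⟫-cong ≈-refl (T-pairᴰ x y)) v)

  module Trees (exp : ExpGraph) (trIΔ₀ : ∀ {φ} → IΔ₀ ⊢ φ → Tr φ [] []) where

    open ExpGraph exp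

    exponentiation : Exponentiation 𝔖 exp
    exponentiation = record
      { exp-base = λ p → ⟷-trans (⟷-sym (at₀ p)) (trIΔ₀ base p)
      ; exp-step = λ y p →
          ⟷-trans (⟷-sym (atˢ y p)) (⟷-trans (trIΔ₀ step y p)
            (C-⟷ (Σ-⟷ λ z → at₁ y p z ×-⟷ ⟷-refl)))
      }
      where
      at₀ : ∀ p → Tr Exp[ O , x₀ ] [] (p ∷ []) ⟷ Tr graph [] (0ᴰ ∷ p ∷ [])
      at₀ p = Tr-sub graph (λ ()) (λ ()) λ { 0F → ≈-refl ; 1F → ≈-refl }
      atˢ : ∀ y p → Tr Exp[ S x₁ , x₀ ] [] (p ∷ y ∷ []) ⟷ Tr graph [] (Sᴰ y ∷ p ∷ [])
      atˢ y p = Tr-sub graph (λ ()) (λ ()) λ { 0F → ≈-refl ; 1F → ≈-refl }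
      at₁ : ∀ y p z → Tr Exp[ x₂ , x₀ ] [] (z ∷ p ∷ y ∷ []) ⟷ Tr graph [] (y ∷ z ∷ [])
      at₁ y p z = Tr-sub graph (λ ()) (λ ()) λ { 0F → ≈-refl ; 1F → ≈-refl }

    open Prefix 𝔅 base₀ exponentiation

    module _ {X : Fin m → D → Set} (baseX : Base X) where
      open Base baseX using (good)

      -- The nodes of level `ℓ` are the `σ` in the tree with `σ ≤ ℓ + 1 ≤ 2σ`. They exist because
      -- the tree has elements not below `ℓ + 1`, which `restrict` cuts down to this size. The
      -- branch consists of the initial segments of the nodes on the generic path.
      branch : ∀ t → (X t 0ᴰ → R) → (∀ {σ τ} → X t τ → σ ⊴ τ → X t σ) →
               (∀ b → (∀ x → X t x → x ⊏ b) → R) →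
               Σ (D → Set) λ P → Base (P ∷ X) × (P 0ᴰ → R) × (∀ {σ τ} → P τ → σ ⊴ τ → P σ) ×
                 (∀ b → (∀ x → P x → x ⊏ b) → R) ×
                 (∀ {σ τ} → P σ → P τ → C (σ ⊴ τ ⊎ τ ⊴ σ)) × (∀ {σ} → P σ → X t σ)
      branch t t≢0 closed infinite =
        P , extension ,
        (λ p → at-levels 0ᴰ 0ᴰ λ (_ , _ , _ , (f , _)) → 0-⊴ (proj₁ f p)) ,
        (λ {σ} {τ} p q → Good.stable (Base.good extension 0F) do
          (_ , _ , _ , (f , f′)) ← at-levels σ τ
          return (proj₂ f (⊴-trans q (proj₁ f′ p)))) ,
        (λ b f → unbounded b f) ,
        (λ {σ} {τ} p q → do
          (_ , _ , _ , (f , f′)) ← at-levels σ τ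
          ⊴-linear (proj₁ f p) (proj₁ f′ q)) ,
        (λ {σ} p → Good.stable (good t) do
          (_ , _ , (k , _) , (f , _)) ← at-levels σ σ
          return (closed k (proj₁ f p)))
        where
        positive : ∀ {τ} → X t τ → 0ᴰ ⊏ τ
        positive {τ} x = ⊏-stable do
          inj₂ p ← compare 0ᴰ τ
            where inj₁ p → return p
          inj₂ q ← <-Sᴰ p
            where inj₁ q → λ _ → ≮0ᴰ q
          λ _ → t≢0 (Good.resp (good t) q x)

        𝔞 : Approximation X
        𝔞 = record
          { Kᶠ        = λ e → X t (e 1F) × e 1F ⊏ Sᴰ (Sᴰ (e 0F)) × Sᴰ (e 0F) ⊏ Sᴰ (e 1F +ᴰ e 1F)
          -- If `2s ≤ ℓ`, then `s` is smaller than every node of level `ℓ`. Hence, if `s` and such a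
          -- node both precede `σ`, it is `s` that precedes the node.
          ; Decᶠ      = λ e → e 0F +ᴰ e 0F ⊏ Sᴰ (e 1F)
          ; Aᶠ        = λ e → e 0F ⊴ e 2F
          ; Kᵈ        = def-code (vr 1F ∈′ t ∧′ vr 1F <′ S′ (S′ (vr 0F)) ∧′
                                  S′ (vr 0F) <′ S′ (vr 1F +′ vr 1F))
          ; Aᵈ        = ⊴ᵈ⟨ vr 0F , vr 2F ⟩
          ; Decᵈ      = def-code (vr 0F +′ vr 0F <′ S′ (vr 1F))
          ; K-bound   = λ (_ , p , _) → p
          ; K-total   = λ ℓ k → infinite (Sᴰ ℓ) λ x p → ⊏-stable do
              inj₂ q ← compare x (Sᴰ ℓ)
                where inj₁ q → return q
              (σ , _ , a , b , c) ← restrict (0⊏S ℓ) q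
              λ _ → k (σ , closed p a , b , c)
          ; K-res     = λ {ℓ} {ℓ′} {σ} l (p , q , r) → do
              (τ , a , b , c) ← shrink l p r
              return (τ , (closed p a , b , c) , λ s d →
                (λ u → ⊴-stable do
                  inj₂ v ← ⊴-linear u a
                    where inj₁ v → return v
                  λ _ → ⊏-irrefl (⊏-⊏S-trans (⊏-⊏S-trans d c) (double-mono-≤ (⊴-≤ v)))) ,
                (λ u → ⊴-trans u a))
          ; Dec-mono  = λ p q → ⊏S-trans q p
          ; Dec-total = λ s → return (s +ᴰ s , x⊏Sx _)
          ; Dec-bound = λ p → ⊏S-trans (x⊏Sx+y _ _) p
          }
          where
          shrink : ∀ {ℓ ℓ′ σ} → ℓ′ ⊏ Sᴰ ℓ → X t σ → Sᴰ ℓ ⊏ Sᴰ (σ +ᴰ σ) →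
                   C (Σ D λ τ → τ ⊴ σ × τ ⊏ Sᴰ (Sᴰ ℓ′) × Sᴰ ℓ′ ⊏ Sᴰ (τ +ᴰ τ))
          shrink {ℓ} {ℓ′} {σ} l p r = do
            inj₂ q ← compare σ (Sᴰ ℓ′)
              where inj₁ q → return (σ , ⊴-refl (positive p) , ⊏⇒⊏S q , ⊏S-trans (S-mono l) r)
            (τ , _ , a , b , c) ← restrict (0⊏S ℓ′) q
            return (τ , a , b , c)

        open Extension baseX 𝔞
        open Approximation 𝔞

        at-levels : ∀ s s′ → C (Σ D λ ℓ → Σ D λ σ → K⟨ ℓ , σ ⟩ ×
                    (P s ⟷ s ⊴ σ) × (P s′ ⟷ s′ ⊴ σ))
        at-levels s s′ = do
          (ℓ , p , q) ← upper-bound (s +ᴰ s) (s′ +ᴰ s′)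
          (σ , k , f) ← approximated ℓ
          return (ℓ , σ , k , f s p , f s′ q)

        unbounded : ∀ b → (∀ x → P x → x ⊏ b) → R
        -- With `L = 2(b + 1)` and `ℓ ≥ 2L`, the node `σ` exceeds `L` and has an initial segment
        -- `ρ ≤ L ≤ 2ρ`. Then `2ρ ≤ ℓ`, so `ρ` is settled and lies in `P`, yet `L ≤ 2ρ` contradicts
        -- `ρ < b`.
        unbounded b h = upper-bound ((Sᴰ b +ᴰ Sᴰ b) +ᴰ (Sᴰ b +ᴰ Sᴰ b)) 0ᴰ λ (ℓ , p , _) →
          approximated ℓ λ (σ , (k , _ , r) , f) →
          restrict {L = Sᴰ b +ᴰ Sᴰ b} (⊏-respʳ (≈-sym (S+S b)) (0⊏S _))
            (⊏⇒⊏S (double-cancel-⊏ (⊏-⊏S-trans p r))) λ (ρ , _ , a , c , d) →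
          ⊏-irrefl (⊏-trans d (double-mono-S (⊏-trans
            (h ρ (proj₂ (f ρ (⊏S-trans (double-mono-≤ c) p)) a)) (x⊏Sx b))))

  -- The Kripke frame and the axioms forced in it

  record World : Set₁ where
    constructor world
    field
      {#}  : ℕ
      sets : Fin # → D → Set
      base : Base sets

  open World

  data InWorld (w : World) : (D → Set) → Set₁ where
    member : ∀ i → InWorld w (sets w i)

  infix 4 _≤ʷ_
  -- Inclusion of predicates, not of lists, as positions shift when a set is put in front.
  record _≤ʷ_ (w w′ : World) : Set₁ where
    constructor larger
    field
      persist : ∀ {Y} → InWorld w Y → InWorld w′ Y

  open _≤ʷ_

  InWorld-good : ∀ {w Y} → InWorld w Y → Good Y
  InWorld-good {w} (member i) = Base.good (base w) i

  worlds : Frame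
  worlds = record
    { W       = World
    ; _⊑_     = _≤ʷ_
    ; ⊑-refl  = larger id
    ; ⊑-trans = λ p q → larger (persist q ∘ persist p)
    ; 𝒳       = InWorld
    ; 𝒳-mono  = λ p → persist p
    ; 𝒳-good  = InWorld-good
    }

  open Forcing worlds

  tr⇒⊩ : ∀ (φ : Formula L m n) → Arith φ → ∀ {w ρ e} → Tr φ ρ e → w ⊩ φ [ ρ , e ]
  tr⇒⊩ φ a = proj₂ (⊩⟷Tr worlds φ a)

  ⊩⇒tr : ∀ (φ : Formula L m n) → Arith φ → ∀ {w ρ e} → w ⊩ φ [ ρ , e ] → Tr φ ρ e
  ⊩⇒tr φ a = proj₁ (⊩⟷Tr worlds φ a)

  -- `J` permits a move to a later world, so it suffices that every larger world can be extended by
  -- one suitable set.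
  ∃ˢ-force : ∀ (φ : Formula L₂ (suc m) n) → Arith φ → ∀ {ρ e w} →
             (∀ {w′} → w ≤ʷ w′ → Σ (D → Set) λ P → Base (P ∷ sets w′) × Tr φ (P ∷ ρ) e) →
             w ⊩ ∃ˢ φ [ ρ , e ]
  ∃ˢ-force φ a {w = w} h {w′} p k with h p
  ... | P , b , x = k {world (P ∷ sets w′) b} (larger λ { (member i) → member (suc i) })
    (P , member zero , tr⇒⊩ φ a x)

  ∀ˢ*-force : ∀ m (φ : Formula L₂ m n) {e} →
              (∀ {w} ρ → (∀ i → InWorld w (ρ i)) → w ⊩ φ [ ρ , e ]) →
              ∀ {w} → w ⊩ ∀ˢ* m φ [ [] , e ]
  ∀ˢ*-force zero    φ h = h [] λ ()
  ∀ˢ*-force (suc m) φ h = ∀ˢ*-force m (∀ˢ φ) λ ρ r p {X} x →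
    h (X ∷ ρ) λ { zero → x ; (suc i) → persist p (r i) }

  ∀ⁿ*-force : ∀ n (φ : Formula L m n) {ρ w} → (∀ e → w ⊩ φ [ ρ , e ]) →
              w ⊩ ∀ⁿ* n φ [ ρ , [] ]
  ∀ⁿ*-force zero    φ h = h []
  ∀ⁿ*-force (suc n) φ h = ∀ⁿ*-force n (∀ⁿ φ) λ e d → h (d ∷ e)

  force-IND : ∀ {w} → w ⊩ IND [ [] , [] ]
  force-IND _ Xw d {w} p (lift z , s) with persist p Xw
  ... | member i = lift (Base.induction (base w) (vr 0F ∈′ i) z
    (λ x y → lower (s x (larger id) (lift y))) d)

  -- The parameters of an axiom are members of the world in any order and with repetitions, whereas
  -- its invariant speaks of its own list of sets.
  renameᵈ : ∀ {w} {X : Fin m → D → Set} {Q : (Fin n → D) → Set} →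
            (∀ i → InWorld w (X i)) → Def X Q → Def (sets w) Q
  renameᵈ {w = w} {X} r (def c p) = def (plug (λ i → proj₁ (at i)) [] vr c) λ e →
    ⟷-trans (ev-plug {q = []} {r = []} (λ i d → proj₂ (at i) d) (λ ()) (λ _ → refl) c) (p e)
    where
    at : ∀ i → Σ (Code D _ 1) λ c → ∀ d → ev c (sets w) (d ∷ []) ⟷ X i d
    at i with X i | r i
    ... | _ | member j = vr zero ∈′ j , λ d → ⟷-refl

  force-compr : ∀ {φ} → ComprΔ⁰₀ φ → ∀ {w} → w ⊩ φ [ [] , [] ]
  force-compr (compr {m} {n} φ δ) = ∀ˢ*-force m (∀ⁿ* n body) λ ρ r → ∀ⁿ*-force n body λ e →
    ∃ˢ-force (∀ⁿ (x₀ ∈ 0F ↔ wkˢ φ)) ((_ , Arith-wk) , (Arith-wk , _)) λ {w} p →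
      let P , b , h = comprehension (base w) {Q = λ d → Tr φ ρ (d ∷ e)}
            (def-subst (renameᵈ (persist p ∘ r) (Tr-def δ)) (λ f → f 0F ∷ e)
              (vr 0F ∷ λ i → con (e i)) (λ { f zero → refl ; f (suc i) → refl }))
          at : ∀ d → Tr (wkˢ φ) (P ∷ ρ) (d ∷ e) ⟷ Tr φ ρ (d ∷ e)
          at d = Tr-sub φ (λ i → InWorld-good (r i)) (λ _ → refl) (λ _ → ≈-refl)
      in P , b , λ d → ⟷-trans (h d) (⟷-sym (at d))
    where
    body : Formula L₂ m n
    body = ∃ˢ ∀ⁿ (x₀ ∈ 0F ↔ wkˢ φ)
    Arith-sub : ∀ {m m′ n n′} (φ : Formula L₂ m n) {r : Fin m → Fin m′} {σ : Fin n → Term n′} →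
                Arith φ → Arith (sub r σ φ)
    Arith-sub (s ≐ t) a = _
    Arith-sub (s < t) a = _
    Arith-sub (t ∈ X) a = _
    Arith-sub ⊥       a = _
    Arith-sub (φ ∧ ψ) (a , b) = Arith-sub φ a , Arith-sub ψ b
    Arith-sub (φ ∨ ψ) (a , b) = Arith-sub φ a , Arith-sub ψ b
    Arith-sub (φ ⇒ ψ) (a , b) = Arith-sub φ a , Arith-sub ψ b
    Arith-sub (∀ⁿ φ)  a = Arith-sub φ a
    Arith-sub (∃ⁿ φ)  a = Arith-sub φ a
    Arith-wk : Arith (wkˢ φ)
    Arith-wk = Arith-sub φ (Arith-Δ₀ δ)

  force-COMP : ∀ {w} → w ⊩ COMP [ [] , [] ]
  force-COMP _ {g} gx p {h} hx {w} q fs =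
    ∃ˢ-force composite _ {ρ = h ∷ g ∷ []} {e = []} {w = w} λ r →
      result (persist r (persist q (persist p gx))) (persist r (persist q hx)) functions
    where
    composite : Formula L₂ 3 0
    composite = (0F ∈ℱ) ∧ (∀ⁿ ∀ⁿ ∀ⁿ ((1F ⟨ x₂ ⟩≐ x₀) ∧ (2F ⟨ x₀ ⟩≐ x₁) ⇒ (0F ⟨ x₂ ⟩≐ x₁)))
    functions : Tr ((1F ∈ℱ) ∧ (0F ∈ℱ)) (h ∷ g ∷ []) []
    functions = ⊩⇒tr ((1F ∈ℱ) ∧ (0F ∈ℱ)) _ {w} {h ∷ g ∷ []} {[]} fs
    isFunction : ∀ {f : D → Set} → Tr {n = 0} (0F ∈ℱ) (f ∷ []) [] → IsFunction f
    isFunction (t , s , n) = record { total = t ; single = s ; nonzero = n }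
    result : ∀ {w g h} → InWorld w g → InWorld w h → Tr ((1F ∈ℱ) ∧ (0F ∈ℱ)) (h ∷ g ∷ []) [] →
             Σ (D → Set) λ P → Base (P ∷ sets w) × Tr composite (P ∷ h ∷ g ∷ []) []
    result {w} (member i) (member j) (fg , fh) =
      let P , b , (pf , c) = composition (base w) j i (isFunction fh) (isFunction fg)
          open IsFunction pf
      in P , b , (total , single , nonzero) , c

  force-BASIC : ∀ {φ} → BASIC {L₂} φ → ∀ {w} → w ⊩ φ [ [] , [] ]
  force-BASIC a with BASIC-L₂ a
  ... | ψ , b , refl = proj₂ (⊩-embed worlds ψ) (trBASIC b)

  force-RCA₀⁻ : ∀ {φ} → RCA₀⁻ φ → ∀ {w} → w ⊩ φ [ [] , [] ]
  force-RCA₀⁻ (inj₁ (inj₁ a))               = force-BASIC a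
  force-RCA₀⁻ (inj₁ (inj₂ (inj₁ refl)))     = force-IND
  force-RCA₀⁻ (inj₁ (inj₂ (inj₂ a)))        = force-compr a
  force-RCA₀⁻ (inj₂ refl)                   = force-COMP

  module _ (exp : ExpGraph) (trIΔ₀ : ∀ {φ} → IΔ₀ ⊢ φ → Tr φ [] []) where
    open ExpGraph exp using (graph; Exp[_,_])
    open Trees exp trIΔ₀
    open Prefix 𝔅 base₀ exponentiation

    Tr-≼ : ∀ (i j : Fin n) {ρ : Fin m → D → Set} {e} → Tr (_≼_ exp (var i) (var j)) ρ e ⟷ e i ⊴ e j
    Tr-≼ {n} {m} i j {ρ} {e} =
      (λ h → do
        (p , a , h) ← h
        (y , b , h) ← h
        (x , c , d , q) ← h
        return (p , S-<ᴰ a , return (y , S-<ᴰ b , return (x , c , proj₁ (at x y p) d , q)))) ,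
      (λ h → do
        (p , a , h) ← h
        (y , b , h) ← h
        (x , c , d , q) ← h
        return (p , <-Sᴰ a , return (y , <-Sᴰ b , return (x , c , proj₂ (at x y p) d , q))))
      where
      at : ∀ x y p → Tr (embed {m = m} Exp[ x₁ , x₂ ]) ρ (x ∷ y ∷ p ∷ e) ⟷ Ex y p
      at x y p = ⟷-trans (Tr-embed Exp[ x₁ , x₂ ]) at′
        where
        at′ : Tr (Exp[_,_] {m = m} x₁ x₂) ρ (x ∷ y ∷ p ∷ e) ⟷ Ex y p
        at′ = Tr-sub graph (λ ()) (λ ()) λ { 0F → ≈-refl ; 1F → ≈-refl }

    Arith-≼ : ∀ (s t : Term n) → Arith (_≼_ exp {m = m} s t)
    Arith-≼ s t = _ , _ , _ , Arith-embed (Exp[ x₁ , x₂ ]) , _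

    Arith-tree : ∀ (X : Fin m) → Arith (IsTree exp {n = n} X)
    Arith-tree X = _ , _ , (Arith-≼ x₀ x₁ , _) , _

    Arith-branch : ∀ (X : Fin m) → Arith (IsBranch exp {n = n} X)
    Arith-branch X = Arith-tree X , _ , Arith-≼ x₁ x₀ , Arith-≼ x₀ x₁

    force-WKL : ∀ {w} → w ⊩ WKL exp [ [] , [] ]
    force-WKL _ {Y} Yw {w} q hs =
      ∃ˢ-force infinite-branch (Arith-tree 0F , _ , Arith-branch 0F , _)
        {ρ = Y ∷ []} {e = []} {w = w}
        λ r → result (persist r (persist q Yw)) (⊩⇒tr (IsTree exp 0F ∧ IsInfinite exp 0F)
          (Arith-tree 0F , _) {w} {Y ∷ []} hs)
      where
      infinite-branch : Formula L₂ 2 0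
      infinite-branch = IsTree exp 0F ∧ IsInfinite exp 0F ∧ IsBranch exp 0F ∧ _⊆_ exp 0F 1F
      result : ∀ {w Y} → InWorld w Y → Tr (IsTree exp 0F ∧ IsInfinite exp 0F) (Y ∷ []) [] →
               Σ (D → Set) λ P → Base (P ∷ sets w) × Tr infinite-branch (P ∷ Y ∷ []) []
      result {w} (member i) ((Y0 , closed) , inf) =
        let P , b , P0 , Pclosed , Pinf , Plinear , P⊆Y = branch (base w) i Y0
              (λ {σ} {τ} x p → Good.stable (Base.good (base w) i) do
                inj₁ l ← <-Sᴰ (⊴-≤ p)
                  where inj₂ l → return (Good.resp (Base.good (base w) i) (≈-sym l) x)
                return (closed τ x σ (proj₂ (Tr-≼ 0F 1F {e = σ ∷ τ ∷ []}) p , l)))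
              (λ b f → inf (return (b , f)))
            tree = P0 , λ τ x σ (p , _) → Pclosed x (proj₁ (Tr-≼ 0F 1F {e = σ ∷ τ ∷ []}) p)
        in P , b , tree , (λ f → f λ (b , h) → Pinf b h) ,
           (tree , λ σ τ (x , y) → Plinear x y >>= λ where
             (inj₁ p) → return (inj₁ (proj₂ (Tr-≼ 1F 0F {e = τ ∷ σ ∷ []}) p))
             (inj₂ p) → return (inj₂ (proj₂ (Tr-≼ 0F 1F {e = τ ∷ σ ∷ []}) p))) ,
           λ σ → P⊆Y

    force-WKL₀⁻ : ∀ {φ} → WKL₀⁻ exp φ → ∀ {w} → w ⊩ φ [ [] , [] ]
    force-WKL₀⁻ (inj₁ a)    = force-RCA₀⁻ a
    force-WKL₀⁻ (inj₂ refl) = force-WKL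

-- Codes as formulas

constantsᵗ : Tm A n → List A
constantsᵗ (vr i)     = []ᴸ
constantsᵗ (con a)    = a ∷ᴸ []ᴸ
constantsᵗ O′         = []ᴸ
constantsᵗ (S′ t)     = constantsᵗ t
constantsᵗ (H′ t)     = constantsᵗ t
constantsᵗ (T′ t)     = constantsᵗ t
constantsᵗ (s +′ t)   = constantsᵗ s ++ constantsᵗ t
constantsᵗ (s ·′ t)   = constantsᵗ s ++ constantsᵗ t
constantsᵗ ⟪ s , t ⟫′ = constantsᵗ s ++ constantsᵗ t

constants : Code A m n → List A
constants (s ≐′ t)  = constantsᵗ s ++ constantsᵗ t
constants (s <′ t)  = constantsᵗ s ++ constantsᵗ t
constants (t ∈′ i)  = constantsᵗ t
constants ⊥′        = []ᴸ
constants (c ∧′ d)  = constants c ++ constants d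
constants (c ⇒′ d)  = constants c ++ constants d
constants (∀<′ t c) = constantsᵗ t ++ constants c

Naming : List A → ℕ → Set
Naming cs N = ∀ a → a ∈ᴸ cs → Fin N

left : ∀ {cs ds : List A} → Naming (cs ++ ds) N → Naming cs N
left p a i = p a (∈-++⁺ˡ i)

right : ∀ (cs : List A) {ds : List A} → Naming (cs ++ ds) N → Naming ds N
right cs p a i = p a (∈-++⁺ʳ cs i)

later : ∀ {cs : List A} → Naming cs N → Naming cs (suc N)
later p a i = suc (p a i)

fromTm : (t : Tm A n) → (Fin n → Fin N) → Naming (constantsᵗ t) N → Term N
fromTm (vr i)     v p = var (v i)
fromTm (con a)    v p = var (p a (here refl))
fromTm O′         v p = O
fromTm (S′ t)     v p = S (fromTm t v p)
fromTm (H′ t)     v p = H (fromTm t v p)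
fromTm (T′ t)     v p = T (fromTm t v p)
fromTm (s +′ t)   v p = fromTm s v (left p) + fromTm t v (right (constantsᵗ s) p)
fromTm (s ·′ t)   v p = fromTm s v (left p) · fromTm t v (right (constantsᵗ s) p)
fromTm ⟪ s , t ⟫′ v p = ⟪ fromTm s v (left p) , fromTm t v (right (constantsᵗ s) p) ⟫

fromCode : (Fin m → HasSets L) → (c : Code A m n) → (Fin n → Fin N) → Naming (constants c) N →
           Formula L m N
fromCode h (s ≐′ t)  v p = fromTm s v (left p) ≐ fromTm t v (right (constantsᵗ s) p)
fromCode h (s <′ t)  v p = fromTm s v (left p) < fromTm t v (right (constantsᵗ s) p)
fromCode h (t ∈′ i)  v p = _∈_ ⦃ h i ⦄ (fromTm t v p) i
fromCode h ⊥′        v p = ⊥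
fromCode h (c ∧′ d)  v p = fromCode h c v (left p) ∧ fromCode h d v (right (constants c) p)
fromCode h (c ⇒′ d)  v p = fromCode h c v (left p) ⇒ fromCode h d v (right (constants c) p)
fromCode h (∀<′ t c) v p =
  ∀[< fromTm t v (left p) ] fromCode h c (zero ∷ (suc ∘ v)) (later (right (constantsᵗ t) p))

fromCode-Δ₀ : ∀ (h : Fin m → HasSets L) (c : Code A m n) (v : Fin n → Fin N) p →
              IsΔ₀ (fromCode h c v p)
fromCode-Δ₀ h (s ≐′ t)  v p = eq
fromCode-Δ₀ h (s <′ t)  v p = less
fromCode-Δ₀ h (t ∈′ i)  v p = mem ⦃ h i ⦄
fromCode-Δ₀ h ⊥′        v p = bot
fromCode-Δ₀ h (c ∧′ d)  v p = and (fromCode-Δ₀ h c v _) (fromCode-Δ₀ h d v _)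
fromCode-Δ₀ h (c ⇒′ d)  v p = imp (fromCode-Δ₀ h c v _) (fromCode-Δ₀ h d v _)
fromCode-Δ₀ h (∀<′ t c) v p = ball (fromTm t v (left p)) (fromCode-Δ₀ h c _ _)

module Parameters (𝔖 : Str) where
  open Str 𝔖
  open Truth 𝔖
  open TruthLemmas 𝔖
  open Codes 𝔖
  open DefinableFormulas 𝔖

  ⟦fromTm⟧ : ∀ (t : Tm D n) {v : Fin n → Fin N} {p : Naming (constantsᵗ t) N} {e f} →
             (∀ i → f (v i) ≡ e i) → (∀ {d} (i : d ∈ᴸ constantsᵗ t) → f (p d i) ≡ d) →
             ⟦ fromTm t v p ⟧ f ≡ evᵗ t e
  ⟦fromTm⟧ (vr i)     q r = q i
  ⟦fromTm⟧ (con a)    q r = r (here refl)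
  ⟦fromTm⟧ O′         q r = refl
  ⟦fromTm⟧ (S′ t)     q r = cong Sᴰ (⟦fromTm⟧ t q r)
  ⟦fromTm⟧ (H′ t)     q r = cong Hᴰ (⟦fromTm⟧ t q r)
  ⟦fromTm⟧ (T′ t)     q r = cong Tᴰ (⟦fromTm⟧ t q r)
  ⟦fromTm⟧ (s +′ t)   q r = cong₂ _+ᴰ_ (⟦fromTm⟧ s q (λ i → r (∈-++⁺ˡ i)))
                                       (⟦fromTm⟧ t q (λ i → r (∈-++⁺ʳ (constantsᵗ s) i)))
  ⟦fromTm⟧ (s ·′ t)   q r = cong₂ _·ᴰ_ (⟦fromTm⟧ s q (λ i → r (∈-++⁺ˡ i)))
                                       (⟦fromTm⟧ t q (λ i → r (∈-++⁺ʳ (constantsᵗ s) i)))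
  ⟦fromTm⟧ ⟪ s , t ⟫′ q r = cong₂ ⟪_,_⟫ᴰ (⟦fromTm⟧ s q (λ i → r (∈-++⁺ˡ i)))
                                         (⟦fromTm⟧ t q (λ i → r (∈-++⁺ʳ (constantsᵗ s) i)))

  Tr-fromCode : ∀ (h : Fin m → HasSets L) (c : Code D m n) {v : Fin n → Fin N}
                {p : Naming (constants c) N} {X e f} →
                (∀ i → f (v i) ≡ e i) → (∀ {d} (i : d ∈ᴸ constants c) → f (p d i) ≡ d) →
                Tr (fromCode h c v p) X f ⟷ ev c X e
  Tr-fromCode h (s ≐′ t) q r = ≡⇒⟷ (cong₂ _≈_ (⟦fromTm⟧ s q (λ i → r (∈-++⁺ˡ i)))
                                              (⟦fromTm⟧ t q (λ i → r (∈-++⁺ʳ (constantsᵗ s) i))))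
  Tr-fromCode h (s <′ t) q r = ≡⇒⟷ (cong₂ _⊏_ (⟦fromTm⟧ s q (λ i → r (∈-++⁺ˡ i)))
                                              (⟦fromTm⟧ t q (λ i → r (∈-++⁺ʳ (constantsᵗ s) i))))
  Tr-fromCode h (t ∈′ i) {X = X} q r = ≡⇒⟷ (cong (X i) (⟦fromTm⟧ t q r))
  Tr-fromCode h ⊥′ q r = ⟷-refl
  Tr-fromCode h (c ∧′ d) q r =
    Tr-fromCode h c q (λ i → r (∈-++⁺ˡ i)) ×-⟷ Tr-fromCode h d q (λ i → r (∈-++⁺ʳ (constants c) i))
  Tr-fromCode h (c ⇒′ d) q r =
    Tr-fromCode h c q (λ i → r (∈-++⁺ˡ i)) →-⟷ Tr-fromCode h d q (λ i → r (∈-++⁺ʳ (constants c) i))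
  Tr-fromCode h (∀<′ t c) {v} {p} {X} {e} {f} q r =
    ∀-⟷ λ d → (⊏-resp ≈-refl bound≈ , ⊏-resp ≈-refl (≈-sym bound≈)) →-⟷ body d
    where
    bound≈ : ∀ {d} → ⟦ wkᵗ (fromTm t v (left p)) ⟧ (d ∷ f) ≈ evᵗ t e
    bound≈ {d} = subst (λ x → ⟦ wkᵗ (fromTm t v (left p)) ⟧ (d ∷ f) ≈ x)
      (⟦fromTm⟧ t q (λ i → r (∈-++⁺ˡ i))) (⟦⟧-sub (λ _ → ≈-refl) (fromTm t v (left p)))
    body : ∀ d → Tr (fromCode h c (zero ∷ (suc ∘ v)) (later (right (constantsᵗ t) p))) X (d ∷ f) ⟷
                 ev c X (d ∷ e)
    body d = Tr-fromCode h c (λ { zero → refl ; (suc i) → q i })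
      (λ i → r (∈-++⁺ʳ (constantsᵗ t) i))

  env : ∀ {a} {B : Set a} → Vec B n → Fin n → B
  env []ᵛ      = []
  env (x ∷ᵛ v) = x ∷ env v

  env-fromList : ∀ {d} {cs : List D} (i : d ∈ᴸ cs) → env (fromList cs) (index i) ≡ d
  env-fromList (here refl) = refl
  env-fromList (there i)   = env-fromList i

  Tr-∀ⁿ* : ∀ n (φ : Formula L m n) {ρ} → Tr (∀ⁿ* n φ) ρ [] → ∀ v → Tr φ ρ (env v)
  Tr-∀ⁿ* zero    φ x []ᵛ      = x
  Tr-∀ⁿ* (suc n) φ x (d ∷ᵛ v) = Tr-∀ⁿ* n (∀ⁿ φ) x v d

  ∀ⁿ*-Tr : ∀ n (φ : Formula L m n) {ρ} → (∀ e → Tr φ ρ e) → Tr (∀ⁿ* n φ) ρ []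
  ∀ⁿ*-Tr zero    φ x = x []
  ∀ⁿ*-Tr (suc n) φ x = ∀ⁿ*-Tr n (∀ⁿ φ) λ e d → x (d ∷ e)

  Tr-resp : ∀ (φ : Formula L m n) {ρ e e′} → (∀ i → Good (ρ i)) → (∀ i → e i ≈ e′ i) →
            Tr φ ρ e → Tr φ ρ e′
  Tr-resp φ g q x = proj₁ (Tr-sub φ g (λ _ → refl) q)
    (proj₂ (Tr-sub {r = id} {σ = var} φ g (λ _ → refl) (λ _ → ≈-refl)) x)

  module _ (𝔅 : Basic 𝔖) where
    open Basic 𝔅

    x+1≈Sx : ∀ x → x +ᴰ Sᴰ 0ᴰ ≈ Sᴰ x
    x+1≈Sx x = ≈-trans (+-Sᴰ _ _) (S-cong (+-0ᴰ _))

    -- The constants occurring in a code become the universally quantified parameters of an instance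
    -- of the scheme.
    base-BΣ₁ : (∀ {φ} → IndΔ₀ φ → Tr φ [] []) → (∀ {φ} → CollΣ₁ φ → Tr φ [] []) → Base {m = 0} []
    base-BΣ₁ trInd trColl = record { good = λ () ; induction = indX ; collection = collX }
      where
      indX : Inductive []
      indX c z s x = proj₁ (at x) (Tr-∀ⁿ* _ _ (trInd (ind φ (fromCode-Δ₀ _ c _ _))) (fromList cs)
        (proj₂ (Tr-sub φ (λ ()) (λ ()) λ { zero → ≈-refl ; (suc i) → ≈-refl }) (proj₂ (at 0ᴰ) z) ,
         λ x y → proj₂ (Tr-sub φ (λ ()) (λ ())
           λ { zero → x+1≈Sx x ; (suc i) → ≈-refl }) (proj₂ (at (Sᴰ x)) (s x (proj₁ (at x) y)))) x)
        where
        cs = constants c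
        φ : Formula L₁ 0 (suc (length cs))
        φ = fromCode (λ ()) c (λ _ → zero) (λ _ i → suc (index i))
        at : ∀ x → Tr φ [] (x ∷ env (fromList cs)) ⟷ ev c [] (x ∷ [])
        at x = Tr-fromCode (λ ()) c (λ { 0F → refl }) env-fromList
      collX : (c : Code D 0 2) → ∀ a → (∀ x → x ⊏ a → C (Σ D λ y → ev c [] (y ∷ x ∷ []))) →
              C (Σ D λ b → ∀ x → x ⊏ a → C (Σ D λ y → y ⊏ b × ev c [] (y ∷ x ∷ [])))
      collX c a h = C-map (λ (b , g) → b , λ x p → C-map (λ (y , q , z) → y , q ,
          proj₁ (at y x) (proj₁ (Tr-sub φ (λ ()) (λ ())
            λ { zero → ≈-refl ; (suc zero) → ≈-refl ; (suc (suc i)) → ≈-refl }) z)) (g x p))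
        (Tr-∀ⁿ* _ _ (trColl (coll φ (Δ₀ (fromCode-Δ₀ _ c _ _)))) (a ∷ᵛ fromList cs)
          λ x p → C-map (λ (y , z) → y , proj₂ (at y x) z) (h x p))
        where
        cs = constants c
        φ : Formula L₁ 0 (suc (suc (suc (length cs))))
        φ = fromCode (λ ()) c (zero ∷ suc zero ∷ []) (λ _ i → suc (suc (suc (index i))))
        at : ∀ y x → Tr φ [] (y ∷ x ∷ a ∷ env (fromList cs)) ⟷ ev c [] (y ∷ x ∷ [])
        at y x = Tr-fromCode (λ ()) c (λ { 0F → refl ; 1F → refl }) env-fromList

-- Collection from composition

BASIC-embed : ∀ {φ} → BASIC {L₁} φ → BASIC {L₂} (embed φ)
BASIC-embed S≢0    = S≢0
BASIC-embed S-inj  = S-inj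
BASIC-embed +-0    = +-0
BASIC-embed +-S    = +-S
BASIC-embed ·-0    = ·-0
BASIC-embed ·-S    = ·-S
BASIC-embed ≮0     = ≮0
BASIC-embed <-S    = <-S
BASIC-embed <-tri  = <-tri
BASIC-embed S-surj = S-surj
BASIC-embed pair   = pair
BASIC-embed p-inj  = p-inj
BASIC-embed p-surj = p-surj
BASIC-embed H-pair = H-pair
BASIC-embed H-0    = H-0
BASIC-embed T-pair = T-pair
BASIC-embed T-0    = T-0

module SecondOrderModel (𝔖 : Str)
  (𝒮 : (Str.D 𝔖 → Set) → Set₁) (𝒮-good : ∀ {X} → 𝒮 X → Str.Good 𝔖 X)
  (axioms : ∀ {φ} → RCA₀⁻ φ → ∀ {w} →
            Truth.Forcing._⊩_[_,_] 𝔖 (Truth.flat 𝔖 𝒮 𝒮-good) w φ [] []) where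

  open Str 𝔖
  open Codes 𝔖
  open Truth 𝔖
  open Forcing (flat 𝒮 𝒮-good)
  open TruthLemmas 𝔖
  open DefinableFormulas 𝔖
  open Parameters 𝔖

  trBASIC : ∀ {φ} → BASIC {L₁} φ → Tr φ [] []
  trBASIC {φ} a = proj₁ (⊩-embed (flat 𝒮 𝒮-good) φ) (axioms (inj₁ (inj₁ (BASIC-embed a))) {_})

  𝔅 : Basic 𝔖
  𝔅 = basic trBASIC

  ⊩-∀ˢ* : ∀ m (φ : Formula L₂ m n) {w e} → w ⊩ ∀ˢ* m φ [ [] , e ] →
          ∀ Xs → (∀ i → 𝒮 (env Xs i)) → w ⊩ φ [ env Xs , e ]
  ⊩-∀ˢ* zero    φ x []ᵛ       s = x
  ⊩-∀ˢ* (suc m) φ x (X ∷ᵛ Xs) s = ⊩-∀ˢ* m (∀ˢ φ) x Xs (s ∘ suc) _ (s zero)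

  ⊩-∀ⁿ* : ∀ n (φ : Formula L m n) {ρ w} → w ⊩ ∀ⁿ* n φ [ ρ , [] ] → ∀ v → w ⊩ φ [ ρ , env v ]
  ⊩-∀ⁿ* zero    φ x []ᵛ      = x
  ⊩-∀ⁿ* (suc n) φ x (d ∷ᵛ v) = ⊩-∀ⁿ* n (∀ⁿ φ) x v d

  comprehend : (Xs : Vec (D → Set) m) → (∀ i → 𝒮 (env Xs i)) →
               {Q : D → Set} → Def {n = 1} (env Xs) (λ e → Q (e 0F)) →
               C (Σ (D → Set) λ Y → 𝒮 Y × (∀ s → Y s ⟷ Q s))
  comprehend {m} Xs s {Q} (def c spec) k =
    ⊩-∀ⁿ* (length cs) body (⊩-∀ˢ* m (∀ⁿ* (length cs) body)
      (axioms (inj₁ (inj₂ (inj₂ (compr φ (fromCode-Δ₀ _ c _ _))))) {_}) Xs s) (fromList cs) _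
      λ _ (Y , y , h) → k (Y , y , λ d →
        (λ u → proj₁ (spec _) (proj₁ (at d) (proj₁ (forces d Y)
          (proj₁ (h d) _ (lift u))))) ,
        (λ u → lower (proj₂ (h d) _ (proj₂ (forces d Y) (proj₂ (at d) (proj₂ (spec _) u))))))
    where
    cs = constants c
    φ : Formula L₂ m (suc (length cs))
    φ = fromCode (λ _ → hasSets) c (λ _ → zero) (λ _ i → suc (index i))
    body : Formula L₂ m (length cs)
    body = ∃ˢ ∀ⁿ (x₀ ∈ 0F ↔ wkˢ φ)
    at : ∀ d → Tr φ (env Xs) (d ∷ env (fromList cs)) ⟷ ev c (env Xs) (d ∷ [])
    at d = Tr-fromCode _ c (λ { 0F → refl }) env-fromList
    forces : ∀ d Y {w} → (w ⊩ wkˢ φ [ Y ∷ env Xs , d ∷ env (fromList cs) ]) ⟷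
                         Tr φ (env Xs) (d ∷ env (fromList cs))
    forces d Y = ⟷-trans (⊩-sub φ (λ i → 𝒮-good (s i)) (λ _ → refl) (λ _ → ≈-refl))
      (⊩⟷Tr (flat 𝒮 𝒮-good) φ (Arith-Δ₀ (fromCode-Δ₀ _ c _ _)))

  -- Comprehension turns the bounded formula into a set, to which `IND` applies.
  induction∈ : (Xs : Vec (D → Set) m) → (∀ i → 𝒮 (env Xs i)) → Inductive (env Xs)
  induction∈ Xs s c z h x = ev-stable (λ i → 𝒮-good (s i)) c do
    (Y , y , u) ← comprehend Xs s {λ d → ev c (env Xs) (d ∷ [])}
                    (def-subst (def-code c) (λ e → e 0F ∷ []) (vr 0F ∷ []) λ { _ 0F → refl })
    return (proj₁ (u x) (lower (axioms (inj₁ (inj₂ (inj₁ refl))) {_} _ y x _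
      (lift (proj₂ (u _) z) , λ x _ w → lift (proj₂ (u _) (h x (proj₁ (u _) (lower w))))))))

  induction₀ : Inductive {m = 0} []
  induction₀ = induction∈ []ᵛ λ ()

  open Arithmetic 𝔅 induction₀

  composite : ∀ {g h} → 𝒮 g → 𝒮 h → IsFunction g → IsFunction h →
              C (Σ (D → Set) λ f → 𝒮 f × IsFunction f ×
                (∀ x y z → h ⟪ x , z ⟫ᴰ × g ⟪ z , y ⟫ᴰ → f ⟪ x , y ⟫ᴰ))
  composite {g} {h} sg sh fg fh k =
    axioms (inj₂ refl) {_} _ sg _ sh _
      (proj₂ (⊩⟷Tr (flat 𝒮 𝒮-good) ((1F ∈ℱ) ∧ (0F ∈ℱ)) _ {ρ = h ∷ g ∷ []} {e = []})
        (function fg , function fh)) _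
      λ _ (f , sf , u) →
        let truth = ⊩⟷Tr (flat 𝒮 𝒮-good) composes _ {ρ = f ∷ h ∷ g ∷ []} {e = []}
            (t , s , n) , c = proj₁ truth u
        in k (f , sf , record { total = t ; single = s ; nonzero = n } , c)
    where
    composes : Formula L₂ 3 0
    composes = (0F ∈ℱ) ∧ (∀ⁿ ∀ⁿ ∀ⁿ ((1F ⟨ x₂ ⟩≐ x₀) ∧ (2F ⟨ x₀ ⟩≐ x₁) ⇒ (0F ⟨ x₂ ⟩≐ x₁)))
    function : ∀ {f} → IsFunction f →
               (∀ x → C (Σ D λ y → f ⟪ x , y ⟫ᴰ)) ×
               (∀ x y y′ → f ⟪ x , y ⟫ᴰ × f ⟪ x , y′ ⟫ᴰ → y ≈ y′) × (f 0ᴰ → R)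
    function p = total , single , nonzero
      where open IsFunction p

  -- Let h map x < a to the least witness for x, and k map b to the least x < a
  -- with h(x) > b, or to a if there is none.  By induction on v, using the
  -- composition f = k ∘ h, some x ≤ v has f(x) > v; for v = a - 1 this x
  -- maximises h below a.
  module Δ₀-Collection (c : Code D 0 2) (a : D)
    (witnesses : ∀ x → x ⊏ a → C (Σ D λ y → ev c [] (y ∷ x ∷ []))) where

    P : D → D → Set
    P x y = ev c [] (y ∷ x ∷ [])

    Pᵈ⟨_,_⟩ : (s t : Tm D n) → Def {m = 0} [] (λ e → P (evᵗ s e) (evᵗ t e))
    Pᵈ⟨ s , t ⟩ = def-subst (def-code c) _ (t ∷ s ∷ []) λ _ → at₂

    P-resp : ∀ {x x′ y y′} → x ≈ x′ → y ≈ y′ → P x y → P x′ y′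
    P-resp p q = ev-resp (λ ()) c λ { 0F → q ; 1F → p }

    -- Minimality makes the function single-valued, and the value 0 outside `x ⊏ a` makes it total.
    LeastWitness : D → D → Set
    LeastWitness x y = (x ⊏ a → P x y × (∀ z → z ⊏ y → P x z → R)) × ((x ⊏ a → R) → y ≈ 0ᴰ)

    leastWitnessᵈ : Def {m = 0} {n = 1} [] (λ e → 0ᴰ ⊏ e 0F × LeastWitness (Hᴰ (e 0F)) (Tᴰ (e 0F)))
    leastWitnessᵈ = def-code (O′ <′ vr 0F) ∧ᵈ
      (def-code (H′ (vr 0F) <′ con a) ⇒ᵈ Pᵈ⟨ H′ (vr 0F) , T′ (vr 0F) ⟩ ∧ᵈ
        ∀ᵈ (T′ (vr 0F)) (¬ᵈ Pᵈ⟨ H′ (vr 1F) , vr 0F ⟩)) ∧ᵈ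
      ((¬ᵈ def-code (H′ (vr 0F) <′ con a)) ⇒ᵈ def-code (T′ (vr 0F) ≐′ O′))

    LeastWitness-resp : ∀ {x x′ y y′} → x ≈ x′ → y ≈ y′ → LeastWitness x y → LeastWitness x′ y′
    LeastWitness-resp p q (u , v) =
      (λ l → let (r , s) = u (⊏-respˡ (≈-sym p) l) in
        P-resp p q r , λ z w t → s z (⊏-respʳ (≈-sym q) w) (P-resp (≈-sym p) ≈-refl t)) ,
      (λ n → ≈-trans (≈-sym q) (v λ l → n (⊏-respˡ p l)))

    module _ (h : D → Set) (sh : 𝒮 h)
      (h-spec : ∀ s → h s ⟷ (0ᴰ ⊏ s × LeastWitness (Hᴰ s) (Tᴰ s))) where

      h-intro : ∀ {x y} → LeastWitness x y → h ⟪ x , y ⟫ᴰ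
      h-intro u = proj₂ (h-spec _) (0⊏⟪⟫ _ _ ,
        LeastWitness-resp (≈-sym (H-pairᴰ _ _)) (≈-sym (T-pairᴰ _ _)) u)

      h-elim : ∀ {x y} → h ⟪ x , y ⟫ᴰ → LeastWitness x y
      h-elim u = LeastWitness-resp (H-pairᴰ _ _) (T-pairᴰ _ _) (proj₂ (proj₁ (h-spec _) u))

      h-function : IsFunction h
      h-function = record
        { total = λ x → do
            inj₁ l ← lem (x ⊏ a)
              where inj₂ n → return (0ᴰ , h-intro ((λ l → ⊥-R (n l)) , λ _ → ≈-refl))
            (y , p) ← witnesses x l
            (y , p , q) ← least induction₀ Pᵈ⟨ con x , vr 0F ⟩ p
            return (y , h-intro ((λ _ → p , q) , λ n → ≈-stable λ _ → n l))
        ; single = λ x y y′ (p , q) → ≈-stable do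
            inj₁ l ← lem (x ⊏ a)
              where inj₂ n → return (≈-trans (proj₂ (h-elim p) n) (≈-sym (proj₂ (h-elim q) n)))
            inj₂ t ← triᴰ y y′
              where inj₁ t → λ _ → proj₂ (proj₁ (h-elim q) l) y t (proj₁ (proj₁ (h-elim p) l))
            inj₁ t ← t
              where inj₂ t → λ _ → proj₂ (proj₁ (h-elim p) l) y′ t (proj₁ (proj₁ (h-elim q) l))
            return t
        ; nonzero = λ p → ≮0ᴰ (proj₁ (proj₁ (h-spec _) p))
        }
        where
        ⊥-R : ∀ {x y} → R → P x y × (∀ z → z ⊏ y → P x z → R)
        ⊥-R r = ev-stable (λ ()) c (λ _ → r) , λ _ _ _ → r

      -- h(x) > b
      Big : D → D → Set
      Big x b = ∀ y → y ⊏ Sᴰ b → h ⟪ x , y ⟫ᴰ → R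

      Bigᵈ⟨_,_⟩ : (s t : Tm D n) → Def {m = 1} (env (h ∷ᵛ []ᵛ)) (λ e → Big (evᵗ s e) (evᵗ t e))
      Bigᵈ⟨ s , t ⟩ = def-subst {Q = λ e → Big (e 0F) (e 1F)}
        (∀ᵈ (S′ (vr 1F)) (¬ᵈ def-code (⟪ vr 1F , vr 0F ⟫′ ∈′ 0F))) _ (s ∷ t ∷ []) λ _ → at₂

      Big-resp : ∀ {x x′ b b′} → x ≈ x′ → b ≈ b′ → Big x b → Big x′ b′
      Big-resp p q u y l v = u y (⊏-respʳ (S-cong (≈-sym q)) l)
        (Good.resp (𝒮-good sh) (⟪⟫-cong (≈-sym p) ≈-refl) v)

      LeastBig : D → D → Set
      LeastBig b x = x ⊏ Sᴰ a × (∀ z → z ⊏ x → Big z b → R) × (x ⊏ a → Big x b)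

      LeastBig-resp : ∀ {b b′ x x′} → b ≈ b′ → x ≈ x′ → LeastBig b x → LeastBig b′ x′
      LeastBig-resp p q (u , v , w) = ⊏-respˡ q u ,
        (λ z l t → v z (⊏-respʳ (≈-sym q) l) (Big-resp ≈-refl (≈-sym p) t)) ,
        (λ l → Big-resp q p (w (⊏-respˡ (≈-sym q) l)))

      sets₁ : ∀ {X} → 𝒮 X → ∀ i → 𝒮 (env (X ∷ᵛ []ᵛ) i)
      sets₁ s zero = s

      leastBigᵈ : Def {m = 1} {n = 1} (env (h ∷ᵛ []ᵛ))
                    (λ e → 0ᴰ ⊏ e 0F × LeastBig (Hᴰ (e 0F)) (Tᴰ (e 0F)))
      leastBigᵈ = def-code (O′ <′ vr 0F) ∧ᵈ def-code (T′ (vr 0F) <′ S′ (con a)) ∧ᵈ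
        ∀ᵈ (T′ (vr 0F)) (¬ᵈ Bigᵈ⟨ vr 0F , H′ (vr 1F) ⟩) ∧ᵈ
        (def-code (T′ (vr 0F) <′ con a) ⇒ᵈ Bigᵈ⟨ T′ (vr 0F) , H′ (vr 0F) ⟩)

      module _ (k : D → Set) (k-spec : ∀ s → k s ⟷ (0ᴰ ⊏ s × LeastBig (Hᴰ s) (Tᴰ s))) where

        k-intro : ∀ {b x} → LeastBig b x → k ⟪ b , x ⟫ᴰ
        k-intro u = proj₂ (k-spec _) (0⊏⟪⟫ _ _ ,
          LeastBig-resp (≈-sym (H-pairᴰ _ _)) (≈-sym (T-pairᴰ _ _)) u)

        k-elim : ∀ {b x} → k ⟪ b , x ⟫ᴰ → LeastBig b x
        k-elim u = LeastBig-resp (H-pairᴰ _ _) (T-pairᴰ _ _) (proj₂ (proj₁ (k-spec _) u))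

        LeastBig-unique-⊏ : ∀ {b x x′} → LeastBig b x → LeastBig b x′ → x ⊏ x′ → R
        LeastBig-unique-⊏ (u , v , w) (u′ , v′ , w′) l = v′ _ l (w (⊏-⊏S-trans l u′))

        k-function : IsFunction k
        k-function = record
          { total = λ b → do
              (x , (u , v) , w) ← least (induction∈ (h ∷ᵛ []ᵛ) (sets₁ sh))
                {λ x → x ⊏ Sᴰ a × (x ⊏ a → Big x b)}
                (def-code (vr 0F <′ S′ (con a)) ∧ᵈ
                  (def-code (vr 0F <′ con a) ⇒ᵈ Bigᵈ⟨ vr 0F , con b ⟩))
                {a} (x⊏Sx a , λ l → λ _ _ _ → ⊏-irrefl l)
              return (x , k-intro (u , (λ z l t → w z l (⊏-trans l u , λ _ → t)) , v))
          ; single = λ b x x′ (p , q) → ≈-stable do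
              inj₂ t ← triᴰ x x′
                where inj₁ t → λ _ → LeastBig-unique-⊏ (k-elim p) (k-elim q) t
              inj₁ t ← t
                where inj₂ t → λ _ → LeastBig-unique-⊏ (k-elim q) (k-elim p) t
              return t
          ; nonzero = λ p → ≮0ᴰ (proj₁ (proj₁ (k-spec _) p))
          }

        module _ (f : D → Set) (sf : 𝒮 f) (f-function : IsFunction f)
          (f-comp : ∀ x y z → h ⟪ x , z ⟫ᴰ × k ⟪ z , y ⟫ᴰ → f ⟪ x , y ⟫ᴰ) where

          value : ∀ x → C (Σ D λ z → Σ D λ w → h ⟪ x , z ⟫ᴰ × LeastBig z w × f ⟪ x , w ⟫ᴰ)
          value x = do
            (z , p) ← IsFunction.total h-function x
            (w , q) ← IsFunction.total k-function z
            return (z , w , p , k-elim q , f-comp x w z (p , q))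

          -- This is bounded in `f`. Written with `h` and `k` it would quantify over the value of
          -- `h`, which has no bound, and induction would not be available.
          Record : D → Set
          Record v = v ⊏ a → C (Σ D λ x → x ⊏ Sᴰ v × C (Σ D λ w → w ⊏ Sᴰ a × v ⊏ w × f ⟪ x , w ⟫ᴰ))

          not-small : ∀ {x z w} → x ⊏ a → h ⟪ x , z ⟫ᴰ → LeastBig z w → w ≈ x → R
          not-small l p (u , v , t) e = Big-resp e ≈-refl (t (⊏-respˡ (≈-sym e) l)) _ (x⊏Sx _) p

          -- Let f(x) > v. If f(x) > v + 1, the same `x` serves. Otherwise f(x) = v + 1, so h(v + 1)
          -- > h(x), while no `z ≤ v` has h(z) > h(x). Then f(v + 1) > v + 1: it is not `v + 1`
          -- itself, and a smaller value would be some `z ≤ v` with h(z) > h(v + 1) > h(x).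
          records : ∀ v → Record v
          records = inductᵈ (induction∈ (f ∷ᵛ []ᵛ) (sets₁ sf))
            (def-code (vr 0F <′ con a) ⇒ᵈ ∃ᵈ (S′ (vr 0F)) (∃ᵈ (S′ (con a))
              (def-code (vr 2F <′ vr 0F ∧′ ⟪ vr 1F , vr 0F ⟫′ ∈′ 0F))))
            (λ l → do
              (z , w , p , q , r) ← value 0ᴰ
              inj₁ t ← compare 0ᴰ w
                where inj₂ t → do
                        inj₂ t ← <-Sᴰ t
                          where inj₁ t → λ _ → ≮0ᴰ t
                        λ _ → not-small l p q t
              return (0ᴰ , x⊏Sx 0ᴰ , return (w , proj₁ q , t , r)))
            (λ v ih l → do
              (x , x≤v , s) ← ih (S-⊏⇒⊏ l)
              (w , w≤a , v<w , r) ← s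
              inj₂ w≤Sv ← compare (Sᴰ v) w
                where inj₁ t → return (x , ⊏⇒⊏S x≤v , return (w , w≤a , t , r))
              (z , w₁ , p₁ , q₁ , r₁) ← value x
              let w≈w₁ = IsFunction.single f-function x w w₁ (r , r₁)
                  w₁≈Sv = ≈-trans (≈-sym w≈w₁) (⊏S-antisym w≤Sv (S-mono v<w))
                  (_ , small , big) = LeastBig-resp ≈-refl w₁≈Sv q₁
              (z₂ , w₂ , p₂ , q₂ , r₂) ← value (Sᴰ v)
              inj₂ w₂≤Sv ← compare (Sᴰ v) w₂
                where inj₁ t → return (Sᴰ v , x⊏Sx _ , return (w₂ , proj₁ q₂ , t , r₂))
              inj₁ w₂<Sv ← <-Sᴰ w₂≤Sv
                where inj₂ e → λ _ → not-small l p₂ q₂ e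
              inj₂ z≤z₂ ← compare z₂ (Sᴰ z)
                where inj₁ t → λ _ → big l z₂ t p₂
              λ _ → small w₂ w₂<Sv λ y t u →
                proj₂ (proj₂ q₂) (⊏-trans w₂<Sv l) y (⊏S-trans t (S-⊏⇒⊏ z≤z₂)) u)

          bounded-witnesses : C (Σ D λ b → ∀ x → x ⊏ a → C (Σ D λ y → y ⊏ b × P x y))
          bounded-witnesses = do
            inj₂ (v , e) ← zero-or-suc a
              where inj₁ e → return (0ᴰ , λ x l _ → ≮0ᴰ (⊏-respʳ e l))
            (x , x≤v , s) ← records v (⊏-respʳ e (x⊏Sx v))
            (w , w≤a , v<w , r) ← s
            (z , w₁ , p , q , r₁) ← value x
            let w≈w₁ = IsFunction.single f-function x w w₁ (r , r₁)
                a≤w₁ = ⊏-respʳ (S-cong w≈w₁) (⊏-respˡ e (S-mono v<w))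
            -- Now v < w ≤ a forces `w` to be `a`, so no `x′ < a` has h(x′) > z; the least witnesses
            -- are at most `z`.
            return (Sᴰ z , λ x′ l k → proj₁ (proj₂ q) x′ (⊏-⊏S-trans l a≤w₁) λ y t u →
              k (y , t , proj₁ (proj₁ (h-elim u) l)))

    collection : C (Σ D λ b → ∀ x → x ⊏ a → C (Σ D λ y → y ⊏ b × P x y))
    collection = do
      (h , sh , h-spec) ← comprehend []ᵛ (λ ()) leastWitnessᵈ
      (k , sk , k-spec) ← comprehend (h ∷ᵛ []ᵛ) (λ { zero → sh }) (leastBigᵈ h sh h-spec)
      (f , sf , f-function , f-comp) ← composite sk sh (k-function h sh h-spec k k-spec)
                                         (h-function h sh h-spec)
      bounded-witnesses h sh h-spec k k-spec f sf f-function f-comp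

  -- Adjacent existential quantifiers are contracted by pairing, and by `H-≤` the bound on the pair
  -- also bounds its first component. `σ` tells how the variables of `φ` are read off from the
  -- witness and `x`.
  Σ₁-collection : ∀ {φ : Formula L₁ 0 N} → IsΣ₁ φ → ∀ (σ : Fin N → Tm D 2) a →
    (∀ x → x ⊏ a → C (Σ D λ y → Tr φ [] (λ i → evᵗ (σ i) (y ∷ x ∷ [])))) →
    C (Σ D λ b → ∀ x → x ⊏ a → C (Σ D λ y → y ⊏ b × Tr φ [] (λ i → evᵗ (σ i) (y ∷ x ∷ []))))
  Σ₁-collection (Δ₀ δ) σ a h =
    let def c spec = subᵈ σ (Tr-def δ)
    in C-map (λ (b , g) → b , λ x l → C-map (λ (y , p , q) → y , p , proj₁ (spec _) q) (g x l))
         (Δ₀-Collection.collection c a λ x l → C-map (λ (y , p) → y , proj₂ (spec _) p) (h x l))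
  Σ₁-collection {N} (ex {φ} p) σ a h = do
    (b , g) ← Σ₁-collection p σ′ a λ x l → do
      (y , u) ← h x l
      (z , u) ← u
      return (⟪ y , z ⟫ᴰ , Tr-resp φ (λ ()) (λ where
        zero    → ≈-sym (T-pairᴰ y z)
        (suc i) → ≈-trans (evᵗ-resp (λ { 0F → ≈-sym (H-pairᴰ y z) ; 1F → ≈-refl }) (σ i))
                    (≈-reflexive (sym (evᵗ-tsub at₂ (σ i))))) u)
    return (b , λ x l → do
      (q , r , u) ← g x l
      return (Hᴰ q , ⊏S-⊏-trans (H-≤ q) r , return (Tᴰ q , Tr-resp φ (λ ()) (λ where
        zero    → ≈-refl
        (suc i) → ≈-reflexive (evᵗ-tsub at₂ (σ i))) u)))
    where
    ≈-reflexive : ∀ {x y} → x ≡ y → x ≈ y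
    ≈-reflexive refl = ≈-refl
    σ′ : Fin (suc N) → Tm D 2
    σ′ zero    = T′ (vr 0F)
    σ′ (suc i) = tsub (σ i) (H′ (vr 0F) ∷ vr 1F ∷ [])

  trInd : ∀ {φ} → IndΔ₀ φ → Tr φ [] []
  trInd (ind {n} φ δ) = ∀ⁿ*-Tr n _ λ e (z , s) → inductᵈ induction₀
    {λ x → Tr φ [] (x ∷ e)}
    (def-subst (Tr-def δ) (λ f → f 0F ∷ e) (vr 0F ∷ λ i → con (e i))
      (λ { f zero → refl ; f (suc i) → refl }))
    (proj₁ (Tr-sub φ (λ ()) (λ ()) λ { zero → ≈-refl ; (suc i) → ≈-refl }) z)
    (λ x u → proj₁ (Tr-sub φ (λ ()) (λ ()) λ { zero → x+1≈Sx 𝔅 x ; (suc i) → ≈-refl }) (s x u))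

  trColl : ∀ {φ} → CollΣ₁ φ → Tr φ [] []
  trColl (coll {n} φ p) = ∀ⁿ*-Tr (suc n) _ λ e h →
    let σ : Fin (suc (suc (suc n))) → Tm D 2
        σ = vr 0F ∷ vr 1F ∷ λ i → con (e i)
        at : ∀ y x i → (y ∷ x ∷ e) i ≈ evᵗ (σ i) (y ∷ x ∷ [])
        at = λ { y x zero → ≈-refl ; y x (suc zero) → ≈-refl ; y x (suc (suc i)) → ≈-refl }
    in C-map (λ (b , g) → b , λ x l → C-map (λ (y , q , u) → y , q ,
           proj₂ (Tr-sub φ {e′ = y ∷ x ∷ e} (λ ()) (λ ())
             λ { zero → ≈-refl ; (suc zero) → ≈-refl ; (suc (suc i)) → ≈-refl })
             (Tr-resp φ (λ ()) (λ i → ≈-sym (at y x i)) u)) (g x l))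
         (Σ₁-collection p σ (e zero) λ x l →
           C-map (λ (y , u) → y , Tr-resp φ (λ ()) (at y x) u) (h x l))

  trBΣ₁ : ∀ {φ} → BΣ₁ φ → Tr φ [] []
  trBΣ₁ (inj₁ (inj₁ a)) = trBASIC a
  trBΣ₁ (inj₁ (inj₂ a)) = trInd a
  trBΣ₁ (inj₂ a)        = trColl a

-- The two conservation results

module BΣ₁-Model (φ : Sentence L₁) where

  extract : BΣ₁ ∣ inScope {m = 0} {n = 0} (¬ φ) ∷ᴸ []ᴸ ⊢ ⊥ → BΣ₁ ⊢ φ
  extract d = raa (subst (λ ψ → BΣ₁ ∣ ψ ∷ᴸ []ᴸ ⊢ ⊥) (sub-id (λ ()) (λ ()) (¬ φ)) d)

  no-sets : HasSets L₁ → ℕ → Fin 0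
  no-sets ()

  open Henkin BΣ₁ φ 0 no-sets extract public
  open Str 𝔐
  open Truth 𝔐
  open TruthLemmas 𝔐
  open Codes 𝔐
  open Forcing 𝔉
  open Parameters 𝔐

  trBΣ₁ : ∀ {ψ} → BΣ₁ ψ → Tr ψ [] []
  trBΣ₁ {ψ} a = proj₁ (⊩⟷Tr 𝔉 ψ (Arith-L₁ ψ)) (model a {_})

  trIΔ₀ : ∀ {ψ} → IΔ₀ ⊢ ψ → Tr ψ [] []
  trIΔ₀ {ψ} d = proj₁ (⊩⟷Tr 𝔉 ψ (Arith-L₁ ψ))
    (Soundness.sound (λ a → model (inj₁ a)) d {w = _} (λ ()) []ᵃ)

  base₀ : Base []
  base₀ = base-BΣ₁ (basic (λ a → trBΣ₁ (inj₁ (inj₁ a)))) (λ a → trBΣ₁ (inj₁ (inj₂ a)))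
            (λ a → trBΣ₁ (inj₂ a))

  open Worlds 𝔐 (λ a → trBΣ₁ (inj₁ (inj₁ a))) countable-Dᵗ base₀ public

  -- Soundness is used at the world without sets. The sentence is arithmetical, so being forced
  -- there means truth in the Henkin model, which yields provability.
  reflect : ∀ {𝒯} → (∀ {ψ} → 𝒯 ψ → ∀ {w} → Forcing._⊩_[_,_] worlds w ψ [] []) →
            𝒯 ⊢ embed φ → BΣ₁ ⊢ φ
  reflect force d = complete {_} (proj₂ (⊩⟷Tr 𝔉 φ (Arith-L₁ φ))
    (proj₁ (⊩-embed worlds φ {world [] base₀} {[]} {[]})
      (Forcing.Soundness.sound worlds force d {w = world [] base₀} (λ ()) []ᵃ)))

module SecondOrder (𝒯 : Theory L₂) (RCA⊆𝒯 : ∀ {φ} → RCA₀⁻ φ → 𝒯 φ) (φ : Sentence L₁) where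

  -- The empty set exists, so that a set variable may be brought into scope.
  extract : 𝒯 ∣ inScope {m = 1} {n = 0} (¬ embed φ) ∷ᴸ []ᴸ ⊢ ⊥ → 𝒯 ⊢ embed φ
  extract d = raa (∃ˢE (axiom (RCA⊆𝒯 (inj₁ (inj₂ (inj₂ (compr {m = 0} {n = 0} ⊥ bot))))))
    (weaken (λ { (here p) → there (here (trans p (sub-cong (λ ()) (λ ()) (¬ embed φ)))) }) d))

  open Henkin 𝒯 (embed φ) 1 (λ _ _ → zero) extract
  open Truth 𝔐
  open TruthLemmas 𝔐
  open Forcing 𝔉
  open SecondOrderModel 𝔐 _ (Frame.𝒳-good 𝔉) (λ a → model (RCA⊆𝒯 a))

  -- The Henkin model of any theory that includes `RCA₀⁻` satisfies `BΣ₁` by the argument from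
  -- composition, hence also `φ`.
  transfer : BΣ₁ ⊢ φ → 𝒯 ⊢ embed φ
  transfer d = complete {_} (proj₂ (⊩-embed 𝔉 φ {_} {[]} {[]}) (proj₁ (⊩⟷Tr 𝔉 φ (Arith-L₁ φ))
    (Soundness.sound (λ {ψ} a → proj₂ (⊩⟷Tr 𝔉 ψ (Arith-L₁ ψ)) (trBΣ₁ a)) d {w = _} (λ ()) []ᵃ)))

corollary5p10 : (φ : Sentence L₁) →
    ((exp : ExpGraph) → (WKL₀⁻ exp ⊢ embed φ) ⇔ (RCA₀⁻ ⊢ embed φ))
    × ((RCA₀⁻ ⊢ embed φ) ⇔ (BΣ₁ ⊢ φ))
corollary5p10 φ =
  (λ exp → mk⇔ (fromBΣ₁ ∘ reflect (force-WKL₀⁻ exp trIΔ₀))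
               (SecondOrder.transfer (WKL₀⁻ exp) inj₁ φ ∘ toBΣ₁)) ,
  mk⇔ toBΣ₁ fromBΣ₁
  where
  open BΣ₁-Model φ using (reflect; force-RCA₀⁻; force-WKL₀⁻; trIΔ₀)
  toBΣ₁ : RCA₀⁻ ⊢ embed φ → BΣ₁ ⊢ φ
  toBΣ₁ = reflect force-RCA₀⁻
  fromBΣ₁ : BΣ₁ ⊢ φ → RCA₀⁻ ⊢ embed φ
  fromBΣ₁ = SecondOrder.transfer RCA₀⁻ id φ
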